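{- For all positive integers $m$ and $n$, the following identity holds in $\mathcal{A}_1$: $$R_{n}^{(m,1)} =\frac{n!}{m}\sum_{\substack{1\le \ell\le \lfloor n/3 \rfloor\\ k_1+\dots+k_\ell=m,\ k_j\ge 1\ \forall j \\ a_1+\dots+a_\ell\vdash n }}\ \prod_{j=1}^{\ell-1}\frac{1}{k_1+\cdots+k_j}\ \prod_{j=1}^\ell \left[\binom{k_j+a_j-1}{a_j}-\binom{k_j}{a_j}\right] \mathfrak{b}_{a_j}.$$
   Context: For a prime $p$ and positive integers $n,m,r$, $R_n^{(m)}(p^r):=\sum \frac{1}{l_1\cdots l_n}$, summed over positive integers $l_1,\dots,l_n$ not divisible by $p$ with $l_1+\dots+l_n=mp^r$. Let $\mathcal{A}_\ell:=\prod_{p}(\mathbb{Z}/p^\ell\mathbb{Z})/\bigoplus_{p}(\mathbb{Z}/p^\ell\mathbb{Z})$ over all primes $p$; a family of rationals $(x_p)_p$ which are $p$-integral for all large $p$ defines an element of $\mathcal{A}_\ell$ by reduction mod $p^\ell$, and two such families are equal in $\mathcal{A}_\ell$ iff $x_p\equiv y_p \pmod{p^\ell}$ for all sufficiently large primes $p$. $R_n^{(m,r)}:=(R_n^{(m)}(p^r) \bmod p^r)_p\in\mathcal{A}_r$. The $\mathcal{A}$-Bernoulli number is $\mathfrak{b}_k:=(-B_{p-k}/k \bmod p)_{p>k}\in\mathcal{A}_1$, where $B_j$ is the $j$-th Bernoulli number. The condition $a_1+\dots+a_\ell\vdash n$ means $a_1,\dots,a_\ell$ are odd integers $\ge3$ with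 sum $n$ (ordered tuples). -}

module Defs where

open import Data.Nat using (ℕ; zero; suc; _+_; _*_; _∸_; _≤_; _<_; _≤ᵇ_; _!)
open import Data.Nat.Divisibility using (_∣_; _∣?_)
open import Data.Nat.DivMod using (_/_; _%_)
open import Data.Nat.Combinatorics using (_C_)
open import Data.Integer as ℤ using (ℤ; +_)
open import Data.Rational as ℚ using (ℚ; 0ℚ; 1ℚ; ↥_)
open import Data.List using (List; []; _∷_; map; concatMap; upTo; downFrom; zipWith; filter; foldr)
open import Data.Bool using (Bool; true; false; _∧_; not)
open import Relation.Nullary.Decidable using (does)

sumℚ : List ℚ → ℚ
sumℚ = foldr ℚ._+_ 0ℚ

prodℚ : List ℚ → ℚ
prodℚ = foldr ℚ._*_ 1ℚ

ℕtoℚ : ℕ → ℚ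
ℕtoℚ k = (+ k) ℚ./ 1

ℤtoℚ : ℤ → ℚ
ℤtoℚ z = z ℚ./ 1

-- reciprocal of a natural number (only ever applied to positive numbers;
-- the value at 0 is an irrelevant junk value 0)
recip : ℕ → ℚ
recip zero    = 0ℚ
recip (suc k) = (+ 1) ℚ./ suc k

-- Bernoulli numbers (convention B_1 = -1/2), via the recursion
-- B_0 = 1,  B_n = -1/(n+1) Σ_{k=0}^{n-1} C(n+1,k) B_k.
-- bernoulliRev n = [B_n, B_{n-1}, ..., B_0]
bernoulliRev : ℕ → List ℚ
bernoulliRev zero    = 1ℚ ∷ []
bernoulliRev (suc n) = next ∷ prev
  where
  prev : List ℚ
  prev = bernoulliRev n
  next : ℚ
  next = ℚ.- (recip (suc (suc n)) ℚ.*
           sumℚ (zipWith (λ k b → ℕtoℚ ((suc (suc n)) C k) ℚ.* b) (downFrom (suc n)) prev))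

headOr : ℚ → List ℚ → ℚ
headOr d []      = d
headOr d (x ∷ _) = x

bernoulli : ℕ → ℚ
bernoulli n = headOr 0ℚ (bernoulliRev n)

compositions : ℕ → ℕ → List (List ℕ)
compositions zero    zero    = [] ∷ []
compositions zero    (suc _) = []
compositions (suc k) N       =
  concatMap (λ l → map (l ∷_) (compositions k (N ∸ l))) (map suc (upTo N))

allB : (ℕ → Bool) → List ℕ → Bool
allB f = foldr (λ x b → f x ∧ b) true

notDivBy : ℕ → ℕ → Bool
notDivBy p l = not (does (p ∣? l))

-- R_n^{(m)}(p^r) = Σ 1/(l_1⋯l_n), l_i ≥ 1, p ∤ l_i, l_1+⋯+l_n = m p^r  (here with q = p^r)
R : ℕ → ℕ → ℕ → ℕ → ℚ
R n m p q =
  sumℚ (map (λ ls → recip (foldr _*_ 1 ls))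
            (filter (λ ls → allB (notDivBy p) ls Data.Bool.≟ true)
                    (compositions n (m * q))))
  where import Data.Bool

oddGe3 : ℕ → Bool
oddGe3 a = (3 ≤ᵇ a) ∧ not (does ((a % 2) Data.Nat.≟ 0))
  where import Data.Nat

oddComps : ℕ → ℕ → List (List ℕ)
oddComps ℓ n = filter (λ as → allB oddGe3 as Data.Bool.≟ true) (compositions ℓ n)
  where import Data.Bool

initPartialSums : List ℕ → List ℕ
initPartialSums = go 0
  where
  go : ℕ → List ℕ → List ℕ
  go acc []           = []
  go acc (x ∷ [])     = []
  go acc (x ∷ y ∷ r)  = (acc + x) ∷ go (acc + x) (y ∷ r)

frakB : ℕ → ℕ → ℚ
frakB p a = ℚ.- (bernoulli (p ∸ a) ℚ.* recip a)

factor : ℕ → ℕ → ℕ → ℚ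
factor p k a = ℤtoℚ ((+ ((k + a ∸ 1) C a)) ℤ.- (+ (k C a))) ℚ.* frakB p a

RHS : ℕ → ℕ → ℕ → ℚ
RHS n m p =
  ℕtoℚ (n !) ℚ.* recip m ℚ.*
  sumℚ (concatMap
         (λ ℓ → concatMap
           (λ ks → map
             (λ as → prodℚ (map recip (initPartialSums ks)) ℚ.*
                     prodℚ (zipWith (factor p) ks as))
             (oddComps ℓ n))
           (compositions ℓ m))
         (map suc (upTo (n / 3))))

-- congruence of rationals modulo a natural q: q divides the numerator of
-- x - y in lowest terms (for p-integral x,y and q = p^r this is x ≡ y mod p^r)
_≡ℚ_[mod_] : ℚ → ℚ → ℕ → Set
x ≡ℚ y [mod q ] = q ∣ ℤ.∣ ↥ (x ℚ.- y) ∣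

-- Let L = Σ l⁻¹ x^l over the l ≥ 1 prime to p, so that R_n^(m)(p)/n! is the coefficient of t^n x^(mp) in exp(tL).
-- Modulo p, the variable y = x^p is a constant for x d/dx, and exp(tL) = Σ_{i<p} e_i x^i with e_i ∈ F_p[[y]][[t]].
-- As x L′ = x/(1-x) - y/(1-y), the equation x d/dx exp(tL) = t x L′ exp(tL) becomes the two-term recursion
-- (i+1+B) e_{i+1} = (i+A) e_i with A = tw, B = tu, w = 1/(1-y), u = y/(1-y), while the x^0-part of
-- d/dt exp(tL) = L exp(tL) reads t ∂e_0/∂t = - B Σ_{0<i<p} e_i/i. Solving the recursion turns the latter sum
-- into e_0 Q(A,B)/(p-1)! for a polynomial Q with (A-B)(Q(A+1,B) - Q(A,B)) = (A+1)⋯(A+p-1) - (B+1)⋯(B+p-1) and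
-- Q(0,B) = 0; as this difference is (p-1)!(B^(p-1) - A^(p-1)), Q is a combination of the Faulhaber polynomials
-- of A, and its coefficients are Bernoulli numbers. Modulo t^(p-1) this gives t ∂e_0/∂t = Φ e_0 with
-- Φ = Σ_a B_{p-a}/a (1 + u^a - w^a) t^a over the odd a ≥ 3.
-- On the other side, the sum over the k_j and a_j is the coefficient of y^m t^n in X = exp(H), where
-- H = Σ_{k,a} k⁻¹ (C(k+a-1,a) - C(k,a)) 𝔟_a y^k t^a: peeling off the last letter shows y ∂X/∂y = (y ∂H/∂y) X,
-- hence t ∂X/∂t = (t ∂H/∂t) X, and t ∂H/∂t reduces to Φ modulo p.
module Submission where

open import Defs
open import Algebra.Bundles using (CommutativeRing)
open import Algebra.Structures using (IsCommutativeRing)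
open import Data.Bool as Bool using (Bool; true; false; _∧_; not; if_then_else_)
open import Data.Bool.Properties using (∧-zeroʳ)
open import Data.Integer as ℤ using (ℤ; +_; -[1+_])
import Data.Integer.Properties as ℤₚ
open import Data.List using (List; []; _∷_; _++_; map; concatMap; upTo; downFrom; applyUpTo; zipWith; filter; foldr)
open import Data.List.Properties using (map-id)
open import Data.Maybe using (Maybe; just; nothing)
open import Data.Nat as ℕ using (ℕ; zero; suc; _≤_; _<_; _≤ᵇ_; _!)
open import Data.Nat.Combinatorics using (_C_; nCn≡1; k>n⇒nCk≡0; nCk≡nC[n∸k]; nCk+nC[k+1]≡[n+1]C[k+1])
open import Data.Nat.DivMod using (_/_; _%_; m≡m%n+[m/n]*n; m%n<n; m/n≤m)
open import Data.Nat.Divisibility using (_∣_; _∣?_; divides; ∣m+n∣m⇒∣n; ∣-refl; ∣m∣n⇒∣m+n; >⇒∤; ∣1⇒≡1; _∣0; m%n≡0⇒n∣m)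
open import Data.Nat.ListAction using (sum)
open import Data.Nat.Primality using (Prime; euclidsLemma; ¬prime[1]; prime⇒irreducible)
import Data.Nat.Properties as ℕₚ
import Data.Nat.Solver as ℕ-Solver
open import Data.Product using (Σ; _×_; _,_; ∃-syntax)
open import Data.Rational as ℚ using (ℚ; 0ℚ; 1ℚ; ↥_; ↧ₙ_; fromℚᵘ)
import Data.Rational.Properties as ℚₚ
open import Data.Rational.Unnormalised as ℚᵘ using (ℚᵘ; mkℚᵘ; *≡*)
import Data.Rational.Unnormalised.Properties as ℚᵘₚ
open import Data.Sum using (_⊎_; inj₁; inj₂)
open import Data.Unit using (⊤; tt)
open import Function using (_∘_; id; flip)
open import Level using (0ℓ)
open import Relation.Binary.PropositionalEquality as ≡ using (_≡_; _≢_)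
open import Relation.Nullary using (¬_; Dec; yes; no; does; contradiction)
open import Relation.Nullary.Decidable using (dec-false)

-- Division is the obstacle. Modulo p only 1, ..., p-1 may be inverted, and the coefficients of
-- exp(tL) are power series in y, where no count of roots in a field is available. Two choices cope
-- with this. The exponential is cut off at t^(p-1), which keeps all factorials invertible and makes
-- B nilpotent, so that (B+1)⋯(B+p-1) collapses to (p-1)!. And the identity that evaluates Q is
-- first proved with A in the prime field, where shifting A by 1 is an induction and differences of
-- points are units; it passes to A = tw because both sides have degree less than p in A. The number
-- B_(p-1), which is not p-integral, belongs to a = 1. It may be replaced by any value, since 1 + u
-- - w = 0. The partial sums k_1, k_1+k_2, ..., m in the denominators are what iterated integration
-- of y ∂X/∂y = (y ∂H/∂y) X produces; as the coefficients commute, the solution is exp(H). The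
-- exponential itself is never formed: both sides are compared through the recursion on the
-- coefficients of t that t ∂X/∂t = (t ∂H/∂t) X gives.

∸-suc : ∀ {i n} → i ℕ.< n → n ℕ.∸ i ≡ suc (n ℕ.∸ suc i)
∸-suc = ℕₚ.+-∸-assoc 1

-- Commutative rings: integer multiples, a ring solver, finite sums

module RingTools (R : CommutativeRing 0ℓ 0ℓ) where
  open CommutativeRing R public hiding (zero)
  open import Algebra.Properties.Ring ring public
    using (-‿distribˡ-*; -‿distribʳ-*; -‿involutive; -0#≈0#; -‿+-comm)
  open import Algebra.Properties.Semiring.Mult semiring using (×-homo-+; ×1-homo-*) renaming (_×_ to _·_)
  open import Algebra.Properties.Semiring.Exp semiring public using (_^_; ^-congˡ; ^-homo-*)
  open import Relation.Binary.Reasoning.Setoid setoid public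
  open import Algebra.Solver.Ring.AlmostCommutativeRing
    using (fromCommutativeRing; _-Raw-AlmostCommutative⟶_)

  ι : ℕ → Carrier
  ι n = n · 1#

  ι-+ : ∀ m n → ι (m ℕ.+ n) ≈ ι m + ι n
  ι-+ = ×-homo-+ 1#

  ι-* : ∀ m n → ι (m ℕ.* n) ≈ ι m * ι n
  ι-* = ×1-homo-*

  ι-1 : ι 1 ≈ 1#
  ι-1 = +-identityʳ 1#

  ι-periodic : ∀ {p} → ι p ≈ 0# → ∀ n → ι (p ℕ.+ n) ≈ ι n
  ι-periodic {p} h n = trans (ι-+ p n) (trans (+-congʳ h) (+-identityˡ (ι n)))

  ι-cong : ∀ {m n} → m ≡ n → ι m ≈ ι n
  ι-cong ≡.refl = refl

  +-cancelʳ′ : ∀ c {a b} → a + c ≈ b + c → a ≈ b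
  +-cancelʳ′ c {a} {b} h = begin
    a               ≈⟨ +-identityʳ a ⟨
    a + 0#          ≈⟨ +-congˡ (-‿inverseʳ c) ⟨
    a + (c + - c)   ≈⟨ +-assoc a c (- c) ⟨
    (a + c) + - c   ≈⟨ +-congʳ h ⟩
    (b + c) + - c   ≈⟨ +-assoc b c (- c) ⟩
    b + (c + - c)   ≈⟨ +-congˡ (-‿inverseʳ c) ⟩
    b + 0#          ≈⟨ +-identityʳ b ⟩
    b ∎

  private
    ιᶻ′ : ℤ → Carrier
    ιᶻ′ (+ n)    = ι n
    ιᶻ′ -[1+ n ] = - ι (suc n)

    -- The solver sees the constant 1 as ιᶻ (+ 1), which therefore has to reduce to 1#, not to 1# + 0#.
    ιᶻ : ℤ → Carrier
    ιᶻ (+ 1)  = 1#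
    ιᶻ i      = ιᶻ′ i

    ιᶻ≈ : ∀ i → ιᶻ i ≈ ιᶻ′ i
    ιᶻ≈ (+ 0)           = refl
    ιᶻ≈ (+ 1)           = sym ι-1
    ιᶻ≈ (+ suc (suc n)) = refl
    ιᶻ≈ -[1+ n ]        = refl

    ιᶻ′-neg : ∀ i → ιᶻ′ (ℤ.- i) ≈ - ιᶻ′ i
    ιᶻ′-neg (+ zero)   = sym -0#≈0#
    ιᶻ′-neg (+ suc n)  = refl
    ιᶻ′-neg -[1+ n ]   = sym (-‿involutive _)

    ιᶻ′-⊖ : ∀ m n → ιᶻ′ (m ℤ.⊖ n) ≈ ι m + - ι n
    ιᶻ′-⊖ m zero          = begin
      ιᶻ′ (m ℤ.⊖ 0)       ≡⟨ ≡.cong ιᶻ′ (ℤₚ.⊖-≥ {m} {0} ℕ.z≤n) ⟩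
      ι m                ≈⟨ +-identityʳ _ ⟨
      ι m + 0#           ≈⟨ +-congˡ -0#≈0# ⟨
      ι m + - 0#         ∎
    ιᶻ′-⊖ zero (suc n)    = sym (+-identityˡ _)
    ιᶻ′-⊖ (suc m) (suc n) = begin
      ιᶻ′ (suc m ℤ.⊖ suc n)           ≡⟨ ≡.cong ιᶻ′ (ℤₚ.[1+m]⊖[1+n]≡m⊖n m n) ⟩
      ιᶻ′ (m ℤ.⊖ n)                   ≈⟨ ιᶻ′-⊖ m n ⟩
      ι m + - ι n                    ≈⟨ +-congʳ (+-identityʳ _) ⟨
      (ι m + 0#) + - ι n             ≈⟨ +-congʳ (+-congˡ (-‿inverseʳ 1#)) ⟨
      (ι m + (1# + - 1#)) + - ι n    ≈⟨ +-congʳ (+-assoc _ _ _) ⟨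
      ((ι m + 1#) + - 1#) + - ι n    ≈⟨ +-congʳ (+-congʳ (+-comm _ _)) ⟩
      (ι (suc m) + - 1#) + - ι n     ≈⟨ +-assoc _ _ _ ⟩
      ι (suc m) + (- 1# + - ι n)     ≈⟨ +-congˡ (-‿+-comm _ _) ⟩
      ι (suc m) + - ι (suc n)        ∎

    ιᶻ′-+ : ∀ i j → ιᶻ′ (i ℤ.+ j) ≈ ιᶻ′ i + ιᶻ′ j
    ιᶻ′-+ (+ m)    (+ n)    = ι-+ m n
    ιᶻ′-+ (+ m)    -[1+ n ] = ιᶻ′-⊖ m (suc n)
    ιᶻ′-+ -[1+ m ] (+ n)    = trans (ιᶻ′-⊖ n (suc m)) (+-comm _ _)
    ιᶻ′-+ -[1+ m ] -[1+ n ] = begin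
      - ι (suc (suc (m ℕ.+ n)))       ≡⟨ ≡.cong (λ k → - ι (suc k)) (≡.sym (ℕₚ.+-suc m n)) ⟩
      - ι (suc m ℕ.+ suc n)           ≈⟨ -‿cong (ι-+ (suc m) (suc n)) ⟩
      - (ι (suc m) + ι (suc n))       ≈⟨ -‿+-comm _ _ ⟨
      - ι (suc m) + - ι (suc n)       ∎

    ιᶻ′-*⁺ : ∀ m j → ιᶻ′ (+ m ℤ.* j) ≈ ι m * ιᶻ′ j
    ιᶻ′-*⁺ zero    j = begin
      ιᶻ′ (+ 0 ℤ.* j)   ≡⟨ ≡.cong ιᶻ′ (ℤₚ.*-zeroˡ j) ⟩
      0#               ≈⟨ zeroˡ _ ⟨
      0# * ιᶻ′ j        ∎
    ιᶻ′-*⁺ (suc m) j = begin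
      ιᶻ′ (+ suc m ℤ.* j)           ≡⟨ ≡.cong ιᶻ′ (ℤₚ.suc-* (+ m) j) ⟩
      ιᶻ′ (j ℤ.+ + m ℤ.* j)         ≈⟨ ιᶻ′-+ j (+ m ℤ.* j) ⟩
      ιᶻ′ j + ιᶻ′ (+ m ℤ.* j)        ≈⟨ +-cong (sym (*-identityˡ _)) (ιᶻ′-*⁺ m j) ⟩
      1# * ιᶻ′ j + ι m * ιᶻ′ j       ≈⟨ distribʳ _ _ _ ⟨
      ι (suc m) * ιᶻ′ j             ∎

    ιᶻ′-* : ∀ i j → ιᶻ′ (i ℤ.* j) ≈ ιᶻ′ i * ιᶻ′ j
    ιᶻ′-* (+ m)    j = ιᶻ′-*⁺ m j
    ιᶻ′-* -[1+ m ] j = begin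
      ιᶻ′ (-[1+ m ] ℤ.* j)          ≡⟨ ≡.cong ιᶻ′ (≡.sym (ℤₚ.neg-distribˡ-* (+ suc m) j)) ⟩
      ιᶻ′ (ℤ.- (+ suc m ℤ.* j))     ≈⟨ ιᶻ′-neg (+ suc m ℤ.* j) ⟩
      - ιᶻ′ (+ suc m ℤ.* j)         ≈⟨ -‿cong (ιᶻ′-*⁺ (suc m) j) ⟩
      - (ι (suc m) * ιᶻ′ j)         ≈⟨ -‿distribˡ-* _ _ ⟩
      - ι (suc m) * ιᶻ′ j           ∎

    ιᶻ-hom : ℤ.+-*-rawRing -Raw-AlmostCommutative⟶ fromCommutativeRing R
    ιᶻ-hom = record
      { ⟦_⟧    = ιᶻ
      ; +-homo = λ i j → trans (ιᶻ≈ (i ℤ.+ j)) (trans (ιᶻ′-+ i j) (+-cong (sym (ιᶻ≈ i)) (sym (ιᶻ≈ j))))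
      ; *-homo = λ i j → trans (ιᶻ≈ (i ℤ.* j)) (trans (ιᶻ′-* i j) (*-cong (sym (ιᶻ≈ i)) (sym (ιᶻ≈ j))))
      ; -‿homo = λ i → trans (ιᶻ≈ (ℤ.- i)) (trans (ιᶻ′-neg i) (-‿cong (sym (ιᶻ≈ i))))
      ; 0-homo = refl
      ; 1-homo = refl
      }

    ℤ≟ : ∀ i j → Maybe (ιᶻ i ≈ ιᶻ j)
    ℤ≟ i j with i ℤ.≟ j
    ... | yes i≡j = just (reflexive (≡.cong ιᶻ i≡j))
    ... | no  _   = nothing

  open import Algebra.Solver.Ring ℤ.+-*-rawRing (fromCommutativeRing R) ιᶻ-hom ℤ≟ public
    using (solve; _:=_; _:+_; _:*_; _:-_; :-_; con)

  inverse-unique : ∀ {x y i j} → x * i ≈ 1# → y * j ≈ 1# → i ≈ j → x ≈ y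
  inverse-unique {x} {y} {i} {j} xi yj i≈j = begin
    x             ≈⟨ *-identityʳ x ⟨
    x * 1#        ≈⟨ *-congˡ yj ⟨
    x * (y * j)   ≈⟨ solve 3 (λ x y j → x :* (y :* j) := y :* (x :* j)) refl x y j ⟩
    y * (x * j)   ≈⟨ *-congˡ (trans (*-congˡ (sym i≈j)) xi) ⟩
    y * 1#        ≈⟨ *-identityʳ y ⟩
    y ∎

  neg-^ : ∀ x n → (- x) ^ n ≈ (- 1#) ^ n * x ^ n
  neg-^ x zero    = sym (*-identityˡ _)
  neg-^ x (suc n) = trans (*-congˡ (neg-^ x n))
    (solve 3 (λ x y z → :- x :* (y :* z) := (:- con (+ 1) :* y) :* (x :* z)) refl x _ _)

  -- Finite sums

  Σ< : ℕ → (ℕ → Carrier) → Carrier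
  Σ< zero    f = 0#
  Σ< (suc n) f = Σ< n f + f n

  Σ-cong : ∀ n {f g} → (∀ i → i ℕ.< n → f i ≈ g i) → Σ< n f ≈ Σ< n g
  Σ-cong zero    h = refl
  Σ-cong (suc n) h = +-cong (Σ-cong n (λ i i<n → h i (ℕₚ.m<n⇒m<1+n i<n))) (h n ℕₚ.≤-refl)

  Σ-zero : ∀ n {f} → (∀ i → i ℕ.< n → f i ≈ 0#) → Σ< n f ≈ 0#
  Σ-zero zero    h = refl
  Σ-zero (suc n) h =
    trans (+-cong (Σ-zero n (λ i i<n → h i (ℕₚ.m<n⇒m<1+n i<n))) (h n ℕₚ.≤-refl)) (+-identityʳ 0#)

  Σ-+ : ∀ n f g → Σ< n (λ i → f i + g i) ≈ Σ< n f + Σ< n g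
  Σ-+ zero    f g = sym (+-identityʳ 0#)
  Σ-+ (suc n) f g = trans (+-congʳ (Σ-+ n f g))
    (solve 4 (λ a b c d → (a :+ b) :+ (c :+ d) := (a :+ c) :+ (b :+ d)) refl _ _ _ _)

  Σ-*ˡ : ∀ n c f → c * Σ< n f ≈ Σ< n (λ i → c * f i)
  Σ-*ˡ zero    c f = zeroʳ c
  Σ-*ˡ (suc n) c f = trans (distribˡ c _ _) (+-congʳ (Σ-*ˡ n c f))

  Σ-swap : ∀ m n (f : ℕ → ℕ → Carrier) →
    Σ< m (λ i → Σ< n (f i)) ≈ Σ< n (λ j → Σ< m (λ i → f i j))
  Σ-swap zero    n f = sym (Σ-zero n (λ _ _ → refl))
  Σ-swap (suc m) n f = trans (+-congʳ (Σ-swap m n f)) (sym (Σ-+ n _ _))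

  Σ-head : ∀ n f → Σ< (suc n) f ≈ f 0 + Σ< n (λ i → f (suc i))
  Σ-head zero    f = +-comm 0# (f 0)
  Σ-head (suc n) f = trans (+-congʳ (Σ-head n f)) (+-assoc _ _ _)

  Σ-reverse : ∀ n f → Σ< n f ≈ Σ< n (λ i → f (n ℕ.∸ suc i))
  Σ-reverse zero    f = refl
  Σ-reverse (suc n) f = trans (+-comm _ _)
    (trans (+-congˡ (Σ-reverse n f)) (sym (Σ-head n (λ i → f (n ℕ.∸ i)))))

  Σ-single : ∀ n j {f} → j ℕ.< n → (∀ i → i ≢ j → f i ≈ 0#) → Σ< n f ≈ f j
  Σ-single (suc n) j {f} j<1+n h with j ℕ.≟ n
  ... | yes ≡.refl = trans (+-congʳ (Σ-zero n (λ i i<n → h i (ℕₚ.<⇒≢ i<n)))) (+-identityˡ _)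
  ... | no  j≢n    = trans
    (+-cong (Σ-single n j (ℕₚ.≤∧≢⇒< (ℕ.s≤s⁻¹ j<1+n) j≢n) h) (h n (λ n≡j → j≢n (≡.sym n≡j))))
    (+-identityʳ _)

  -- Both sides range over the pairs with i + j + 2 ≤ m. Passing from m to m + 1 adds the diagonal i
  -- + j + 1 = m, which reversal of the summation maps to itself with i and j exchanged.
  Σ-triangle : ∀ m (f : ℕ → ℕ → Carrier) →
    Σ< m (λ i → Σ< (m ℕ.∸ suc i) (f i)) ≈ Σ< m (λ j → Σ< (m ℕ.∸ suc j) (λ i → f i j))
  Σ-triangle zero    f = refl
  Σ-triangle (suc m) f = begin
    Σ< (suc m) (λ i → Σ< (m ℕ.∸ i) (f i))                       ≈⟨ extend f ⟩
    Σ< m (λ i → Σ< (m ℕ.∸ suc i) (f i)) + Σ< m (λ i → f i (m ℕ.∸ suc i))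
      ≈⟨ +-cong (Σ-triangle m f) (trans (Σ-reverse m _) (Σ-cong m (λ i i<m →
           reflexive (≡.cong (f (m ℕ.∸ suc i)) (complement i i<m))))) ⟩
    Σ< m (λ j → Σ< (m ℕ.∸ suc j) (λ i → f i j)) + Σ< m (λ j → f (m ℕ.∸ suc j) j)
      ≈⟨ extend (λ j i → f i j) ⟨
    Σ< (suc m) (λ j → Σ< (m ℕ.∸ j) (λ i → f i j)) ∎
    where
    complement : ∀ i → i ℕ.< m → m ℕ.∸ suc (m ℕ.∸ suc i) ≡ i
    complement i i<m = ≡.trans (≡.cong (m ℕ.∸_) (≡.sym (∸-suc i<m))) (ℕₚ.m∸[m∸n]≡n (ℕₚ.<⇒≤ i<m))
    extend : ∀ (f : ℕ → ℕ → Carrier) → Σ< (suc m) (λ i → Σ< (m ℕ.∸ i) (f i)) ≈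
      Σ< m (λ i → Σ< (m ℕ.∸ suc i) (f i)) + Σ< m (λ i → f i (m ℕ.∸ suc i))
    extend f = begin
      Σ< m (λ i → Σ< (m ℕ.∸ i) (f i)) + Σ< (m ℕ.∸ m) (f m)
        ≈⟨ trans (+-congˡ (reflexive (≡.cong (λ k → Σ< k (f m)) (ℕₚ.n∸n≡0 m)))) (+-identityʳ _) ⟩
      Σ< m (λ i → Σ< (m ℕ.∸ i) (f i))
        ≈⟨ Σ-cong m (λ i i<m → reflexive (≡.cong (λ k → Σ< k (f i)) (∸-suc i<m))) ⟩
      Σ< m (λ i → Σ< (m ℕ.∸ suc i) (f i) + f i (m ℕ.∸ suc i))
        ≈⟨ Σ-+ m _ _ ⟩
      Σ< m (λ i → Σ< (m ℕ.∸ suc i) (f i)) + Σ< m (λ i → f i (m ℕ.∸ suc i)) ∎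

  Σ-split : ∀ m n f → Σ< (m ℕ.+ n) f ≈ Σ< m f + Σ< n (λ i → f (m ℕ.+ i))
  Σ-split m zero    f = trans (reflexive (≡.cong (λ k → Σ< k f) (ℕₚ.+-identityʳ m))) (sym (+-identityʳ _))
  Σ-split m (suc n) f = trans (reflexive (≡.cong (λ k → Σ< k f) (ℕₚ.+-suc m n)))
    (trans (+-congʳ (Σ-split m n f)) (+-assoc _ _ _))

-- Convolution and truncated power series

module Convolution {A : Set} (_+_ _*_ : A → A → A) where
  conv : (ℕ → A) → (ℕ → A) → ℕ → A
  conv f g zero    = f 0 * g 0
  conv f g (suc n) = (f 0 * g (suc n)) + conv (f ∘ suc) g n

module ConvolutionRelation {A B : Set} (_+₁_ _*₁_ : A → A → A) (_+₂_ _*₂_ : B → B → B)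
  (_~_ : A → B → Set)
  (~-+ : ∀ {a b c d} → a ~ b → c ~ d → (a +₁ c) ~ (b +₂ d))
  (~-* : ∀ {a b c d} → a ~ b → c ~ d → (a *₁ c) ~ (b *₂ d)) where
  open Convolution _+₁_ _*₁_ renaming (conv to conv₁)
  open Convolution _+₂_ _*₂_ renaming (conv to conv₂)

  -- Convolution is built from sums and products alone, so any relation respected by these is
  -- respected by it. This serves both for the congruence of series and for the passage from
  -- rational sequences to their residues modulo p.
  conv-~ : ∀ n {f g f′ g′} → (∀ i → i ℕ.≤ n → f i ~ f′ i) → (∀ i → i ℕ.≤ n → g i ~ g′ i) →
    conv₁ f g n ~ conv₂ f′ g′ n
  conv-~ zero    hf hg = ~-* (hf 0 ℕ.z≤n) (hg 0 ℕ.z≤n)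
  conv-~ (suc n) hf hg = ~-+ (~-* (hf 0 ℕ.z≤n) (hg (suc n) ℕₚ.≤-refl))
    (conv-~ n (λ i i≤n → hf (suc i) (ℕ.s≤s i≤n)) (λ i i≤n → hg i (ℕₚ.m≤n⇒m≤1+n i≤n)))

-- Power series in one variable over R, compared only at the exponents in the downward closed set Bd.
module PowerSeries (R : CommutativeRing 0ℓ 0ℓ) (Bd : ℕ → Set) (down : ∀ {n} → Bd (suc n) → Bd n) where
  private
    module R = RingTools R
  open R using (Carrier; _≈_; solve; _:=_; _:+_; _:*_; con) renaming
    (_+_ to _⊕_; _*_ to _⊗_; -_ to ⊝_; 0# to 𝟘; 1# to 𝟙)
  open Convolution _⊕_ _⊗_ public
  open import Relation.Binary.Reasoning.Setoid R.setoid

  Series : Set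
  Series = ℕ → Carrier

  infix 4 _≋_
  record _≋_ (f g : Series) : Set where
    constructor ≋-intro
    field at : ∀ n → Bd n → f n ≈ g n
  open _≋_ public

  Bd-≤ : ∀ {m n} → m ℕ.≤ n → Bd n → Bd m
  Bd-≤ {m} {n} m≤n b with ℕₚ.≤⇒≤′ m≤n
  ... | le = go le b
    where
    go : ∀ {n} → m ℕ.≤′ n → Bd n → Bd m
    go (ℕ.≤′-reflexive ≡.refl) b = b
    go (ℕ.≤′-step le)          b = go le (down b)

  infixl 6 _+ˢ_
  infixl 7 _*ˢ_
  _+ˢ_ _*ˢ_ : Series → Series → Series
  (f +ˢ g) n = f n ⊕ g n
  _*ˢ_ = conv

  -ˢ_ : Series → Series
  (-ˢ f) n = ⊝ f n

  const : Carrier → Series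
  const c zero    = c
  const c (suc _) = 𝟘

  0ˢ 1ˢ : Series
  0ˢ _ = 𝟘
  1ˢ = const 𝟙

  mono : ℕ → Carrier → Series
  mono zero    c         = const c
  mono (suc a) c zero    = 𝟘
  mono (suc a) c (suc n) = mono a c n

  conv-cong-≤ : ∀ n {f g f′ g′} → (∀ i → i ℕ.≤ n → f i ≈ f′ i) → (∀ i → i ℕ.≤ n → g i ≈ g′ i) →
    conv f g n ≈ conv f′ g′ n
  conv-cong-≤ = ConvolutionRelation.conv-~ _⊕_ _⊗_ _⊕_ _⊗_ _≈_ R.+-cong R.*-cong

  conv-cong : ∀ n {f g f′ g′} → (∀ i → f i ≈ f′ i) → (∀ i → g i ≈ g′ i) → conv f g n ≈ conv f′ g′ n
  conv-cong n hf hg = conv-cong-≤ n (λ i _ → hf i) (λ i _ → hg i)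

  conv-zeroˡ : ∀ n g → conv 0ˢ g n ≈ 𝟘
  conv-zeroˡ zero    g = R.zeroˡ _
  conv-zeroˡ (suc n) g = R.trans (R.+-cong (R.zeroˡ _) (conv-zeroˡ n g)) (R.+-identityʳ 𝟘)

  conv-scaleˡ : ∀ n c f g → conv (λ i → c ⊗ f i) g n ≈ c ⊗ conv f g n
  conv-scaleˡ zero    c f g = R.*-assoc _ _ _
  conv-scaleˡ (suc n) c f g = R.trans (R.+-cong (R.*-assoc _ _ _) (conv-scaleˡ n c _ g)) (R.sym (R.distribˡ c _ _))

  conv-distribʳ : ∀ n f g h → conv (f +ˢ g) h n ≈ conv f h n ⊕ conv g h n
  conv-distribʳ zero    f g h = R.distribʳ _ _ _
  conv-distribʳ (suc n) f g h = R.trans (R.+-cong (R.distribʳ _ _ _) (conv-distribʳ n _ _ h))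
    (solve 4 (λ a b c d → (a :+ b) :+ (c :+ d) := (a :+ c) :+ (b :+ d)) R.refl _ _ _ _)

  conv-sucʳ : ∀ n f g → conv f g (suc n) ≈ conv f (g ∘ suc) n ⊕ (f (suc n) ⊗ g 0)
  conv-sucʳ zero    f g = R.refl
  conv-sucʳ (suc n) f g = R.trans (R.+-congˡ (conv-sucʳ n (f ∘ suc) g)) (R.sym (R.+-assoc _ _ _))

  conv-comm : ∀ n f g → conv f g n ≈ conv g f n
  conv-comm zero    f g = R.*-comm _ _
  conv-comm (suc n) f g = begin
    f 0 ⊗ g (suc n) ⊕ conv (f ∘ suc) g n   ≈⟨ R.+-cong (R.*-comm _ _) (conv-comm n (f ∘ suc) g) ⟩
    g (suc n) ⊗ f 0 ⊕ conv g (f ∘ suc) n   ≈⟨ R.+-comm _ _ ⟩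
    conv g (f ∘ suc) n ⊕ g (suc n) ⊗ f 0   ≈⟨ conv-sucʳ n g f ⟨
    conv g f (suc n) ∎

  conv-Σ : ∀ n f g → conv f g n ≈ R.Σ< (suc n) (λ i → f i ⊗ g (n ℕ.∸ i))
  conv-Σ zero    f g = R.sym (R.+-identityˡ _)
  conv-Σ (suc n) f g = R.trans (R.+-congˡ (conv-Σ n (f ∘ suc) g)) (R.sym (R.Σ-head (suc n) (λ i → f i ⊗ g (suc n ℕ.∸ i))))

  conv-assoc : ∀ n f g h → conv (conv f g) h n ≈ conv f (conv g h) n
  conv-assoc zero    f g h = R.*-assoc _ _ _
  conv-assoc (suc n) f g h = begin
    (f 0 ⊗ g 0) ⊗ h (suc n) ⊕ conv (λ i → f 0 ⊗ g (suc i) ⊕ conv (f ∘ suc) g i) h n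
      ≈⟨ R.+-congˡ (R.trans (conv-distribʳ n (λ i → f 0 ⊗ g (suc i)) _ h)
           (R.+-cong (conv-scaleˡ n (f 0) (g ∘ suc) h) (conv-assoc n (f ∘ suc) g h))) ⟩
    (f 0 ⊗ g 0) ⊗ h (suc n) ⊕ (f 0 ⊗ conv (g ∘ suc) h n ⊕ conv (f ∘ suc) (conv g h) n)
      ≈⟨ solve 5 (λ a b c d e → (a :* b) :* c :+ (a :* d :+ e) := a :* (b :* c :+ d) :+ e) R.refl _ _ _ _ _ ⟩
    f 0 ⊗ (g 0 ⊗ h (suc n) ⊕ conv (g ∘ suc) h n) ⊕ conv (f ∘ suc) (conv g h) n ∎

  conv-const : ∀ n c g → conv (const c) g n ≈ c ⊗ g n
  conv-const zero    c g = R.refl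
  conv-const (suc n) c g = R.trans
    (R.+-congˡ (R.trans (conv-cong n (λ _ → R.refl) (λ _ → R.refl)) (conv-zeroˡ n g))) (R.+-identityʳ _)

  -- Coefficient n of a product involves only exponents up to n, so agreement on a downward closed
  -- set of exponents is a ring congruence. The sets used are everything, the exponents below p - 1
  -- (series modulo t^(p-1)), and the exponents up to a bound b.
  series-commutativeRing : CommutativeRing 0ℓ 0ℓ
  series-commutativeRing = record
    { Carrier = Series ; _≈_ = _≋_ ; _+_ = _+ˢ_ ; _*_ = _*ˢ_ ; -_ = -ˢ_ ; 0# = 0ˢ ; 1# = 1ˢ
    ; isCommutativeRing = record
      { isRing = record
        { +-isAbelianGroup = record
          { isGroup = record
            { isMonoid = record
              { isSemigroup = record
                { isMagma = record
                  { isEquivalence = record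
                    { refl  = ≋-intro λ _ _ → R.refl
                    ; sym   = λ h → ≋-intro λ n b → R.sym (at h n b)
                    ; trans = λ h k → ≋-intro λ n b → R.trans (at h n b) (at k n b) }
                  ; ∙-cong = λ h k → ≋-intro λ n b → R.+-cong (at h n b) (at k n b) }
                ; assoc = λ f g h → ≋-intro λ n _ → R.+-assoc _ _ _ }
              ; identity = (λ f → ≋-intro λ n _ → R.+-identityˡ _) , (λ f → ≋-intro λ n _ → R.+-identityʳ _) }
            ; inverse = (λ f → ≋-intro λ n _ → R.-‿inverseˡ _) , (λ f → ≋-intro λ n _ → R.-‿inverseʳ _)
            ; ⁻¹-cong = λ h → ≋-intro λ n b → R.-‿cong (at h n b) }
          ; comm = λ f g → ≋-intro λ n _ → R.+-comm _ _ }
        ; *-cong = λ h k → ≋-intro λ n b →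
            conv-cong-≤ n (λ i i≤n → at h i (Bd-≤ i≤n b)) (λ i i≤n → at k i (Bd-≤ i≤n b))
        ; *-assoc = λ f g h → ≋-intro λ n _ → conv-assoc n f g h
        ; *-identity = (λ f → ≋-intro λ n _ → 1*f f n)
                     , (λ f → ≋-intro λ n _ → R.trans (conv-comm n f 1ˢ) (1*f f n))
        ; distrib = (λ f g h → ≋-intro λ n _ → R.trans (conv-comm n f _)
                      (R.trans (conv-distribʳ n g h f) (R.+-cong (conv-comm n g f) (conv-comm n h f))))
                  , (λ f g h → ≋-intro λ n _ → conv-distribʳ n g h f)
        }
      ; *-comm = λ f g → ≋-intro λ n _ → conv-comm n f g } }
    where
    1*f : ∀ f n → conv 1ˢ f n ≈ f n
    1*f f n = R.trans (conv-const n 𝟙 f) (R.*-identityˡ _)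

  const-cong : ∀ {a b} → a ≈ b → const a ≋ const b
  const-cong h = ≋-intro λ { zero _ → h ; (suc _) _ → R.refl }

  const-+ : ∀ a b → const (a ⊕ b) ≋ const a +ˢ const b
  const-+ a b = ≋-intro λ { zero _ → R.refl ; (suc _) _ → R.sym (R.+-identityʳ 𝟘) }

  const-* : ∀ a b → const (a ⊗ b) ≋ const a *ˢ const b
  const-* a b = ≋-intro λ { zero _ → R.refl ; (suc n) _ → R.sym (R.trans (conv-const (suc n) a _) (R.zeroʳ a)) }

  private
    module S = RingTools series-commutativeRing

  const-0 : const 𝟘 ≋ 0ˢ
  const-0 = ≋-intro λ { zero _ → R.refl ; (suc _) _ → R.refl }

  const-ι : ∀ n → const (R.ι n) ≋ S.ι n
  const-ι zero    = const-0
  const-ι (suc n) = S.trans (const-+ 𝟙 (R.ι n)) (S.+-congˡ (const-ι n))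

  Σ-at : ∀ n f k → S.Σ< n f k ≈ R.Σ< n (λ i → f i k)
  Σ-at zero    f k = R.refl
  Σ-at (suc n) f k = R.+-congʳ (Σ-at n f k)

  -- The derivation x d/dx. Unlike d/dx it keeps exponents in place, hence is compatible with every
  -- truncation.
  euler : Series → Series
  euler f n = R.ι n ⊗ f n

  euler-cong : ∀ {f g} → f ≋ g → euler f ≋ euler g
  euler-cong h = ≋-intro λ n b → R.*-congˡ (at h n b)

  private
    conv-euler-shift : ∀ n f g → conv (euler f ∘ suc) g n ≈ conv (f ∘ suc) g n ⊕ conv (euler (f ∘ suc)) g n
    conv-euler-shift n f g = R.trans
      (conv-cong n (λ i → solve 2 (λ a b → (con (ℤ.+ 1) :+ a) :* b := b :+ a :* b) R.refl _ _) (λ _ → R.refl))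
      (conv-distribʳ n (f ∘ suc) (euler (f ∘ suc)) g)

  conv-leibniz : ∀ n f g → R.ι n ⊗ conv f g n ≈ conv (euler f) g n ⊕ conv f (euler g) n
  conv-leibniz zero    f g =
    solve 2 (λ a b → con (ℤ.+ 0) :* (a :* b) := (con (ℤ.+ 0) :* a) :* b :+ a :* (con (ℤ.+ 0) :* b)) R.refl _ _
  conv-leibniz (suc n) f g = begin
    (𝟙 ⊕ R.ι n) ⊗ (f 0 ⊗ g (suc n) ⊕ conv (f ∘ suc) g n)
      ≈⟨ solve 4 (λ i a b c → (con (ℤ.+ 1) :+ i) :* (a :* b :+ c)
                  := con (ℤ.+ 0) :* a :* b :+ c :+ i :* c :+ a :* ((con (ℤ.+ 1) :+ i) :* b)) R.refl _ _ _ _ ⟩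
    ((𝟘 ⊗ f 0) ⊗ g (suc n) ⊕ conv (f ∘ suc) g n ⊕ R.ι n ⊗ conv (f ∘ suc) g n) ⊕ f 0 ⊗ ((𝟙 ⊕ R.ι n) ⊗ g (suc n))
      ≈⟨ R.+-congʳ (R.+-congˡ (conv-leibniz n (f ∘ suc) g)) ⟩
    ((𝟘 ⊗ f 0) ⊗ g (suc n) ⊕ conv (f ∘ suc) g n ⊕ (conv (euler (f ∘ suc)) g n ⊕ conv (f ∘ suc) (euler g) n)) ⊕ f 0 ⊗ ((𝟙 ⊕ R.ι n) ⊗ g (suc n))
      ≈⟨ solve 5 (λ a b c d e → (a :+ b :+ (c :+ d)) :+ e := (a :+ (b :+ c)) :+ (e :+ d)) R.refl _ _ _ _ _ ⟩
    ((𝟘 ⊗ f 0) ⊗ g (suc n) ⊕ (conv (f ∘ suc) g n ⊕ conv (euler (f ∘ suc)) g n)) ⊕ (f 0 ⊗ ((𝟙 ⊕ R.ι n) ⊗ g (suc n)) ⊕ conv (f ∘ suc) (euler g) n)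
      ≈⟨ R.+-congʳ (R.+-congˡ (R.sym (conv-euler-shift n f g))) ⟩
    conv (euler f) g (suc n) ⊕ conv f (euler g) (suc n) ∎

  leibniz : ∀ f g → euler (f *ˢ g) ≋ euler f *ˢ g +ˢ f *ˢ euler g
  leibniz f g = ≋-intro λ n _ → conv-leibniz n f g

  mono-at : ∀ a c → mono a c a ≈ c
  mono-at zero    c = R.refl
  mono-at (suc a) c = mono-at a c

  mono-≢ : ∀ a c n → n ≢ a → mono a c n ≈ 𝟘
  mono-≢ zero    c zero    n≢a = contradiction ≡.refl n≢a
  mono-≢ zero    c (suc n) n≢a = R.refl
  mono-≢ (suc a) c zero    n≢a = R.refl
  mono-≢ (suc a) c (suc n) n≢a = mono-≢ a c n (λ { ≡.refl → n≢a ≡.refl })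

  mono-* : ∀ a b c d → mono a c *ˢ mono b d ≋ mono (a ℕ.+ b) (c ⊗ d)
  mono-* a b c d = ≋-intro λ n _ → go a n
    where
    scale : ∀ b n → c ⊗ mono b d n ≈ mono b (c ⊗ d) n
    scale zero    zero    = R.refl
    scale zero    (suc n) = R.zeroʳ c
    scale (suc b) zero    = R.zeroʳ c
    scale (suc b) (suc n) = scale b n
    go : ∀ a n → conv (mono a c) (mono b d) n ≈ mono (a ℕ.+ b) (c ⊗ d) n
    go zero    n       = R.trans (conv-const n c (mono b d)) (scale b n)
    go (suc a) zero    = R.zeroˡ _
    go (suc a) (suc n) = R.trans (R.+-congʳ (R.zeroˡ _)) (R.trans (R.+-identityˡ _) (go a n))

  mono-^ : ∀ n c → mono 1 c S.^ n ≋ mono n (c R.^ n)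
  mono-^ zero    c = S.refl
  mono-^ (suc n) c = S.trans (S.*-congˡ (mono-^ n c)) (mono-* 1 n c (c R.^ n))

-- Binomial coefficients and the binomial transform

nC0≡1 : ∀ n → n C 0 ≡ 1
nC0≡1 n = ≡.trans (nCk≡nC[n∸k] {0} {n} ℕ.z≤n) (nCn≡1 n)

-- The absorption identity. It makes C(p,i) vanish modulo p for 0 < i < p, and it trades the
-- quotients a/k in front of binomial coefficients for shifted binomial coefficients.
[1+k]*[1+n]C[1+k] : ∀ n k → suc k ℕ.* (suc n C suc k) ≡ suc n ℕ.* (n C k)
[1+k]*[1+n]C[1+k] zero    zero    = ≡.refl
[1+k]*[1+n]C[1+k] zero    (suc k) = ≡.trans
  (≡.cong (suc (suc k) ℕ.*_) (k>n⇒nCk≡0 {1} {suc (suc k)} (ℕ.s≤s (ℕ.s≤s ℕ.z≤n))))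
  (≡.trans (ℕₚ.*-zeroʳ (suc (suc k))) (≡.sym (≡.cong (1 ℕ.*_) (k>n⇒nCk≡0 {0} {suc k} (ℕ.s≤s ℕ.z≤n)))))
[1+k]*[1+n]C[1+k] (suc n) zero    = begin
  1 ℕ.* (suc (suc n) C 1)               ≡⟨ ≡.cong (1 ℕ.*_) (≡.sym (nCk+nC[k+1]≡[n+1]C[k+1] (suc n) 0)) ⟩
  1 ℕ.* (suc n C 0 ℕ.+ suc n C 1)       ≡⟨ ℕₚ.*-distribˡ-+ 1 (suc n C 0) (suc n C 1) ⟩
  1 ℕ.* (suc n C 0) ℕ.+ 1 ℕ.* (suc n C 1) ≡⟨ ≡.cong₂ ℕ._+_ (≡.cong (1 ℕ.*_) (≡.trans (nC0≡1 (suc n)) (≡.sym (nC0≡1 n)))) ([1+k]*[1+n]C[1+k] n 0) ⟩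
  1 ℕ.* (n C 0) ℕ.+ suc n ℕ.* (n C 0)   ≡⟨ ≡.sym (ℕₚ.*-distribʳ-+ (n C 0) 1 (suc n)) ⟩
  suc (suc n) ℕ.* (n C 0)               ≡⟨ ≡.cong (suc (suc n) ℕ.*_) (≡.trans (nC0≡1 n) (≡.sym (nC0≡1 (suc n)))) ⟩
  suc (suc n) ℕ.* (suc n C 0)           ∎
  where open ≡.≡-Reasoning
[1+k]*[1+n]C[1+k] (suc n) (suc k) = begin
  suc (suc k) ℕ.* (suc (suc n) C suc (suc k))
    ≡⟨ ≡.cong (suc (suc k) ℕ.*_) (≡.sym (nCk+nC[k+1]≡[n+1]C[k+1] (suc n) (suc k))) ⟩
  suc (suc k) ℕ.* (suc n C suc k ℕ.+ suc n C suc (suc k))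
    ≡⟨ ℕS.solve 3 (λ k a b → (ℕS.con 1 ℕS.:+ k) ℕS.:* (a ℕS.:+ b) ℕS.:= a ℕS.:+ (k ℕS.:* a ℕS.:+ (ℕS.con 1 ℕS.:+ k) ℕS.:* b)) ≡.refl (suc k) (suc n C suc k) (suc n C suc (suc k)) ⟩
  suc n C suc k ℕ.+ (suc k ℕ.* (suc n C suc k) ℕ.+ suc (suc k) ℕ.* (suc n C suc (suc k)))
    ≡⟨ ≡.cong (suc n C suc k ℕ.+_) (≡.cong₂ ℕ._+_ ([1+k]*[1+n]C[1+k] n k) ([1+k]*[1+n]C[1+k] n (suc k))) ⟩
  suc n C suc k ℕ.+ (suc n ℕ.* (n C k) ℕ.+ suc n ℕ.* (n C suc k))
    ≡⟨ ≡.cong (suc n C suc k ℕ.+_) (≡.sym (ℕₚ.*-distribˡ-+ (suc n) (n C k) (n C suc k))) ⟩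
  suc n C suc k ℕ.+ suc n ℕ.* (n C k ℕ.+ n C suc k)
    ≡⟨ ≡.cong (λ c → suc n C suc k ℕ.+ suc n ℕ.* c) (nCk+nC[k+1]≡[n+1]C[k+1] n k) ⟩
  suc (suc n) ℕ.* (suc n C suc k) ∎
  where
  open ≡.≡-Reasoning
  module ℕS = ℕ-Solver.+-*-Solver

module BinomialTransform (R : CommutativeRing 0ℓ 0ℓ) where
  open RingTools R

  -- T A a n = Σ C(n,i) A^(n-i) a i, that is, the umbral power (A + a)^n
  T : Carrier → (ℕ → Carrier) → ℕ → Carrier
  T A a zero    = a 0
  T A a (suc n) = A * T A a n + T A (a ∘ suc) n

  T-cong : ∀ n {A B a b} → A ≈ B → (∀ i → i ℕ.≤ n → a i ≈ b i) → T A a n ≈ T B b n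
  T-cong zero    A≈B h = h 0 ℕ.z≤n
  T-cong (suc n) A≈B h = +-cong (*-cong A≈B (T-cong n A≈B (λ i i≤n → h i (ℕₚ.m≤n⇒m≤1+n i≤n))))
    (T-cong n A≈B (λ i i≤n → h (suc i) (ℕ.s≤s i≤n)))

  T-+ : ∀ n A a b → T A (λ i → a i + b i) n ≈ T A a n + T A b n
  T-+ zero    A a b = refl
  T-+ (suc n) A a b = trans (+-cong (*-congˡ (T-+ n A a b)) (T-+ n A _ _))
    (solve 5 (λ A a b c d → A :* (a :+ b) :+ (c :+ d) := (A :* a :+ c) :+ (A :* b :+ d)) refl _ _ _ _ _)

  T-scale : ∀ n A c a → T A (λ i → c * a i) n ≈ c * T A a n
  T-scale zero    A c a = refl
  T-scale (suc n) A c a = trans (+-cong (*-congˡ (T-scale n A c a)) (T-scale n A c _))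
    (solve 4 (λ A c a b → A :* (c :* a) :+ c :* b := c :* (A :* a :+ b)) refl _ _ _ _)

  T-T : ∀ n A B a → T A (T B a) n ≈ T (A + B) a n
  T-T zero    A B a = refl
  T-T (suc n) A B a = begin
    A * T A (T B a) n + T A (λ i → B * T B a i + T B (a ∘ suc) i) n
      ≈⟨ +-congˡ (trans (T-+ n A _ _) (+-congʳ (T-scale n A B _))) ⟩
    A * T A (T B a) n + (B * T A (T B a) n + T A (T B (a ∘ suc)) n)
      ≈⟨ +-cong (*-congˡ (T-T n A B a)) (+-cong (*-congˡ (T-T n A B a)) (T-T n A B _)) ⟩
    A * T (A + B) a n + (B * T (A + B) a n + T (A + B) (a ∘ suc) n)
      ≈⟨ solve 4 (λ A B x y → A :* x :+ (B :* x :+ y) := (A :+ B) :* x :+ y) refl _ _ _ _ ⟩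
    (A + B) * T (A + B) a n + T (A + B) (a ∘ suc) n ∎

  T-0 : ∀ n a → T 0# a n ≈ a n
  T-0 zero    a = refl
  T-0 (suc n) a = trans (+-cong (zeroˡ _) (T-0 n _)) (+-identityˡ _)

  T-powers : ∀ n A B → T A (B ^_) n ≈ (A + B) ^ n
  T-powers zero    A B = refl
  T-powers (suc n) A B = trans (+-congˡ (T-scale n A B (B ^_)))
    (trans (sym (distribʳ _ A B)) (*-congˡ (T-powers n A B)))

  δ₀ δ₁ : ℕ → Carrier
  δ₀ zero    = 1#
  δ₀ (suc _) = 0#
  δ₁ zero    = 0#
  δ₁ (suc n) = δ₀ n

  T-0s : ∀ n A → T A (λ _ → 0#) n ≈ 0#
  T-0s zero    A = refl
  T-0s (suc n) A = trans (+-cong (*-congˡ (T-0s n A)) (T-0s n A)) (trans (+-identityʳ _) (zeroʳ A))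

  T-δ₀ : ∀ n A → T A δ₀ n ≈ A ^ n
  T-δ₀ zero    A = refl
  T-δ₀ (suc n) A = trans (+-cong (*-congˡ (T-δ₀ n A)) (T-0s n A)) (+-identityʳ _)

  T-δ₁ : ∀ n A → T A δ₁ (suc n) ≈ ι (suc n) * A ^ n
  T-δ₁ zero    A = trans (+-congʳ (zeroʳ A))
    (solve 0 (con (ℤ.+ 0) :+ con (ℤ.+ 1) := (con (ℤ.+ 1) :+ con (ℤ.+ 0)) :* con (ℤ.+ 1)) refl)
  T-δ₁ (suc n) A = trans (+-cong (*-congˡ (T-δ₁ n A)) (T-δ₀ (suc n) A))
    (solve 3 (λ A i B → A :* (i :* B) :+ A :* B := (con (ℤ.+ 1) :+ i) :* (A :* B)) refl A (ι (suc n)) (A ^ n))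

  T-low : ∀ n A a → (∀ i → i ℕ.< n → a i ≈ 0#) → T A a n ≈ a n
  T-low zero    A a h = refl
  T-low (suc n) A a h = trans (+-cong
      (trans (*-congˡ (trans (T-low n A a (λ i i<n → h i (ℕₚ.m<n⇒m<1+n i<n))) (h n ℕₚ.≤-refl))) (zeroʳ A))
      (T-low n A (a ∘ suc) (λ i i<n → h (suc i) (ℕ.s≤s i<n))))
    (+-identityˡ _)

  -- Only the two top terms of the binomial sum survive. For a sequence fixed by `T 1#` this leaves
  -- (n+1) a_n = 0, the source of the uniqueness of the Bernoulli numbers.
  T-low-suc : ∀ n a → (∀ i → i ℕ.< n → a i ≈ 0#) → T 1# a (suc n) ≈ ι (suc n) * a n + a (suc n)
  T-low-suc zero    a h = +-congʳ (*-congʳ (sym ι-1))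
  T-low-suc (suc n) a h = trans (+-cong (*-congˡ (T-low (suc n) 1# a h)) (T-low-suc n (a ∘ suc) (λ i i<n → h (suc i) (ℕ.s≤s i<n))))
    (solve 3 (λ x i y → con (ℤ.+ 1) :* x :+ (i :* x :+ y) := (con (ℤ.+ 1) :+ i) :* x :+ y) refl (a (suc n)) (ι (suc n)) _)

  T-neg : ∀ n A a → T A (λ i → (- 1#) ^ i * a i) n ≈ (- 1#) ^ n * T (- A) a n
  T-neg zero    A a = refl
  T-neg (suc n) A a = trans (+-cong (*-congˡ (T-neg n A a))
      (trans (T-cong n refl (λ i _ → *-assoc _ _ _)) (trans (T-scale n A (- 1#) _) (*-congˡ (T-neg n A (a ∘ suc))))))
    (solve 4 (λ A s x y → A :* (s :* x) :+ (:- con (ℤ.+ 1)) :* (s :* y) := ((:- con (ℤ.+ 1)) :* s) :* (:- A :* x :+ y)) refl A _ _ _)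

  -- The recursion that defines `T` is Pascal's rule: a factor A + a is either A, which keeps the
  -- index, or a, which raises it.
  T-explicit : ∀ n A a → T A a n ≈ Σ< (suc n) (λ i → ι (n C i) * (A ^ (n ℕ.∸ i) * a i))
  T-explicit zero    A a = sym (trans (+-identityˡ _)
    (trans (*-cong ι-1 (*-identityˡ _)) (*-identityˡ _)))
  T-explicit (suc n) A a = begin
    A * T A a n + T A (a ∘ suc) n
      ≈⟨ +-cong (*-congˡ (T-explicit n A a)) (T-explicit n A (a ∘ suc)) ⟩
    A * Σ< (suc n) (λ i → ι (n C i) * (A ^ (n ℕ.∸ i) * a i)) + Σ< (suc n) t
      ≈⟨ +-congʳ first ⟩
    (ι (suc n C 0) * (A ^ suc n * a 0) + Σ< (suc n) s) + Σ< (suc n) t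
      ≈⟨ trans (+-assoc _ _ _) (+-congˡ (trans (sym (Σ-+ (suc n) s t)) (Σ-cong (suc n) pascal))) ⟩
    ι (suc n C 0) * (A ^ suc n * a 0) + Σ< (suc n) (λ i → ι (suc n C suc i) * (A ^ (n ℕ.∸ i) * a (suc i)))
      ≈⟨ Σ-head (suc n) (λ i → ι (suc n C i) * (A ^ (suc n ℕ.∸ i) * a i)) ⟨
    Σ< (suc (suc n)) (λ i → ι (suc n C i) * (A ^ (suc n ℕ.∸ i) * a i)) ∎
    where
    s t : ℕ → Carrier
    s i = ι (n C suc i) * (A ^ (n ℕ.∸ i) * a (suc i))
    t i = ι (n C i) * (A ^ (n ℕ.∸ i) * a (suc i))
    pascal : ∀ i → i ℕ.< suc n → s i + t i ≈ ι (suc n C suc i) * (A ^ (n ℕ.∸ i) * a (suc i))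
    pascal i _ = trans (+-comm _ _) (trans (sym (distribʳ _ _ _)) (*-congʳ
      (trans (sym (ι-+ (n C i) (n C suc i))) (ι-cong (nCk+nC[k+1]≡[n+1]C[k+1] n i)))))
    u : ℕ → Carrier
    u i = ι (n C i) * (A ^ (suc n ℕ.∸ i) * a i)
    first : A * Σ< (suc n) (λ i → ι (n C i) * (A ^ (n ℕ.∸ i) * a i)) ≈ ι (suc n C 0) * (A ^ suc n * a 0) + Σ< (suc n) s
    first = begin
      A * Σ< (suc n) (λ i → ι (n C i) * (A ^ (n ℕ.∸ i) * a i))
        ≈⟨ Σ-*ˡ (suc n) A _ ⟩
      Σ< (suc n) (λ i → A * (ι (n C i) * (A ^ (n ℕ.∸ i) * a i)))
        ≈⟨ Σ-cong (suc n) (λ i i≤n → trans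
             (solve 4 (λ A c x y → A :* (c :* (x :* y)) := c :* ((A :* x) :* y)) refl A _ _ _)
             (*-congˡ (*-congʳ (reflexive (≡.cong (A ^_) (≡.sym (ℕₚ.+-∸-assoc 1 (ℕ.s≤s⁻¹ i≤n)))))))) ⟩
      Σ< (suc n) u
        -- The term i = n + 1 is appended at no cost, as C(n,n+1) = 0; splitting off the head then
        -- leaves as many terms as in the second sum.
        ≈⟨ trans (+-congˡ (trans (*-congʳ (ι-cong (k>n⇒nCk≡0 (ℕₚ.n<1+n n)))) (zeroˡ _))) (+-identityʳ _) ⟨
      Σ< (suc (suc n)) u
        ≈⟨ Σ-head (suc n) u ⟩
      u 0 + Σ< (suc n) s
        ≈⟨ +-congʳ (*-congʳ (ι-cong (≡.trans (nC0≡1 n) (≡.sym (nC0≡1 (suc n)))))) ⟩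
      ι (suc n C 0) * (A ^ suc n * a 0) + Σ< (suc n) s ∎

-- Polynomial functions and rising factorials

module Polynomials (R : CommutativeRing 0ℓ 0ℓ) where
  open RingTools R

  -- f is a polynomial function of degree < d
  IsPoly : ℕ → (Carrier → Carrier) → Set
  IsPoly zero    f = ∀ A → f A ≈ 0#
  IsPoly (suc d) f = Σ Carrier λ c → Σ (Carrier → Carrier) λ g → IsPoly d g × (∀ A → f A ≈ c + A * g A)

  poly-resp : ∀ d {f g} → (∀ A → g A ≈ f A) → IsPoly d f → IsPoly d g
  poly-resp zero    h f₀            = λ A → trans (h A) (f₀ A)
  poly-resp (suc d) h (c , g , P , e) = c , g , P , λ A → trans (h A) (e A)

  poly-suc : ∀ d {f} → IsPoly d f → IsPoly (suc d) f
  poly-suc zero    f₀              = 0# , (λ _ → 0#) , (λ _ → refl) ,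
    λ A → trans (f₀ A) (sym (trans (+-identityˡ _) (zeroʳ A)))
  poly-suc (suc d) (c , g , P , e) = c , g , poly-suc d P , e

  poly-≤ : ∀ {d d′ f} → d ℕ.≤ d′ → IsPoly d f → IsPoly d′ f
  poly-≤ {d} {f = f} d≤d′ P = go (ℕₚ.≤⇒≤′ d≤d′)
    where
    go : ∀ {d′} → d ℕ.≤′ d′ → IsPoly d′ f
    go (ℕ.≤′-reflexive ≡.refl) = P
    go (ℕ.≤′-step le)          = poly-suc _ (go le)

  poly-0 : ∀ d → IsPoly d (λ _ → 0#)
  poly-0 d = poly-≤ {0} {d} ℕ.z≤n (λ _ → refl)

  poly-const : ∀ c → IsPoly 1 (λ _ → c)
  poly-const c = c , (λ _ → 0#) , (λ _ → refl) , λ A → sym (trans (+-congˡ (zeroʳ A)) (+-identityʳ c))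

  poly-shift : ∀ d {f} → IsPoly d f → IsPoly (suc d) (λ A → A * f A)
  poly-shift d P = 0# , _ , P , λ A → sym (+-identityˡ _)

  poly-+ : ∀ d {f g} → IsPoly d f → IsPoly d g → IsPoly d (λ A → f A + g A)
  poly-+ zero    f₀ g₀ = λ A → trans (+-cong (f₀ A) (g₀ A)) (+-identityʳ 0#)
  poly-+ (suc d) (c , f , P , e) (c′ , f′ , P′ , e′) = c + c′ , (λ A → f A + f′ A) , poly-+ d P P′ ,
    λ A → trans (+-cong (e A) (e′ A))
      (solve 5 (λ A c c′ x y → (c :+ A :* x) :+ (c′ :+ A :* y) := (c :+ c′) :+ A :* (x :+ y)) refl A c c′ _ _)

  poly-*ˡ : ∀ d c {f} → IsPoly d f → IsPoly d (λ A → c * f A)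
  poly-*ˡ zero    c f₀              = λ A → trans (*-congˡ (f₀ A)) (zeroʳ c)
  poly-*ˡ (suc d) c (b , f , P , e) = c * b , (λ A → c * f A) , poly-*ˡ d c P , λ A → trans (*-congˡ (e A))
    (solve 4 (λ A c b x → c :* (b :+ A :* x) := c :* b :+ A :* (c :* x)) refl A c b _)

  poly-Σ : ∀ d n {f : ℕ → Carrier → Carrier} → (∀ i → i ℕ.< n → IsPoly d (f i)) → IsPoly d (λ A → Σ< n (λ i → f i A))
  poly-Σ d zero    h = poly-0 d
  poly-Σ d (suc n) h = poly-+ d (poly-Σ d n (λ i i<n → h i (ℕₚ.m<n⇒m<1+n i<n))) (h n ℕₚ.≤-refl)

  poly-^ : ∀ n → IsPoly (suc n) (_^ n)
  poly-^ zero    = poly-const 1#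
  poly-^ (suc n) = poly-shift (suc n) (poly-^ n)

  -- Synthetic division along the Horner form: if g = g(x) + (A - x) h, then c + A g has the
  -- quotient g(x) + A h.
  poly-factor : ∀ d {f} → IsPoly (suc d) f → ∀ x →
    Σ (Carrier → Carrier) λ g → IsPoly d g × (∀ A → f A ≈ f x + (A - x) * g A)
  poly-factor zero    (c , g , g₀ , e) x = (λ _ → 0#) , (λ _ → refl) , λ A → begin
    _                       ≈⟨ e A ⟩
    c + A * g A             ≈⟨ +-congˡ (*-congˡ (g₀ A)) ⟩
    c + A * 0#              ≈⟨ solve 3 (λ c A x → c :+ A :* con (ℤ.+ 0) := (c :+ x :* con (ℤ.+ 0)) :+ (A :- x) :* con (ℤ.+ 0)) refl c A x ⟩
    (c + x * 0#) + (A - x) * 0#  ≈⟨ +-congʳ (trans (e x) (+-congˡ (*-congˡ (g₀ x)))) ⟨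
    _                       ∎
  poly-factor (suc d) (c , g , P , e) x with poly-factor d P x
  ... | h , Q , e′ = (λ A → g x + A * h A) , (g x , h , Q , λ _ → refl) , λ A → begin
    _                                      ≈⟨ e A ⟩
    c + A * g A                            ≈⟨ +-congˡ (*-congˡ (e′ A)) ⟩
    c + A * (g x + (A - x) * h A)          ≈⟨ solve 5 (λ c A x y z → c :+ A :* (y :+ (A :- x) :* z) := (c :+ x :* y) :+ (A :- x) :* (y :+ A :* z)) refl c A x _ _ ⟩
    (c + x * g x) + (A - x) * (g x + A * h A) ≈⟨ +-congʳ (e x) ⟨
    _                                      ∎

  -- The rising factorial A(A+1)⋯(A+n-1); in particular `rise 1# n` is n!.
  rise : Carrier → ℕ → Carrier
  rise A zero    = 1#
  rise A (suc n) = rise A n * (A + ι n)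

  rise-cong : ∀ n {A B} → A ≈ B → rise A n ≈ rise B n
  rise-cong zero    h = refl
  rise-cong (suc n) h = *-cong (rise-cong n h) (+-congʳ h)

  rise-head : ∀ n A → rise A (suc n) ≈ A * rise (A + 1#) n
  rise-head zero    A = solve 1 (λ A → con (ℤ.+ 1) :* (A :+ con (ℤ.+ 0)) := A :* con (ℤ.+ 1)) refl A
  rise-head (suc n) A = trans (*-congʳ (rise-head n A))
    (solve 3 (λ A i r → (A :* r) :* (A :+ (con (ℤ.+ 1) :+ i)) := A :* (r :* ((A :+ con (ℤ.+ 1)) :+ i))) refl A (ι n) _)

  rise-split : ∀ m n A → rise A (m ℕ.+ n) ≈ rise A m * rise (A + ι m) n
  rise-split m zero    A = trans (reflexive (≡.cong (rise A) (ℕₚ.+-identityʳ m))) (sym (*-identityʳ _))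
  rise-split m (suc n) A = begin
    rise A (m ℕ.+ suc n)                            ≡⟨ ≡.cong (rise A) (ℕₚ.+-suc m n) ⟩
    rise A (m ℕ.+ n) * (A + ι (m ℕ.+ n))            ≈⟨ *-cong (rise-split m n A) (+-congˡ (ι-+ m n)) ⟩
    (rise A m * rise (A + ι m) n) * (A + (ι m + ι n)) ≈⟨ solve 5 (λ x y A i j → (x :* y) :* (A :+ (i :+ j)) := x :* (y :* ((A :+ i) :+ j))) refl _ _ A (ι m) (ι n) ⟩
    rise A m * rise (A + ι m) (suc n) ∎

  rise-vanish : ∀ n s {A} → s ℕ.< n → A + ι s ≈ 0# → rise A n ≈ 0#
  rise-vanish (suc n) s s<1+n h with s ℕ.≟ n
  ... | yes ≡.refl = trans (*-congˡ h) (zeroʳ _)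
  ... | no  s≢n    = trans (*-congʳ (rise-vanish n s (ℕₚ.≤∧≢⇒< (ℕ.s≤s⁻¹ s<1+n) s≢n) h)) (zeroˡ _)

  poly-rise : ∀ n c → IsPoly (suc n) (λ A → rise (A + c) n)
  poly-rise zero    c = poly-const 1#
  poly-rise (suc n) c = poly-resp (suc (suc n))
    (λ A → solve 4 (λ A c i r → r :* ((A :+ c) :+ i) := A :* r :+ (c :+ i) :* r) refl A c (ι n) _)
    (poly-+ (suc (suc n)) (poly-shift (suc n) (poly-rise n c))
      (poly-*ˡ (suc (suc n)) (c + ι n) (poly-suc (suc n) (poly-rise n c))))

-- Polynomial identities in characteristic p

-- The characteristic is p = suc q.
record Characteristic (R : CommutativeRing 0ℓ 0ℓ) (q : ℕ) : Set where
  open RingTools R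
  field
    0<q   : 0 ℕ.< q
    inv   : ℕ → Carrier
    inv-ι : ∀ j → j ℕ.< q → inv (suc j) * ι (suc j) ≈ 1#
    ι-p   : ι (suc q) ≈ 0#

module CharacteristicP (R : CommutativeRing 0ℓ 0ℓ) (q : ℕ) (char : Characteristic R q) where
  open RingTools R
  open Polynomials R
  open BinomialTransform R
  open Characteristic char

  ι-cancelˡ : ∀ j {x} → j ℕ.< q → ι (suc j) * x ≈ 0# → x ≈ 0#
  ι-cancelˡ j {x} j<q h = begin
    x                               ≈⟨ *-identityˡ x ⟨
    1# * x                          ≈⟨ *-congʳ (inv-ι j j<q) ⟨
    (inv (suc j) * ι (suc j)) * x   ≈⟨ *-assoc _ _ _ ⟩
    inv (suc j) * (ι (suc j) * x)   ≈⟨ *-congˡ h ⟩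
    inv (suc j) * 0#                ≈⟨ zeroʳ _ ⟩
    0# ∎

  x≈y : ∀ {x y} → x - y ≈ 0# → x ≈ y
  x≈y {x} {y} h = begin
    x            ≈⟨ solve 2 (λ x y → x := (x :- y) :+ y) refl x y ⟩
    (x - y) + y  ≈⟨ +-congʳ h ⟩
    0# + y       ≈⟨ +-identityˡ y ⟩
    y ∎

  x-y≈0 : ∀ {x y} → x ≈ y → x - y ≈ 0#
  x-y≈0 {x} {y} h = trans (+-congʳ h) (-‿inverseʳ y)

  -- After dividing by A - (c+d), the quotient vanishes at the remaining points because their
  -- distances to c + d lie among 1, ..., p-1 up to sign and are units. So the count of roots works
  -- in power series rings as well.
  poly-zero : ∀ d {f} → d ℕ.≤ suc q → IsPoly d f → ∀ c → (∀ j → j ℕ.< d → f (c + ι j) ≈ 0#) → ∀ A → f A ≈ 0#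
  poly-zero zero        _   P c h A = P A
  poly-zero (suc d) {f} d<p P c h A with poly-factor d P (c + ι d)
  ... | g , Q , e = begin
    f A                                      ≈⟨ e A ⟩
    f (c + ι d) + (A - (c + ι d)) * g A      ≈⟨ +-cong (h d ℕₚ.≤-refl) (*-congˡ (poly-zero d (ℕₚ.<⇒≤ d<p) Q c g-zero A)) ⟩
    0# + (A - (c + ι d)) * 0#                ≈⟨ trans (+-identityˡ _) (zeroʳ _) ⟩
    0# ∎
    where
    g-zero : ∀ j → j ℕ.< d → g (c + ι j) ≈ 0#
    g-zero j j<d = ι-cancelˡ k (ℕₚ.≤-trans (ℕₚ.≤-trans (ℕₚ.m≤n+m (suc k) j) (ℕₚ.≤-reflexive (≡.sym d≡))) (ℕ.s≤s⁻¹ d<p)) (begin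
      ι (suc k) * g (c + ι j)
        ≈⟨ solve 4 (λ k c j g → k :* g := :- ((c :+ j :- (c :+ (j :+ k))) :* g)) refl (ι (suc k)) c (ι j) _ ⟩
      - ((c + ι j - (c + (ι j + ι (suc k)))) * g (c + ι j))
        ≈⟨ -‿cong (*-congʳ (+-congˡ (-‿cong (+-congˡ (trans (ι-cong d≡) (ι-+ j (suc k))))))) ⟨
      - ((c + ι j - (c + ι d)) * g (c + ι j))
        ≈⟨ -‿cong (trans (+-congʳ (h d ℕₚ.≤-refl)) (+-identityˡ _)) ⟨
      - (f (c + ι d) + (c + ι j - (c + ι d)) * g (c + ι j))
        ≈⟨ -‿cong (e (c + ι j)) ⟨
      - f (c + ι j)
        ≈⟨ trans (-‿cong (h j (ℕₚ.m<n⇒m<1+n j<d))) -0#≈0# ⟩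
      0# ∎)
      where
      k : ℕ
      k = d ℕ.∸ suc j
      d≡ : d ≡ j ℕ.+ suc k
      d≡ = ≡.trans (≡.sym (ℕₚ.m+[n∸m]≡n j<d)) (≡.sym (ℕₚ.+-suc j k))

  poly-ext : ∀ {f g} → IsPoly (suc q) f → IsPoly (suc q) g →
    (∀ j → j ℕ.< suc q → f (ι j) ≈ g (ι j)) → (∀ {A B} → A ≈ B → f A - g A ≈ f B - g B) → ∀ A → f A ≈ g A
  poly-ext P Q h resp A = x≈y (poly-zero (suc q) ℕₚ.≤-refl
    (poly-+ (suc q) P (poly-resp (suc q) (λ B → solve 1 (λ x → :- x := con (ℤ.- (ℤ.+ 1)) :* x) refl _) (poly-*ˡ (suc q) _ Q)))
    0# (λ j j<p → trans (resp (+-identityˡ _)) (x-y≈0 (h j j<p))) A)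

  C-vanish : ∀ i → i ℕ.< q → ι (suc q C suc i) ≈ 0#
  C-vanish i i<q = ι-cancelˡ i i<q (begin
    ι (suc i) * ι (suc q C suc i)    ≈⟨ ι-* (suc i) (suc q C suc i) ⟨
    ι (suc i ℕ.* (suc q C suc i))    ≈⟨ ι-cong ([1+k]*[1+n]C[1+k] q i) ⟩
    ι (suc q ℕ.* (q C i))            ≈⟨ ι-* (suc q) (q C i) ⟩
    ι (suc q) * ι (q C i)            ≈⟨ *-congʳ ι-p ⟩
    0# * ι (q C i)                   ≈⟨ zeroˡ _ ⟩
    0# ∎)

  1^ : ∀ n → 1# ^ n ≈ 1#
  1^ zero    = refl
  1^ (suc n) = trans (*-identityˡ _) (1^ n)

  frobenius-+1 : ∀ A → (1# + A) ^ suc q ≈ 1# + A ^ suc q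
  frobenius-+1 A = begin
    (1# + A) ^ suc q
      ≈⟨ T-powers (suc q) 1# A ⟨
    T 1# (A ^_) (suc q)
      ≈⟨ T-explicit (suc q) 1# (A ^_) ⟩
    Σ< (suc q) term + term (suc q)
      ≈⟨ +-cong (trans (Σ-head q term) (+-congˡ (Σ-zero q (λ i i<q → trans (*-congʳ (C-vanish i i<q)) (zeroˡ _)))))
           (*-congʳ (trans (ι-cong (nCn≡1 (suc q))) ι-1)) ⟩
    (term 0 + 0#) + 1# * (1# ^ (q ℕ.∸ q) * A ^ suc q)
      ≈⟨ +-cong (+-congʳ (*-cong (trans (ι-cong (nC0≡1 (suc q))) ι-1) (*-congʳ (1^ (suc q))))) (*-congˡ (*-congʳ (1^ (q ℕ.∸ q)))) ⟩
    (1# * (1# * 1#) + 0#) + 1# * (1# * A ^ suc q)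
      ≈⟨ solve 1 (λ x → (con (ℤ.+ 1) :* (con (ℤ.+ 1) :* con (ℤ.+ 1)) :+ con (ℤ.+ 0)) :+ con (ℤ.+ 1) :* (con (ℤ.+ 1) :* x) := con (ℤ.+ 1) :+ x) refl _ ⟩
    1# + A ^ suc q ∎
    where
    term : ℕ → Carrier
    term i = ι (suc q C i) * (1# ^ (suc q ℕ.∸ i) * A ^ i)

  fermat : ∀ n → ι n ^ suc q ≈ ι n
  fermat zero    = zeroˡ _
  fermat (suc n) = trans (frobenius-+1 (ι n)) (+-congˡ (fermat n))

  fermat-unit : ∀ j → j ℕ.< q → ι (suc j) ^ q ≈ 1#
  fermat-unit j j<q = x≈y (ι-cancelˡ j j<q (trans
    (solve 2 (λ x y → x :* (y :- con (ℤ.+ 1)) := x :* y :- x) refl _ _) (x-y≈0 (fermat (suc j)))))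

  0^ : ∀ n → 0 ℕ.< n → 0# ^ n ≈ 0#
  0^ (suc n) _ = zeroˡ _

  -- (p-1)!, kept as the product 1⋅2⋯(p-1) so that it can be cancelled factor by factor at the end.
  q! : Carrier
  q! = rise 1# q

  -- The product (A+1)⋯(A+p-1) vanishes at 1, …, p-1, as does 1 - A^(p-1).
  rise-q : ∀ A → rise (A + 1#) q ≈ q! * (1# - A ^ q)
  rise-q = poly-ext (poly-rise q 1#)
      (poly-*ˡ (suc q) q! (poly-+ (suc q) (poly-≤ (ℕ.s≤s ℕ.z≤n) (poly-const 1#))
        (poly-resp (suc q) (λ B → solve 1 (λ x → :- x := con (ℤ.- (ℤ.+ 1)) :* x) refl _) (poly-*ˡ (suc q) _ (poly-^ q)))))
      at-ι (λ A≈B → +-cong (rise-cong q (+-congʳ A≈B)) (-‿cong (*-congˡ (+-congˡ (-‿cong (^-congˡ q A≈B))))))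
    where
    at-ι : ∀ j → j ℕ.< suc q → rise (ι j + 1#) q ≈ q! * (1# - ι j ^ q)
    at-ι zero    _ = trans (rise-cong q (+-identityˡ 1#)) (sym (trans (*-congˡ (+-congˡ (-‿cong (0^ q 0<q))))
      (solve 1 (λ x → x :* (con (ℤ.+ 1) :- con (ℤ.+ 0)) := x) refl q!)))
    at-ι (suc j) j<p = trans (rise-vanish q (q ℕ.∸ suc j) (ℕₚ.∸-monoʳ-< (ℕ.s≤s ℕ.z≤n) j<q) (begin
        ι (suc j) + 1# + ι (q ℕ.∸ suc j)      ≈⟨ solve 2 (λ x y → x :+ con (ℤ.+ 1) :+ y := con (ℤ.+ 1) :+ (x :+ y)) refl _ _ ⟩
        1# + (ι (suc j) + ι (q ℕ.∸ suc j))    ≈⟨ +-congˡ (trans (sym (ι-+ (suc j) _)) (ι-cong (ℕₚ.m+[n∸m]≡n j<q))) ⟩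
        ι (suc q)                             ≈⟨ ι-p ⟩
        0# ∎))
      (sym (trans (*-congˡ (x-y≈0 (sym (fermat-unit j j<q)))) (zeroʳ q!)))
      where
      j<q : suc j ℕ.≤ q
      j<q = ℕ.s≤s⁻¹ j<p

  Σ-telescope : ∀ n (u : ℕ → Carrier) → Σ< n (λ i → u (suc i) - u i) ≈ u n - u 0
  Σ-telescope zero    u = sym (-‿inverseʳ (u 0))
  Σ-telescope (suc n) u = trans (+-congʳ (Σ-telescope n u))
    (solve 3 (λ a b c → (b :- c) :+ (a :- b) := a :- c) refl _ _ _)

  powers-quotient : Carrier → Carrier → Carrier
  powers-quotient A B = Σ< q (λ j → A ^ j * B ^ (q ℕ.∸ suc j))

  powers-difference : ∀ A B → (A - B) * powers-quotient A B ≈ A ^ q - B ^ q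
  powers-difference A B = begin
    (A - B) * powers-quotient A B             ≈⟨ Σ-*ˡ q _ _ ⟩
    Σ< q (λ j → (A - B) * (A ^ j * B ^ (q ℕ.∸ suc j)))  ≈⟨ Σ-cong q step ⟩
    Σ< q (λ j → u (suc j) - u j)              ≈⟨ Σ-telescope q u ⟩
    A ^ q * B ^ (q ℕ.∸ q) - 1# * B ^ q        ≈⟨ +-cong (*-congˡ (reflexive (≡.cong (B ^_) (ℕₚ.n∸n≡0 q)))) refl ⟩
    A ^ q * 1# - 1# * B ^ q                   ≈⟨ solve 2 (λ x y → x :* con (ℤ.+ 1) :- con (ℤ.+ 1) :* y := x :- y) refl _ _ ⟩
    A ^ q - B ^ q ∎
    where
    u : ℕ → Carrier
    u j = A ^ j * B ^ (q ℕ.∸ j)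
    step : ∀ j → j ℕ.< q → (A - B) * (A ^ j * B ^ (q ℕ.∸ suc j)) ≈ u (suc j) - u j
    step j j<q = trans
      (solve 4 (λ A B x y → (A :- B) :* (x :* y) := (A :* x) :* y :- x :* (B :* y)) refl A B _ _)
      (+-congˡ (-‿cong (*-congˡ (reflexive (≡.cong (B ^_) (≡.sym (∸-suc j<q)))))))

  -- The divided difference of (A+1)⋯(A+p-1). Exchanging A for B one factor at a time, the exchange
  -- of factor i + 1 contributes A - B times (A+1)⋯(A+i) (B+i+2)⋯(B+p-1).
  rise-quotient : Carrier → Carrier → Carrier
  rise-quotient A B = Σ< q (λ i → rise (A + 1#) i * rise (B + ι (suc (suc i))) (q ℕ.∸ suc i))

  rise-difference : ∀ A B → (A - B) * rise-quotient A B ≈ rise (A + 1#) q - rise (B + 1#) q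
  rise-difference A B = begin
    (A - B) * rise-quotient A B               ≈⟨ Σ-*ˡ q _ _ ⟩
    Σ< q (λ i → (A - B) * (rise (A + 1#) i * rise (B + ι (suc (suc i))) (q ℕ.∸ suc i))) ≈⟨ Σ-cong q step ⟩
    Σ< q (λ i → u (suc i) - u i)              ≈⟨ Σ-telescope q u ⟩
    rise (A + 1#) q * rise (B + ι (suc q)) (q ℕ.∸ q) - 1# * rise (B + ι 1) q
      ≈⟨ +-cong (*-congˡ (reflexive (≡.cong (rise _) (ℕₚ.n∸n≡0 q)))) (-‿cong (*-congˡ (rise-cong q (+-congˡ ι-1)))) ⟩
    rise (A + 1#) q * 1# - 1# * rise (B + 1#) q
      ≈⟨ solve 2 (λ x y → x :* con (ℤ.+ 1) :- con (ℤ.+ 1) :* y := x :- y) refl _ _ ⟩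
    rise (A + 1#) q - rise (B + 1#) q ∎
    where
    u : ℕ → Carrier
    u i = rise (A + 1#) i * rise (B + ι (suc i)) (q ℕ.∸ i)
    step : ∀ i → i ℕ.< q → (A - B) * (rise (A + 1#) i * rise (B + ι (suc (suc i))) (q ℕ.∸ suc i)) ≈ u (suc i) - u i
    step i i<q = begin
      (A - B) * (rise (A + 1#) i * rise (B + ι (suc (suc i))) (q ℕ.∸ suc i))
        ≈⟨ solve 5 (λ A B x y i → (A :- B) :* (x :* y) := (x :* ((A :+ con (ℤ.+ 1)) :+ i)) :* y :- x :* ((B :+ (con (ℤ.+ 1) :+ i)) :* y)) refl A B _ _ (ι i) ⟩
      u (suc i) - rise (A + 1#) i * ((B + ι (suc i)) * rise (B + ι (suc (suc i))) (q ℕ.∸ suc i))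
        ≈⟨ +-congˡ (-‿cong (*-congˡ (*-congˡ (rise-cong (q ℕ.∸ suc i)
             (solve 2 (λ B i → B :+ (con (ℤ.+ 1) :+ i) := (B :+ i) :+ con (ℤ.+ 1)) refl B (ι (suc i))))))) ⟩
      u (suc i) - rise (A + 1#) i * ((B + ι (suc i)) * rise (B + ι (suc i) + 1#) (q ℕ.∸ suc i))
        ≈⟨ +-congˡ (-‿cong (*-congˡ (trans (sym (rise-head (q ℕ.∸ suc i) (B + ι (suc i)))) (reflexive (≡.cong (rise _) (≡.sym (∸-suc i<q))))))) ⟩
      u (suc i) - u i ∎

  -- Both sides are polynomials of degree p-2 in B which agree at the p-1 points B ≠ x.
  rise-quotient-ι : ∀ x B → rise-quotient (ι x) B ≈ - (q! * powers-quotient (ι x) B)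
  rise-quotient-ι x B = x≈-y (poly-zero q (ℕₚ.n≤1+n q) poly (ι x + 1#) at-points B)
    where
    x≈-y : ∀ {a b} → a + b ≈ 0# → a ≈ - b
    x≈-y {a} {b} h = trans (solve 2 (λ a b → a := (a :+ b) :- b) refl a b) (trans (+-congʳ h) (+-identityˡ _))
    f : Carrier → Carrier
    f B = rise-quotient (ι x) B + q! * powers-quotient (ι x) B
    poly : IsPoly q f
    poly = poly-+ q
      (poly-Σ q q (λ i i<q → poly-*ˡ q _ (poly-≤ (ℕₚ.≤-trans (ℕₚ.≤-reflexive (≡.sym (∸-suc i<q))) (ℕₚ.m∸n≤m q i)) (poly-rise (q ℕ.∸ suc i) _))))
      (poly-*ˡ q q! (poly-Σ q q (λ i i<q → poly-*ˡ q _ (poly-≤ (ℕₚ.≤-trans (ℕₚ.≤-reflexive (≡.sym (∸-suc i<q))) (ℕₚ.m∸n≤m q i)) (poly-^ (q ℕ.∸ suc i))))))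
    at-points : ∀ j → j ℕ.< q → f (ι x + 1# + ι j) ≈ 0#
    at-points j j<q = ι-cancelˡ j j<q (begin
      ι (suc j) * f y
        ≈⟨ solve 3 (λ x j z → (con (ℤ.+ 1) :+ j) :* z := :- ((x :- ((x :+ con (ℤ.+ 1)) :+ j)) :* z)) refl (ι x) (ι j) (f y) ⟩
      - ((ι x - y) * f y)
        ≈⟨ -‿cong (solve 4 (λ a b c w → a :* (b :+ w :* c) := a :* b :+ w :* (a :* c)) refl _ _ _ _) ⟩
      - ((ι x - y) * rise-quotient (ι x) y + q! * ((ι x - y) * powers-quotient (ι x) y))
        ≈⟨ -‿cong (+-cong (trans (rise-difference (ι x) y) (+-cong (rise-q (ι x)) (-‿cong (rise-q y)))) (*-congˡ (powers-difference (ι x) y))) ⟩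
      - ((q! * (1# - ι x ^ q) - q! * (1# - y ^ q)) + q! * (ι x ^ q - y ^ q))
        ≈⟨ solve 3 (λ w a b → :- ((w :* (con (ℤ.+ 1) :- a) :- w :* (con (ℤ.+ 1) :- b)) :+ w :* (a :- b)) := con (ℤ.+ 0)) refl q! _ _ ⟩
      0# ∎)
      where
      y = ι x + 1# + ι j

-- Faulhaber polynomials and the solution of the two-term recursion

-- β is a sequence of Bernoulli numbers, as far as these are p-integral.
record BernoulliNumbers (R : CommutativeRing 0ℓ 0ℓ) (q : ℕ) : Set where
  open RingTools R
  open BinomialTransform R
  field
    β     : ℕ → Carrier
    β-rec : ∀ n → n ℕ.≤ q → T 1# β n ≈ β n + δ₁ n

module ContiguousSequence (R : CommutativeRing 0ℓ 0ℓ) (q : ℕ) (char : Characteristic R q) (bern : BernoulliNumbers R q) where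
  open RingTools R
  open Polynomials R
  open BinomialTransform R
  open Characteristic char
  open CharacteristicP R q char
  open BernoulliNumbers bern

  -- The Faulhaber polynomial 0^j + 1^j + ⋯ + (A-1)^j
  powerSum : ℕ → Carrier → Carrier
  powerSum j A = inv (suc j) * (T A β (suc j) - β (suc j))

  powerSum-explicit : ∀ j A → powerSum j A ≈ Σ< (suc j) (λ i → inv (suc j) * (ι (suc j C i) * (A ^ (suc j ℕ.∸ i) * β i)))
  powerSum-explicit j A = trans (*-congˡ (begin
    T A β (suc j) - β (suc j)                        ≈⟨ +-congʳ (T-explicit (suc j) A β) ⟩
    (Σ< (suc j) t + t (suc j)) - β (suc j)           ≈⟨ +-congʳ (+-congˡ last-term) ⟩
    (Σ< (suc j) t + β (suc j)) - β (suc j)           ≈⟨ solve 2 (λ x y → (x :+ y) :- y := x) refl _ _ ⟩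
    Σ< (suc j) t ∎)) (Σ-*ˡ (suc j) (inv (suc j)) t)
    where
    t : ℕ → Carrier
    t i = ι (suc j C i) * (A ^ (suc j ℕ.∸ i) * β i)
    last-term : t (suc j) ≈ β (suc j)
    last-term = trans (*-cong (trans (ι-cong (nCn≡1 (suc j))) ι-1) (*-congʳ (reflexive (≡.cong (A ^_) (ℕₚ.n∸n≡0 j)))))
      (trans (*-identityˡ _) (*-identityˡ _))

  powerSum-cong : ∀ j {A B} → A ≈ B → powerSum j A ≈ powerSum j B
  powerSum-cong j h = *-congˡ (+-congʳ (T-cong (suc j) h (λ _ _ → refl)))

  powerSum-0 : ∀ j → powerSum j 0# ≈ 0#
  powerSum-0 j = trans (*-congˡ (x-y≈0 (T-0 (suc j) β))) (zeroʳ _)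

  -- Umbrally, ((A + 1) + β)^(j+1) = (A + (1 + β))^(j+1), where 1 + β may be replaced by β up to the
  -- correction `δ₁`, which contributes (j+1) A^j.
  powerSum-suc : ∀ j A → j ℕ.< q → powerSum j (A + 1#) ≈ powerSum j A + A ^ j
  powerSum-suc j A j<q = begin
    inv (suc j) * (T (A + 1#) β (suc j) - β (suc j))
      ≈⟨ *-congˡ (+-congʳ (trans (sym (T-T (suc j) A 1# β)) (trans (T-cong (suc j) refl (λ i i≤ → β-rec i (ℕₚ.≤-trans i≤ j<q)))
           (trans (T-+ (suc j) A β δ₁) (+-congˡ (T-δ₁ j A)))))) ⟩
    inv (suc j) * ((T A β (suc j) + ι (suc j) * A ^ j) - β (suc j))
      ≈⟨ solve 5 (λ u t i x b → u :* ((t :+ i :* x) :- b) := u :* (t :- b) :+ (u :* i) :* x) refl _ _ _ _ _ ⟩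
    powerSum j A + (inv (suc j) * ι (suc j)) * A ^ j
      ≈⟨ +-congˡ (trans (*-congʳ (inv-ι j j<q)) (*-identityˡ _)) ⟩
    powerSum j A + A ^ j ∎

  poly-T : ∀ n a → IsPoly (suc n) (λ A → T A a n)
  poly-T zero    a = poly-const (a 0)
  poly-T (suc n) a = poly-+ (suc (suc n)) (poly-shift (suc n) (poly-T n a)) (poly-suc (suc n) (poly-T n (a ∘ suc)))

  poly-powerSum : ∀ j → IsPoly (suc (suc j)) (powerSum j)
  poly-powerSum j = poly-*ˡ (suc (suc j)) _
    (poly-+ (suc (suc j)) (poly-T (suc j) β) (poly-≤ (ℕ.s≤s ℕ.z≤n) (poly-const _)))

  -- The recursion yields e_(i+1) = A⋯(A+i) / ((B+1)⋯(B+i+1)) e_0. Over the common denominator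
  -- (B+1)⋯(B+p-1) the factors (B+i+2)⋯(B+p-1) remain in the numerator.
  Q : Carrier → Carrier → Carrier
  Q A B = Σ< q (λ i → inv (suc i) * (rise A (suc i) * rise (B + ι (suc (suc i))) (q ℕ.∸ suc i)))

  -- For a natural number A below p, this sums the divided differences (x^(p-1) - B^(p-1))/(x - B) =
  -- Σ x^j B^(p-2-j) over 0 ≤ x < A.
  weightedPowerSums : Carrier → Carrier → Carrier
  weightedPowerSums A B = Σ< q (λ j → B ^ (q ℕ.∸ suc j) * powerSum j A)

  Q-cong : ∀ B {A A′} → A ≈ A′ → Q A B ≈ Q A′ B
  Q-cong B h = Σ-cong q (λ i _ → *-congˡ (*-congʳ (rise-cong (suc i) h)))

  wps-cong : ∀ B {A A′} → A ≈ A′ → weightedPowerSums A B ≈ weightedPowerSums A′ B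
  wps-cong B h = Σ-cong q (λ j _ → *-congˡ (powerSum-cong j h))

  -- The products (A+1)⋯(A+i+1) and A⋯(A+i) share i factors and differ by i + 1 times these. The
  -- weight 1/(i+1) cancels, and what remains is the divided difference term by term.
  Q-suc : ∀ A B → Q (A + 1#) B ≈ Q A B + rise-quotient A B
  Q-suc A B = trans (Σ-cong q step) (Σ-+ q _ _)
    where
    step : ∀ i → i ℕ.< q →
      inv (suc i) * (rise (A + 1#) (suc i) * rise (B + ι (suc (suc i))) (q ℕ.∸ suc i)) ≈
      inv (suc i) * (rise A (suc i) * rise (B + ι (suc (suc i))) (q ℕ.∸ suc i)) +
      rise (A + 1#) i * rise (B + ι (suc (suc i))) (q ℕ.∸ suc i)
    step i i<q = begin
      inv (suc i) * ((r * (A + 1# + ι i)) * s)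
        ≈⟨ solve 5 (λ u r A i s → u :* ((r :* (A :+ con (ℤ.+ 1) :+ i)) :* s) := u :* ((A :* r) :* s) :+ (u :* (con (ℤ.+ 1) :+ i)) :* (r :* s)) refl _ r A (ι i) s ⟩
      inv (suc i) * ((A * r) * s) + (inv (suc i) * ι (suc i)) * (r * s)
        ≈⟨ +-cong (*-congˡ (*-congʳ (sym (rise-head i A)))) (trans (*-congʳ (inv-ι i i<q)) (*-identityˡ _)) ⟩
      inv (suc i) * (rise A (suc i) * s) + r * s ∎
      where
      r = rise (A + 1#) i
      s = rise (B + ι (suc (suc i))) (q ℕ.∸ suc i)

  wps-suc : ∀ A B → weightedPowerSums (A + 1#) B ≈ weightedPowerSums A B + powers-quotient A B
  wps-suc A B = trans (Σ-cong q (λ j j<q → trans (*-congˡ (powerSum-suc j A j<q))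
    (trans (distribˡ _ _ _) (+-congˡ (*-comm _ _))))) (Σ-+ q _ _)

  rise-0# : ∀ n → rise 0# (suc n) ≈ 0#
  rise-0# n = trans (rise-head n 0#) (zeroˡ _)

  -- Equal at A = 0 with equal differences, hence equal at all x in the prime field.
  Q-powerSums : ∀ A B → Q A B ≈ - (q! * weightedPowerSums A B)
  -- Both sides have degree at most p - 1 in A, so the p values at the prime field decide the
  -- identity for every A in the ring.
  Q-powerSums A B = poly-ext
    (poly-Σ (suc q) q (λ i i<q → poly-*ˡ (suc q) _ (poly-resp (suc q) (λ A → *-comm _ _) (poly-*ˡ (suc q) _
      (poly-≤ (ℕ.s≤s i<q) (poly-resp (suc (suc i)) (λ A → rise-cong (suc i) (sym (+-identityʳ A))) (poly-rise (suc i) 0#)))))))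
    (poly-resp (suc q) (λ A → solve 2 (λ w x → :- (w :* x) := :- w :* x) refl _ _) (poly-*ˡ (suc q) (- q!)
      (poly-Σ (suc q) q (λ j j<q → poly-*ˡ (suc q) _ (poly-≤ (ℕ.s≤s j<q) (poly-powerSum j))))))
    (λ j _ → at-ι j)
    (λ h → +-cong (Q-cong B h) (-‿cong (-‿cong (*-congˡ (wps-cong B h))))) A
    where
    at-ι : ∀ x → Q (ι x) B ≈ - (q! * weightedPowerSums (ι x) B)
    at-ι zero    = trans
      (Σ-zero q (λ i _ → trans (*-congˡ (trans (*-congʳ (rise-0# i)) (zeroˡ _))) (zeroʳ _)))
      (sym (trans (-‿cong (trans (*-congˡ (Σ-zero q (λ j _ → trans (*-congˡ (powerSum-0 j)) (zeroʳ _)))) (zeroʳ _))) -0#≈0#))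
    at-ι (suc x) = begin
      Q (ι (suc x)) B                                       ≈⟨ Q-cong B (+-comm _ _) ⟩
      Q (ι x + 1#) B                                        ≈⟨ Q-suc (ι x) B ⟩
      Q (ι x) B + rise-quotient (ι x) B                     ≈⟨ +-cong (at-ι x) (rise-quotient-ι x B) ⟩
      - (q! * weightedPowerSums (ι x) B) + - (q! * powers-quotient (ι x) B)
        ≈⟨ solve 3 (λ w a b → :- (w :* a) :+ :- (w :* b) := :- (w :* (a :+ b))) refl q! _ _ ⟩
      - (q! * (weightedPowerSums (ι x) B + powers-quotient (ι x) B))
        ≈⟨ -‿cong (*-congˡ (trans (wps-cong B (+-comm 1# (ι x))) (wps-suc (ι x) B))) ⟨
      - (q! * weightedPowerSums (ι (suc x)) B) ∎

  rise-1-cancel : ∀ n {x} → n ℕ.≤ q → rise 1# n * x ≈ 0# → x ≈ 0#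
  rise-1-cancel zero    _   h = trans (sym (*-identityˡ _)) h
  rise-1-cancel (suc n) n<q h = ι-cancelˡ n n<q (rise-1-cancel n (ℕₚ.<⇒≤ n<q) (trans (sym (*-assoc _ _ _)) h))

  module _ (A B : Carrier) (e : ℕ → Carrier) (B^q≈0 : B ^ q ≈ 0#)
    (e-rec : ∀ i → i ℕ.< q → (ι (suc i) + B) * e (suc i) ≈ (ι i + A) * e i) where

    rise-e : ∀ i → i ℕ.≤ q → rise (B + 1#) i * e i ≈ rise A i * e 0
    rise-e zero    _   = refl
    rise-e (suc i) i<q = begin
      (rise (B + 1#) i * (B + 1# + ι i)) * e (suc i)
        ≈⟨ solve 4 (λ r B i e → (r :* (B :+ con (ℤ.+ 1) :+ i)) :* e := r :* (((con (ℤ.+ 1) :+ i) :+ B) :* e)) refl _ B (ι i) _ ⟩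
      rise (B + 1#) i * ((ι (suc i) + B) * e (suc i))   ≈⟨ *-congˡ (e-rec i i<q) ⟩
      rise (B + 1#) i * ((ι i + A) * e i)               ≈⟨ solve 4 (λ r A i e → r :* ((i :+ A) :* e) := (A :+ i) :* (r :* e)) refl _ A (ι i) _ ⟩
      (A + ι i) * (rise (B + 1#) i * e i)               ≈⟨ *-congˡ (rise-e i (ℕₚ.<⇒≤ i<q)) ⟩
      (A + ι i) * (rise A i * e 0)                      ≈⟨ solve 3 (λ a r e → a :* (r :* e) := (r :* a) :* e) refl _ _ _ ⟩
      rise A (suc i) * e 0 ∎

    -- As B^(p-1) = 0, `rise-q` gives (p-1)! = (B+1)⋯(B+p-1). The first i + 1 of these factors
    -- convert e_(i+1) into a multiple of e_0 by `rise-e`; the others are left over.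
    q!*e : ∀ i → i ℕ.< q → q! * e (suc i) ≈ (rise A (suc i) * rise (B + ι (suc (suc i))) (q ℕ.∸ suc i)) * e 0
    q!*e i i<q = begin
      q! * e (suc i)
        ≈⟨ *-congʳ (trans (rise-q B) (trans (*-congˡ (trans (+-congˡ (trans (-‿cong B^q≈0) -0#≈0#)) (+-identityʳ 1#))) (*-identityʳ q!))) ⟨
      rise (B + 1#) q * e (suc i)
        ≈⟨ *-congʳ (trans (reflexive (≡.cong (rise (B + 1#)) (≡.sym (ℕₚ.m+[n∸m]≡n i<q)))) (rise-split (suc i) (q ℕ.∸ suc i) (B + 1#))) ⟩
      (rise (B + 1#) (suc i) * rise (B + 1# + ι (suc i)) (q ℕ.∸ suc i)) * e (suc i)
        ≈⟨ *-congʳ (*-congˡ (rise-cong (q ℕ.∸ suc i) (+-assoc B 1# _))) ⟩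
      (rise (B + 1#) (suc i) * rise (B + ι (suc (suc i))) (q ℕ.∸ suc i)) * e (suc i)
        ≈⟨ solve 3 (λ a b c → (a :* b) :* c := (a :* c) :* b) refl _ _ _ ⟩
      (rise (B + 1#) (suc i) * e (suc i)) * rise (B + ι (suc (suc i))) (q ℕ.∸ suc i)
        ≈⟨ *-congʳ (rise-e (suc i) i<q) ⟩
      (rise A (suc i) * e 0) * rise (B + ι (suc (suc i))) (q ℕ.∸ suc i)
        ≈⟨ solve 3 (λ a b c → (a :* c) :* b := (a :* b) :* c) refl _ _ _ ⟩
      (rise A (suc i) * rise (B + ι (suc (suc i))) (q ℕ.∸ suc i)) * e 0 ∎

    contiguous-sum : Σ< q (λ i → inv (suc i) * e (suc i)) ≈ - (e 0 * weightedPowerSums A B)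
    contiguous-sum = x≈y (rise-1-cancel q ℕₚ.≤-refl (begin
      q! * (V - - (e 0 * weightedPowerSums A B))
        ≈⟨ solve 4 (λ w v a b → w :* (v :- :- (a :* b)) := w :* v :- (:- (w :* b)) :* a) refl q! V (e 0) _ ⟩
      q! * V - (- (q! * weightedPowerSums A B)) * e 0
        ≈⟨ x-y≈0 (trans q!*V (*-congʳ (Q-powerSums A B))) ⟩
      0# ∎))
      where
      V = Σ< q (λ i → inv (suc i) * e (suc i))
      q!*V : q! * V ≈ Q A B * e 0
      q!*V = trans (Σ-*ˡ q q! _) (trans (Σ-cong q (λ i i<q → trans
        (solve 3 (λ w u x → w :* (u :* x) := u :* (w :* x)) refl q! _ _)
        (trans (*-congˡ (q!*e i i<q)) (solve 3 (λ u r e → u :* (r :* e) := e :* (u :* r)) refl _ _ _))))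
        (trans (sym (Σ-*ˡ q (e 0) _)) (*-comm _ _)))

-- Characteristic p and Bernoulli numbers in series rings

module SeriesCharacteristic (R : CommutativeRing 0ℓ 0ℓ) (Bd : ℕ → Set) (down : ∀ {n} → Bd (suc n) → Bd n) where
  open PowerSeries R Bd down
  private
    module R = RingTools R
    module TR = BinomialTransform R
  open RingTools series-commutativeRing
  open BinomialTransform series-commutativeRing

  -- The inverses are lifted as constant series. The lift is applied twice: to series in y over the
  -- prime field, and to series in t over those.
  series-characteristic : ∀ {q} → Characteristic R q → Characteristic series-commutativeRing q
  series-characteristic {q} char = record
    { 0<q   = C.0<q
    ; inv   = const ∘ C.inv
    ; inv-ι = λ j j<q → trans (*-congˡ (sym (const-ι (suc j)))) (trans (sym (const-* _ _)) (const-cong (C.inv-ι j j<q)))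
    ; ι-p   = trans (sym (const-ι (suc q))) (trans (const-cong C.ι-p) const-0)
    }
    where module C = Characteristic char

  T-const : ∀ n a → T 1# (const ∘ a) n ≋ const (TR.T R.1# a n)
  T-const zero    a = refl
  T-const (suc n) a = trans (+-cong (trans (*-identityˡ _) (T-const n a)) (T-const n (a ∘ suc)))
    (trans (sym (const-+ _ _)) (const-cong (R.+-congʳ (R.sym (R.*-identityˡ _)))))

  const-δ₁ : ∀ n → const (TR.δ₁ n) ≋ δ₁ n
  const-δ₁ zero          = const-0
  const-δ₁ (suc zero)    = refl
  const-δ₁ (suc (suc n)) = const-0

  series-bernoulli : ∀ {q} → BernoulliNumbers R q → BernoulliNumbers series-commutativeRing q
  series-bernoulli bern = record
    { β     = const ∘ B.β
    ; β-rec = λ n n≤q → trans (T-const n B.β) (trans (const-cong (B.β-rec n n≤q))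
        (trans (const-+ _ _) (+-congˡ (const-δ₁ n))))
    }
    where module B = BernoulliNumbers bern

-- The coefficients of Φ

module SignedBinomials (R : CommutativeRing 0ℓ 0ℓ) (q : ℕ) (char : Characteristic R q) where
  open RingTools R
  open BinomialTransform R
  open Characteristic char
  open CharacteristicP R q char

  -- C(p-1-c, a) = C(-(c+1), a) in characteristic p
  C-reflect : ∀ c a → c ℕ.≤ q → a ℕ.≤ q → ι ((q ℕ.∸ c) C a) ≈ (- 1#) ^ a * ι ((c ℕ.+ a) C a)
  C-reflect c zero _ _ = trans (ι-cong (≡.trans (nC0≡1 (q ℕ.∸ c)) (≡.sym (nC0≡1 (c ℕ.+ 0))))) (sym (*-identityˡ _))
  C-reflect zero (suc a) _ a<q = begin
    ι (q C suc a)
      ≈⟨ solve 2 (λ x y → y := (x :+ y) :- x) refl (ι (q C a)) _ ⟩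
    (ι (q C a) + ι (q C suc a)) - ι (q C a)
      ≈⟨ +-cong (trans (sym (ι-+ (q C a) _)) (trans (ι-cong (nCk+nC[k+1]≡[n+1]C[k+1] q a)) (C-vanish a a<q)))
           (-‿cong (trans (C-reflect 0 a ℕ.z≤n (ℕₚ.<⇒≤ a<q)) (*-congˡ (trans (ι-cong (nCn≡1 a)) ι-1)))) ⟩
    0# - (- 1#) ^ a * 1#
      ≈⟨ solve 1 (λ x → con (ℤ.+ 0) :- x :* con (ℤ.+ 1) := (:- con (ℤ.+ 1) :* x) :* con (ℤ.+ 1)) refl _ ⟩
    (- 1#) ^ suc a * 1#
      ≈⟨ *-congˡ (trans (ι-cong (nCn≡1 (suc a))) ι-1) ⟨
    (- 1#) ^ suc a * ι (suc a C suc a) ∎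
  C-reflect (suc c) (suc a) c<q a<q = begin
    ι (m C suc a)
      ≈⟨ solve 2 (λ x y → y := (x :+ y) :- x) refl (ι (m C a)) _ ⟩
    (ι (m C a) + ι (m C suc a)) - ι (m C a)
      ≈⟨ +-cong (trans (sym (ι-+ (m C a) _)) (trans (ι-cong (≡.trans (nCk+nC[k+1]≡[n+1]C[k+1] m a) (≡.cong (_C suc a) (≡.sym (∸-suc c<q)))))
              (C-reflect c (suc a) (ℕₚ.<⇒≤ c<q) a<q)))
           (-‿cong (C-reflect (suc c) a c<q (ℕₚ.<⇒≤ a<q))) ⟩
    (- 1#) ^ suc a * ι ((c ℕ.+ suc a) C suc a) - (- 1#) ^ a * ι ((suc c ℕ.+ a) C a)
      ≈⟨ solve 3 (λ x y z → (:- con (ℤ.+ 1) :* x) :* y :- x :* z := (:- con (ℤ.+ 1) :* x) :* (z :+ y)) refl _ _ _ ⟩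
    (- 1#) ^ suc a * (ι ((suc c ℕ.+ a) C a) + ι ((c ℕ.+ suc a) C suc a))
      ≈⟨ *-congˡ (trans (+-congˡ (ι-cong (≡.cong (_C suc a) (ℕₚ.+-suc c a)))) (trans (sym (ι-+ ((suc c ℕ.+ a) C a) _))
           (ι-cong (≡.trans (nCk+nC[k+1]≡[n+1]C[k+1] (suc c ℕ.+ a) a) (≡.cong (_C suc a) (≡.sym (ℕₚ.+-suc (suc c) a))))))) ⟩
    (- 1#) ^ suc a * ι ((suc c ℕ.+ suc a) C suc a) ∎
    where m = q ℕ.∸ suc c

  inv-cancelˡ : ∀ j {x y} → j ℕ.< q → ι (suc j) * x ≈ ι (suc j) * y → x ≈ y
  inv-cancelˡ j j<q h = x≈y (ι-cancelˡ j j<q (trans (solve 3 (λ i x y → i :* (x :- y) := i :* x :- i :* y) refl _ _ _) (x-y≈0 h)))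

  ι*inv : ∀ j x → j ℕ.< q → ι (suc j) * (inv (suc j) * x) ≈ x
  ι*inv j x j<q = trans (sym (*-assoc _ _ _)) (trans (*-congʳ (trans (*-comm _ _) (inv-ι j j<q))) (*-identityˡ x))

  -- With p = i + a + c, a = d + 1: C(p-c, i)/(p-c) = C(p-c-1, a-1)/a = (-1)^(a-1) C(a+c-1, a-1)/a = (-1)^(a-1) C(a+c, a)/(a+c).
  inv-C-reflect : ∀ N d → N ℕ.< q → d ℕ.< N →
    inv (suc (q ℕ.∸ N ℕ.+ d)) * ι (suc (q ℕ.∸ N ℕ.+ d) C (q ℕ.∸ N)) ≈ inv (suc N) * ((- 1#) ^ d * ι (suc N C suc d))
  inv-C-reflect N d N<q d<N = inv-cancelˡ j j<q (inv-cancelˡ N N<q (inv-cancelˡ d d<q (begin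
    ι (suc d) * (ι (suc N) * (ι (suc j) * (inv (suc j) * ι (suc j C (q ℕ.∸ N)))))
      ≈⟨ *-congˡ (*-congˡ (ι*inv j _ j<q)) ⟩
    ι (suc d) * (ι (suc N) * ι (suc j C (q ℕ.∸ N)))
      ≈⟨ *-congˡ (*-congˡ (ι-cong sym-C)) ⟩
    ι (suc d) * (ι (suc N) * ι (suc j C suc d))
      ≈⟨ solve 3 (λ a b c → a :* (b :* c) := b :* (a :* c)) refl _ _ _ ⟩
    ι (suc N) * (ι (suc d) * ι (suc j C suc d))
      ≈⟨ *-congˡ (absorb j d) ⟩
    ι (suc N) * (ι (suc j) * ι (j C d))
      ≈⟨ *-congˡ (*-congˡ (trans (ι-cong (≡.cong (_C d) j≡)) (C-reflect (N ℕ.∸ d) d (ℕₚ.≤-trans (ℕₚ.m∸n≤m N d) (ℕₚ.<⇒≤ N<q)) (ℕₚ.<⇒≤ d<q)))) ⟩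
    ι (suc N) * (ι (suc j) * ((- 1#) ^ d * ι ((N ℕ.∸ d ℕ.+ d) C d)))
      ≈⟨ *-congˡ (*-congˡ (*-congˡ (ι-cong (≡.cong (_C d) (ℕₚ.m∸n+n≡m (ℕₚ.<⇒≤ d<N)))))) ⟩
    ι (suc N) * (ι (suc j) * ((- 1#) ^ d * ι (N C d)))
      ≈⟨ solve 4 (λ a b c x → a :* (b :* (c :* x)) := b :* (c :* (a :* x))) refl _ _ _ _ ⟩
    ι (suc j) * ((- 1#) ^ d * (ι (suc N) * ι (N C d)))
      ≈⟨ *-congˡ (*-congˡ (absorb N d)) ⟨
    ι (suc j) * ((- 1#) ^ d * (ι (suc d) * ι (suc N C suc d)))
      ≈⟨ solve 4 (λ b c a x → b :* (c :* (a :* x)) := a :* (b :* (c :* x))) refl _ _ _ _ ⟩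
    ι (suc d) * (ι (suc j) * ((- 1#) ^ d * ι (suc N C suc d)))
      ≈⟨ *-congˡ (trans (solve 3 (λ a b x → a :* (b :* x) := b :* (a :* x)) refl _ _ _) (*-congˡ (ι*inv N _ N<q))) ⟨
    ι (suc d) * (ι (suc N) * (ι (suc j) * (inv (suc N) * ((- 1#) ^ d * ι (suc N C suc d))))) ∎)))
    where
    j : ℕ
    j = q ℕ.∸ N ℕ.+ d
    d<q : d ℕ.< q
    d<q = ℕₚ.<-trans d<N N<q
    j<q : j ℕ.< q
    j<q = ℕₚ.≤-trans (ℕₚ.+-monoʳ-< (q ℕ.∸ N) d<N) (ℕₚ.≤-reflexive (ℕₚ.m∸n+n≡m (ℕₚ.<⇒≤ N<q)))
    j≡ : j ≡ q ℕ.∸ (N ℕ.∸ d)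
    j≡ = ℕₚ.+-cancelʳ-≡ (N ℕ.∸ d) j (q ℕ.∸ (N ℕ.∸ d)) (≡.trans (ℕₚ.+-assoc (q ℕ.∸ N) d (N ℕ.∸ d))
      (≡.trans (≡.cong (q ℕ.∸ N ℕ.+_) (ℕₚ.m+[n∸m]≡n (ℕₚ.<⇒≤ d<N)))
      (≡.trans (ℕₚ.m∸n+n≡m (ℕₚ.<⇒≤ N<q)) (≡.sym (ℕₚ.m∸n+n≡m (ℕₚ.≤-trans (ℕₚ.m∸n≤m N d) (ℕₚ.<⇒≤ N<q)))))))
    suc-j≡ : suc j ≡ q ℕ.∸ N ℕ.+ suc d
    suc-j≡ = ≡.sym (ℕₚ.+-suc (q ℕ.∸ N) d)
    sym-C : suc j C (q ℕ.∸ N) ≡ suc j C suc d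
    sym-C = ≡.trans (nCk≡nC[n∸k] {q ℕ.∸ N} {suc j} (ℕₚ.≤-trans (ℕₚ.m≤m+n (q ℕ.∸ N) (suc d)) (ℕₚ.≤-reflexive (≡.sym suc-j≡))))
      (≡.cong (suc j C_) (≡.trans (≡.cong (ℕ._∸ (q ℕ.∸ N)) suc-j≡) (ℕₚ.m+n∸m≡n (q ℕ.∸ N) (suc d))))
    absorb : ∀ n k → ι (suc k) * ι (suc n C suc k) ≈ ι (suc n) * ι (n C k)
    absorb n k = trans (sym (ι-* (suc k) (suc n C suc k))) (trans (ι-cong ([1+k]*[1+n]C[1+k] n k)) (ι-* (suc n) (n C k)))

module LogDerivative (Y : CommutativeRing 0ℓ 0ℓ) (q : ℕ) (char : Characteristic Y q) (bern : BernoulliNumbers Y q)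
  (w u : CommutativeRing.Carrier Y) (u-w : CommutativeRing._≈_ Y (CommutativeRing._-_ Y u w) (CommutativeRing.-_ Y (CommutativeRing.1# Y))) where
  private module Y = RingTools Y
  open Characteristic char using (inv)
  open BernoulliNumbers bern using (β)

  -- Series in t modulo t^(p-1), over the series in y. This truncation is the one at which B^(p-1) =
  -- (tu)^(p-1) becomes zero.
  open PowerSeries Y (ℕ._< q) (ℕₚ.<-trans (ℕₚ.n<1+n _)) public

  Λ : CommutativeRing 0ℓ 0ℓ
  Λ = series-commutativeRing

  open SeriesCharacteristic Y (ℕ._< q) (ℕₚ.<-trans (ℕₚ.n<1+n _)) public
  open ContiguousSequence Λ q (series-characteristic char) (series-bernoulli bern) public
    using (weightedPowerSums; powerSum; powerSum-explicit; contiguous-sum)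

  A B Φ : Series
  A = mono 1 w
  B = mono 1 u
  Φ = B *ˢ weightedPowerSums A B

  private
    module Λ = RingTools Λ

    coefficient : ℕ → ℕ → Y.Carrier
    coefficient j i = (inv (suc j) Y.* Y.ι (suc j C i) Y.* β i) Y.* (u Y.^ suc (q ℕ.∸ suc j) Y.* w Y.^ (suc j ℕ.∸ i))

    -- The factor B^(p-1-j) meets A^(j+1-i) β_i from the Faulhaber polynomial, and the total
    -- t-degree p - i does not depend on j. So β_i enters Φ in degree p - i only.
    Φ-monomials : Φ Λ.≈ Λ.Σ< q (λ j → Λ.Σ< (suc j) (λ i → mono (suc (q ℕ.∸ i)) (coefficient j i)))
    Φ-monomials = Λ.trans (Λ.Σ-*ˡ q B _) (Λ.Σ-cong q (λ j j<q → begin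
      B Λ.* (B Λ.^ (q ℕ.∸ suc j) Λ.* powerSum j A)
        ≈⟨ Λ.*-assoc B _ _ ⟨
      B Λ.^ suc (q ℕ.∸ suc j) Λ.* powerSum j A
        ≈⟨ Λ.*-congˡ {B Λ.^ suc (q ℕ.∸ suc j)} (powerSum-explicit j A) ⟩
      B Λ.^ suc (q ℕ.∸ suc j) Λ.* Λ.Σ< (suc j) (λ i → const (inv (suc j)) Λ.* (Λ.ι (suc j C i) Λ.* (A Λ.^ (suc j ℕ.∸ i) Λ.* const (β i))))
        ≈⟨ Λ.Σ-*ˡ (suc j) (B Λ.^ suc (q ℕ.∸ suc j)) _ ⟩
      Λ.Σ< (suc j) (λ i → B Λ.^ suc (q ℕ.∸ suc j) Λ.* (const (inv (suc j)) Λ.* (Λ.ι (suc j C i) Λ.* (A Λ.^ (suc j ℕ.∸ i) Λ.* const (β i)))))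
        ≈⟨ Λ.Σ-cong (suc j) (λ i i≤j → term j i j<q (ℕ.s≤s⁻¹ i≤j)) ⟩
      Λ.Σ< (suc j) (λ i → mono (suc (q ℕ.∸ i)) (coefficient j i)) ∎))
      where
      open Λ using (begin_; step-≈-⟩; step-≈-⟨; step-≡-⟩; _∎)
      exponent : ∀ j i → j ℕ.< q → i ℕ.≤ j → suc (q ℕ.∸ suc j) ℕ.+ (suc j ℕ.∸ i) ≡ suc (q ℕ.∸ i)
      exponent j i j<q i≤j = ≡.cong suc (≡.trans (≡.sym (ℕₚ.+-∸-assoc (q ℕ.∸ suc j) (ℕₚ.m≤n⇒m≤1+n i≤j)))
        (≡.cong (ℕ._∸ i) (ℕₚ.m∸n+n≡m j<q)))
      term : ∀ j i → j ℕ.< q → i ℕ.≤ j →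
        B Λ.^ suc (q ℕ.∸ suc j) Λ.* (const (inv (suc j)) Λ.* (Λ.ι (suc j C i) Λ.* (A Λ.^ (suc j ℕ.∸ i) Λ.* const (β i))))
          Λ.≈ mono (suc (q ℕ.∸ i)) (coefficient j i)
      term j i j<q i≤j = begin
        B Λ.^ b Λ.* (const (inv (suc j)) Λ.* (Λ.ι (suc j C i) Λ.* (A Λ.^ a Λ.* const (β i))))
          ≈⟨ Λ.solve 5 (λ x y z s t → x Λ.:* (y Λ.:* (z Λ.:* (s Λ.:* t))) Λ.:= (y Λ.:* z Λ.:* t) Λ.:* (x Λ.:* s)) Λ.refl
               (B Λ.^ b) (const (inv (suc j))) (Λ.ι (suc j C i)) (A Λ.^ a) (const (β i)) ⟩
        (const (inv (suc j)) Λ.* Λ.ι (suc j C i) Λ.* const (β i)) Λ.* (B Λ.^ b Λ.* A Λ.^ a)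
          ≈⟨ Λ.*-cong
               (Λ.trans (Λ.*-congʳ {const (β i)} (Λ.trans (Λ.*-congˡ {const (inv (suc j))} (Λ.sym (const-ι (suc j C i)))) (Λ.sym (const-* _ _)))) (Λ.sym (const-* _ _)))
               (Λ.trans (Λ.*-cong (mono-^ b u) (mono-^ a w)) (mono-* b a (u Y.^ b) (w Y.^ a))) ⟩
        const (inv (suc j) Y.* Y.ι (suc j C i) Y.* β i) Λ.* mono (b ℕ.+ a) (u Y.^ b Y.* w Y.^ a)
          ≈⟨ mono-* 0 (b ℕ.+ a) _ _ ⟩
        mono (b ℕ.+ a) (coefficient j i)
          ≡⟨ ≡.cong (λ k → mono k (coefficient j i)) (exponent j i j<q i≤j) ⟩
        mono (suc (q ℕ.∸ i)) (coefficient j i) ∎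
        where
        b a : ℕ
        b = suc (q ℕ.∸ suc j)
        a = suc j ℕ.∸ i

  open RingTools Y

  Φ-0 : Φ 0 ≈ 0#
  Φ-0 = zeroˡ _

  B^q≈0 : B Λ.^ q Λ.≈ Λ.0#
  B^q≈0 = Λ.trans (mono-^ q u) (≋-intro λ n n<q → mono-≢ q _ n (ℕₚ.<⇒≢ n<q))

  -- Put M = N + 1. Only i = p - M contributes, with j = i + d for 0 ≤ d < N. By `inv-C-reflect`,
  -- C(j+1,i)/(j+1) becomes (-1)^d C(M,d+1)/M, so the sum over d is, up to a factor, the binomial
  -- expansion of (u - w)^M without its first and last terms; and u - w = -1.
  Φ-suc : ∀ N → suc N ℕ.< q →
    Φ (suc N) ≈ - (inv (suc N) * β (q ℕ.∸ N) * ((- 1#) ^ suc N - u ^ suc N - (- w) ^ suc N))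
  Φ-suc N N+1<q = begin
    Φ (suc N)
      ≈⟨ at Φ-monomials (suc N) N+1<q ⟩
    Λ.Σ< q (λ j → Λ.Σ< (suc j) (λ i → mono (suc (q ℕ.∸ i)) (coefficient j i))) (suc N)
      ≈⟨ trans (Σ-at q _ (suc N)) (Σ-cong q (λ j _ → Σ-at (suc j) _ (suc N))) ⟩
    Σ< q inner
      ≡⟨ ≡.cong (λ k → Σ< k inner) (≡.sym (ℕₚ.m∸n+n≡m N≤q)) ⟩
    Σ< (q ℕ.∸ N ℕ.+ N) inner
      ≈⟨ Σ-split (q ℕ.∸ N) N inner ⟩
    Σ< (q ℕ.∸ N) inner + Σ< N (λ d → inner (q ℕ.∸ N ℕ.+ d))
      ≈⟨ +-cong (Σ-zero (q ℕ.∸ N) low) (Σ-cong N high) ⟩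
    0# + Σ< N (λ d → - (inv (suc N) * b) * t (suc d))
      ≈⟨ trans (+-identityˡ _) (sym (Σ-*ˡ N _ _)) ⟩
    - (inv (suc N) * b) * Σ< N (λ d → t (suc d))
      ≈⟨ *-congˡ (solve 3 (λ x y z → y := ((x :+ y) :+ z) :- x :- z) refl (t 0) _ (t (suc N))) ⟩
    - (inv (suc N) * b) * (((t 0 + Σ< N (λ d → t (suc d))) + t (suc N)) - t 0 - t (suc N))
      ≈⟨ *-congˡ (+-congʳ (+-congʳ (+-congʳ (sym (Σ-head N t))))) ⟩
    - (inv (suc N) * b) * (Σ< (suc (suc N)) t - t 0 - t (suc N))
      ≈⟨ *-congˡ (+-cong (+-cong binomial (-‿cong t-first)) (-‿cong t-last)) ⟩
    - (inv (suc N) * b) * ((- 1#) ^ suc N - u ^ suc N - (- w) ^ suc N)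
      ≈⟨ -‿distribˡ-* _ _ ⟨
    - (inv (suc N) * b * ((- 1#) ^ suc N - u ^ suc N - (- w) ^ suc N)) ∎
    where
    open BinomialTransform Y using (T-powers; T-explicit)
    open SignedBinomials Y q char using (inv-C-reflect)
    N<q : N ℕ.< q
    N<q = ℕₚ.<-trans (ℕₚ.n<1+n N) N+1<q
    N≤q : N ℕ.≤ q
    N≤q = ℕₚ.<⇒≤ N<q
    b : Carrier
    b = β (q ℕ.∸ N)
    t : ℕ → Carrier
    t i = ι (suc N C i) * (u ^ (suc N ℕ.∸ i) * (- w) ^ i)
    inner : ℕ → Carrier
    inner j = Σ< (suc j) (λ i → mono (suc (q ℕ.∸ i)) (coefficient j i) (suc N))

    index : ∀ i → i ℕ.≤ q → N ≡ q ℕ.∸ i → i ≡ q ℕ.∸ N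
    index i i≤q N≡ = ≡.sym (≡.trans (≡.cong (q ℕ.∸_) N≡) (ℕₚ.m∸[m∸n]≡n i≤q))

    low : ∀ j → j ℕ.< q ℕ.∸ N → inner j ≈ 0#
    low j j<i₀ = Σ-zero (suc j) (λ i i≤j → mono-≢ (suc (q ℕ.∸ i)) _ (suc N) λ N≡ →
      ℕₚ.<⇒≢ (ℕₚ.≤-<-trans (ℕ.s≤s⁻¹ i≤j) j<i₀)
        (index i (ℕₚ.≤-trans (ℕ.s≤s⁻¹ i≤j) (ℕₚ.≤-trans (ℕₚ.<⇒≤ j<i₀) (ℕₚ.m∸n≤m q N))) (ℕₚ.suc-injective N≡)))

    high : ∀ d → d ℕ.< N → inner (q ℕ.∸ N ℕ.+ d) ≈ - (inv (suc N) * b) * t (suc d)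
    high d d<N = begin
      inner j
        ≈⟨ Σ-single (suc j) (q ℕ.∸ N) (ℕ.s≤s (ℕₚ.m≤m+n (q ℕ.∸ N) d)) elsewhere ⟩
      mono (suc (q ℕ.∸ (q ℕ.∸ N))) (coefficient j (q ℕ.∸ N)) (suc N)
        ≡⟨ ≡.cong (λ k → mono (suc k) (coefficient j (q ℕ.∸ N)) (suc N)) (ℕₚ.m∸[m∸n]≡n N≤q) ⟩
      mono (suc N) (coefficient j (q ℕ.∸ N)) (suc N)
        ≈⟨ mono-at (suc N) _ ⟩
      (inv (suc j) * ι (suc j C (q ℕ.∸ N)) * b) * (u ^ suc (q ℕ.∸ suc j) * w ^ (suc j ℕ.∸ (q ℕ.∸ N)))
        ≈⟨ *-cong (*-congʳ (inv-C-reflect N d N<q d<N)) (*-cong (reflexive (≡.cong (u ^_) u-exponent)) (reflexive (≡.cong (w ^_) w-exponent))) ⟩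
      (inv (suc N) * ((- 1#) ^ d * ι (suc N C suc d)) * b) * (u ^ (N ℕ.∸ d) * w ^ suc d)
        ≈⟨ solve 6 (λ i s c b x y → (i :* (s :* c) :* b) :* (x :* y) := :- (i :* b) :* (c :* (x :* ((:- con (ℤ.+ 1) :* s) :* y)))) refl _ _ _ _ _ _ ⟩
      - (inv (suc N) * b) * (ι (suc N C suc d) * (u ^ (N ℕ.∸ d) * ((- 1#) ^ suc d * w ^ suc d)))
        ≈⟨ *-congˡ (*-congˡ (*-congˡ (neg-^ w (suc d)))) ⟨
      - (inv (suc N) * b) * t (suc d) ∎
      where
      j : ℕ
      j = q ℕ.∸ N ℕ.+ d
      j<q : j ℕ.< q
      j<q = ℕₚ.≤-trans (ℕₚ.+-monoʳ-< (q ℕ.∸ N) d<N) (ℕₚ.≤-reflexive (ℕₚ.m∸n+n≡m N≤q))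
      elsewhere : ∀ i → i ≢ q ℕ.∸ N → mono (suc (q ℕ.∸ i)) (coefficient j i) (suc N) ≈ 0#
      elsewhere i i≢ with i ℕ.≤? q
      ... | yes i≤q = mono-≢ (suc (q ℕ.∸ i)) _ (suc N) (λ N≡ → i≢ (index i i≤q (ℕₚ.suc-injective N≡)))
      -- For i > q the truncated `q ∸ i` is 0, so the exponent is 1; equality with N + 1 would force
      -- N = 0, against d < N.
      ... | no  i≰q = mono-≢ (suc (q ℕ.∸ i)) _ (suc N) (λ N≡ → ℕₚ.<⇒≢ (ℕₚ.≤-<-trans ℕ.z≤n d<N)
        (≡.sym (≡.trans (ℕₚ.suc-injective N≡) (ℕₚ.m≤n⇒m∸n≡0 (ℕₚ.≰⇒≥ i≰q)))))
      u-exponent : suc (q ℕ.∸ suc j) ≡ N ℕ.∸ d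
      u-exponent = ≡.trans (≡.sym (∸-suc j<q)) (≡.trans (≡.sym (ℕₚ.∸-+-assoc q (q ℕ.∸ N) d)) (≡.cong (ℕ._∸ d) (ℕₚ.m∸[m∸n]≡n N≤q)))
      w-exponent : suc j ℕ.∸ (q ℕ.∸ N) ≡ suc d
      w-exponent = ≡.trans (≡.cong (ℕ._∸ (q ℕ.∸ N)) (≡.sym (ℕₚ.+-suc (q ℕ.∸ N) d))) (ℕₚ.m+n∸m≡n (q ℕ.∸ N) (suc d))

    binomial : Σ< (suc (suc N)) t ≈ (- 1#) ^ suc N
    binomial = trans (sym (T-explicit (suc N) u ((- w) ^_))) (trans (T-powers (suc N) u (- w)) (^-congˡ (suc N) u-w))
    t-first : t 0 ≈ u ^ suc N
    t-first = trans (*-cong (trans (ι-cong (nC0≡1 (suc N))) ι-1) (*-identityʳ _)) (*-identityˡ _)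
    t-last : t (suc N) ≈ (- w) ^ suc N
    t-last = trans (*-cong (trans (ι-cong (nCn≡1 (suc N))) ι-1) (trans (*-congʳ (reflexive (≡.cong (u ^_) (ℕₚ.n∸n≡0 N)))) (*-identityˡ _))) (*-identityˡ _)

module SignPowers (R : CommutativeRing 0ℓ 0ℓ) where
  open RingTools R

  sign-even : ∀ a → a % 2 ≡ 0 → (- 1#) ^ a ≈ 1#
  sign-even zero          _ = refl
  sign-even (suc (suc a)) h = trans
    (solve 1 (λ x → (:- con (ℤ.+ 1)) :* ((:- con (ℤ.+ 1)) :* x) := x) refl _) (sign-even a h)

  sign-odd : ∀ a → a % 2 ≢ 0 → (- 1#) ^ a ≈ - 1#
  sign-odd zero          h = contradiction ≡.refl h
  sign-odd (suc zero)    h = *-identityʳ (- 1#)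
  sign-odd (suc (suc a)) h = trans
    (solve 1 (λ x → (:- con (ℤ.+ 1)) :* ((:- con (ℤ.+ 1)) :* x) := x) refl _) (sign-odd a h)

  sign-summand : ∀ i j {s} → (- 1#) ^ (i ℕ.+ j) ≈ s → (- 1#) ^ j ≈ 1# → (- 1#) ^ i ≈ s
  sign-summand i j h even = trans (sym (*-identityʳ _)) (trans (*-congˡ (sym even)) (trans (sym (^-homo-* (- 1#) i j)) h))

-- The exponential exp(tL), sliced by residues modulo p

-- L = Σ l⁻¹ x^l over the l prime to p
record Logarithm (K : CommutativeRing 0ℓ 0ℓ) (q : ℕ) (char : Characteristic K q) : Set where
  open RingTools K
  open Characteristic char
  field
    L          : ℕ → Carrier
    L-0        : L 0 ≈ 0#
    L-inv      : ∀ v → v ℕ.< q → L (suc v) ≈ inv (suc v)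
    L-periodic : ∀ n → L (suc q ℕ.+ n) ≈ L n

module Slices (K : CommutativeRing 0ℓ 0ℓ) (q : ℕ) (char : Characteristic K q) (bern : BernoulliNumbers K q)
  (log : Logarithm K q char) where
  open RingTools K
  open Characteristic char
  open CharacteristicP K q char using (ι-cancelˡ; x≈y)
  open Logarithm log
  open BernoulliNumbers bern using (β)
  module S = PowerSeries K (λ _ → ⊤) (λ _ → tt)
  open S using (conv; Series; conv-cong; conv-cong-≤; conv-assoc; conv-comm; conv-leibniz; conv-scaleˡ; conv-zeroˡ; conv-distribʳ; euler)

  p : ℕ
  p = suc q

  -- The series L^n/n!, that is, the coefficient of t^n in exp(tL), for n < p, where the inverses
  -- are genuine.
  r : ℕ → Series
  r zero    = S.1ˢ
  r (suc n) N = inv (suc n) * conv L (r n) N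

  -- χ = x L′ is the indicator of the exponents prime to p, and π that of the multiples of p; the
  -- latter is 1/(1-y) with y = x^p.
  χ π : Series
  χ = euler L
  π l = 1# - χ l

  conv-scaleʳ : ∀ n c f g → conv f (λ i → c * g i) n ≈ c * conv f g n
  conv-scaleʳ n c f g = trans (conv-comm n f _) (trans (conv-scaleˡ n c g f) (*-congˡ (conv-comm n g f)))

  ι-r : ∀ n N → n ℕ.< q → ι (suc n) * r (suc n) N ≈ conv L (r n) N
  ι-r n N n<q = trans (sym (*-assoc _ _ _)) (trans (*-congʳ (trans (*-comm _ _) (inv-ι n n<q))) (*-identityˡ _))

  -- Mutual induction for θ(L^(n+1)/(n+1)!) = θL ⋅ L^n/n! with θ = x d/dx. Leibniz gives θL ⋅ L^n/n!
  -- + L ⋅ θ(L^n/n!), the second summand is n times the first by the previous degree, and the total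
  -- factor n + 1 cancels the new denominator.
  conv-L-euler-r : ∀ n N → n ℕ.< q → conv L (euler (r n)) N ≈ ι n * conv χ (r n) N
  euler-r : ∀ n N → n ℕ.< q → ι N * r (suc n) N ≈ conv χ (r n) N

  conv-L-euler-r zero    N _     = trans (trans (conv-cong N (λ _ → refl) euler-1) (trans (conv-comm N L _) (conv-zeroˡ N L))) (sym (zeroˡ _))
    where
    euler-1 : ∀ i → ι i * S.1ˢ i ≈ 0#
    euler-1 zero    = zeroˡ _
    euler-1 (suc i) = zeroʳ _
  conv-L-euler-r (suc n) N n+1<q = begin
    conv L (euler (r (suc n))) N       ≈⟨ conv-cong N (λ _ → refl) (λ i → euler-r n i n<q) ⟩
    conv L (conv χ (r n)) N            ≈⟨ conv-assoc N L χ (r n) ⟨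
    conv (conv L χ) (r n) N            ≈⟨ conv-cong N (λ i → conv-comm i L χ) (λ _ → refl) ⟩
    conv (conv χ L) (r n) N            ≈⟨ conv-assoc N χ L (r n) ⟩
    conv χ (conv L (r n)) N            ≈⟨ conv-cong N (λ _ → refl) (λ i → ι-r n i n<q) ⟨
    conv χ (λ i → ι (suc n) * r (suc n) i) N  ≈⟨ conv-scaleʳ N (ι (suc n)) χ (r (suc n)) ⟩
    ι (suc n) * conv χ (r (suc n)) N ∎
    where
    n<q = ℕₚ.<-trans (ℕₚ.n<1+n n) n+1<q

  euler-r n N n<q = begin
    ι N * (inv (suc n) * conv L (r n) N)                       ≈⟨ solve 3 (λ a b c → a :* (b :* c) := b :* (a :* c)) refl _ _ _ ⟩
    inv (suc n) * (ι N * conv L (r n) N)                       ≈⟨ *-congˡ (trans (conv-leibniz N L (r n)) (+-congˡ (conv-L-euler-r n N n<q))) ⟩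
    inv (suc n) * (conv χ (r n) N + ι n * conv χ (r n) N)      ≈⟨ solve 3 (λ i n c → i :* (c :+ n :* c) := (i :* (con (ℤ.+ 1) :+ n)) :* c) refl _ _ _ ⟩
    (inv (suc n) * ι (suc n)) * conv χ (r n) N                 ≈⟨ trans (*-congʳ (inv-ι n n<q)) (*-identityˡ _) ⟩
    conv χ (r n) N ∎

  -- For i < p this is the part of g in x^i, as a series in y = x^p: entry k is the coefficient of
  -- x^i y^k.
  slice : ℕ → Series → Series
  slice i g k = g (i ℕ.+ k ℕ.* p)

  private
    slice-suc : ∀ i k → i ℕ.+ suc k ℕ.* p ≡ p ℕ.+ (i ℕ.+ k ℕ.* p)
    slice-suc i k = ≡.trans (≡.sym (ℕₚ.+-assoc i p (k ℕ.* p)))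
      (≡.trans (≡.cong (ℕ._+ k ℕ.* p) (ℕₚ.+-comm i p)) (ℕₚ.+-assoc p i (k ℕ.* p)))

  ι-slice : ∀ i k → ι (i ℕ.+ k ℕ.* p) ≈ ι i
  ι-slice i k = trans (ι-+ i (k ℕ.* p)) (trans (+-congˡ (trans (ι-* k p) (trans (*-congˡ ι-p) (zeroʳ _)))) (+-identityʳ _))

  conv-block : ∀ m n f g →
    conv f g (m ℕ.+ n) ≈ Σ< m (λ v → f v * g (m ℕ.∸ v ℕ.+ n)) + conv (λ l → f (m ℕ.+ l)) g n
  conv-block zero    n f g = sym (+-identityˡ _)
  conv-block (suc m) n f g = begin
    f 0 * g (suc m ℕ.+ n) + conv (f ∘ suc) g (m ℕ.+ n)
      ≈⟨ +-congˡ (conv-block m n (f ∘ suc) g) ⟩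
    f 0 * g (suc m ℕ.+ n) + (Σ< m (λ v → f (suc v) * g (m ℕ.∸ v ℕ.+ n)) + conv (λ l → f (suc m ℕ.+ l)) g n)
      ≈⟨ trans (sym (+-assoc _ _ _)) (+-congʳ (sym (Σ-head m _))) ⟩
    Σ< (suc m) (λ v → f v * g (suc m ℕ.∸ v ℕ.+ n)) + conv (λ l → f (suc m ℕ.+ l)) g n ∎

  conv-block-periodic : ∀ n f g → (∀ l → f (p ℕ.+ l) ≈ f l) →
    conv f g (p ℕ.+ n) ≈ (f 0 * g (p ℕ.+ n) + Σ< q (λ v → f (suc v) * g (q ℕ.∸ v ℕ.+ n))) + conv f g n
  conv-block-periodic n f g per = trans (conv-block p n f g) (+-cong (Σ-head q _) (conv-cong n per (λ _ → refl)))

  χ-0 : χ 0 ≈ 0#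
  χ-0 = zeroˡ _

  χ-suc : ∀ v → v ℕ.< q → χ (suc v) ≈ 1#
  χ-suc v v<q = trans (*-congˡ (L-inv v v<q)) (trans (*-comm _ _) (inv-ι v v<q))

  χ-periodic : ∀ n → χ (p ℕ.+ n) ≈ χ n
  χ-periodic n = *-cong (trans (ι-+ p n) (trans (+-congʳ ι-p) (+-identityˡ _))) (L-periodic n)

  π-0 : π 0 ≈ 1#
  π-0 = trans (+-congˡ (trans (-‿cong χ-0) -0#≈0#)) (+-identityʳ 1#)

  π-suc : ∀ v → v ℕ.< q → π (suc v) ≈ 0#
  π-suc v v<q = trans (+-congˡ (-‿cong (χ-suc v v<q))) (-‿inverseʳ 1#)

  -- The series 1/(1-y) and y/(1-y)
  w u : Series
  w _ = 1#
  u zero    = 0#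
  u (suc _) = 1#

  u-w : u S.+ˢ (S.-ˢ w) S.≋ S.-ˢ S.1ˢ
  u-w = S.≋-intro λ { zero _ → +-identityˡ _ ; (suc _) _ → trans (-‿inverseʳ 1#) (sym -0#≈0#) }

  conv-π-low : ∀ i g → i ℕ.< p → conv π g i ≈ g i
  conv-π-low zero    g _   = trans (*-congʳ π-0) (*-identityˡ _)
  conv-π-low (suc i) g i<q = trans (+-cong (trans (*-congʳ π-0) (*-identityˡ _))
    (trans (conv-cong-≤ i {g = g} {f′ = λ _ → 0#} (λ j j≤i → π-suc j (ℕₚ.≤-<-trans j≤i (ℕ.s≤s⁻¹ i<q))) (λ _ _ → refl)) (conv-zeroˡ i g)))
    (+-identityʳ _)

  -- Supported on the multiples of p, π does not mix residues; each further block of p exponents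
  -- adds one term, so on a slice it acts as 1/(1-y).
  conv-π : ∀ i k g → i ℕ.< p → conv π g (i ℕ.+ k ℕ.* p) ≈ conv w (slice i g) k
  conv-π i zero    g i<p = trans (reflexive (≡.cong (conv π g) (ℕₚ.+-identityʳ i)))
    (trans (conv-π-low i g i<p) (trans (reflexive (≡.cong g (≡.sym (ℕₚ.+-identityʳ i)))) (sym (*-identityˡ _))))
  conv-π i (suc k) g i<p = begin
    conv π g (i ℕ.+ suc k ℕ.* p)            ≡⟨ ≡.cong (conv π g) (slice-suc i k) ⟩
    conv π g (p ℕ.+ n)                      ≈⟨ conv-block-periodic n π g (λ l → +-congˡ (-‿cong (χ-periodic l))) ⟩
    (π 0 * g (p ℕ.+ n) + Σ< q (λ v → π (suc v) * g (q ℕ.∸ v ℕ.+ n))) + conv π g n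
      ≈⟨ +-cong (trans (+-cong (*-congʳ π-0) (Σ-zero q (λ v v<q → trans (*-congʳ (π-suc v v<q)) (zeroˡ _)))) (+-identityʳ _)) (conv-π i k g i<p) ⟩
    1# * g (p ℕ.+ n) + conv w (slice i g) k ≡⟨ ≡.cong (λ j → 1# * g j + conv w (slice i g) k) (≡.sym (slice-suc i k)) ⟩
    conv w (slice i g) (suc k) ∎
    where n = i ℕ.+ k ℕ.* p

  conv-χ-w : ∀ n g → conv χ g n + conv π g n ≈ conv w g n
  conv-χ-w n g = trans (sym (conv-distribʳ n χ π g))
    (conv-cong n (λ i → solve 1 (λ x → x :+ (con (ℤ.+ 1) :- x) := con (ℤ.+ 1)) refl _) (λ _ → refl))

  -- χ + π is 1/(1-x), and multiplication by it forms partial sums. Neighbouring coefficients thus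
  -- differ by one coefficient of g, which reduces the infinite sum from x/(1-x) to a relation
  -- between two neighbouring slices.
  conv-χ-suc : ∀ n g → conv χ g (suc n) + conv π g (suc n) ≈ g (suc n) + (conv χ g n + conv π g n)
  conv-χ-suc n g = trans (conv-χ-w (suc n) g) (+-cong (*-identityˡ _) (sym (conv-χ-w n g)))

  conv-u : ∀ k g → conv u g k + g k ≈ conv w g k
  conv-u zero    g = trans (+-cong (zeroˡ _) (sym (*-identityˡ _))) (+-identityˡ _)
  conv-u (suc k) g = trans (+-congʳ (trans (+-congʳ (zeroˡ _)) (+-identityˡ _)))
    (trans (+-comm _ _) (+-congʳ (sym (*-identityˡ _))))

  open LogDerivative S.series-commutativeRing q
    (SeriesCharacteristic.series-characteristic K (λ _ → ⊤) (λ _ → tt) char)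
    (SeriesCharacteristic.series-bernoulli K (λ _ → ⊤) (λ _ → tt) bern) w u u-w public
    hiding (conv; Series; euler; conv-cong; conv-cong-≤; conv-assoc; conv-comm; conv-leibniz; conv-scaleˡ; conv-zeroˡ; conv-distribʳ)
  module P = PowerSeries S.series-commutativeRing (ℕ._< q) (ℕₚ.<-trans (ℕₚ.n<1+n _))
  module Y = RingTools S.series-commutativeRing
  private
    module Λ = RingTools Λ
    module ±Y = SignPowers S.series-commutativeRing

  -- e i n k is the coefficient of t^n x^(i + k p) in exp(tL).
  e : ℕ → P.Series
  e i n = slice i (r n)

  private
    ι-times : ∀ j f n k → P.conv (Λ.ι j) f n k ≈ ι j * f n k
    ι-times j f n k = trans (S.at (P.conv-cong n (ι-const j) (λ _ → Y.refl)) k tt)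
      (trans (S.at (P.conv-const n (Y.ι j) f) k tt) (trans (S.at (Y.*-congʳ (Y.sym (S.const-ι j))) k tt) (S.conv-const k (ι j) (f n))))
      where
      ι-const : ∀ j m → Λ.ι j m S.≋ P.const (Y.ι j) m
      ι-const zero    zero    = Y.refl
      ι-const zero    (suc m) = Y.refl
      ι-const (suc j) zero    = Y.+-congˡ (ι-const j zero)
      ι-const (suc j) (suc m) = Y.trans (Y.+-congˡ (ι-const j (suc m))) (Y.+-identityʳ _)

    mono-times : ∀ c f n → P.conv (P.mono 1 c) f (suc n) S.≋ S.conv c (f n)
    mono-times c f n = Y.trans (Y.+-cong (Y.zeroˡ (f (suc n))) (P.conv-const n c f)) (Y.+-identityˡ _)

  module _ (i : ℕ) (i<q : i ℕ.< q) where
    private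
      step : ∀ n k → suc n ℕ.< q →
        ι (suc i) * r (suc n) (suc i ℕ.+ k ℕ.* p) + conv u (slice (suc i) (r n)) k ≈
        ι i * r (suc n) (i ℕ.+ k ℕ.* p) + conv w (slice i (r n)) k
      -- Adding `g (suc N)` turns u = w - 1 into w on the left. Then both sides are coefficients of
      -- (χ + π) g, at N + 1 and at N, and `conv-χ-suc` relates them.
      step n k n+1<q = +-cancelʳ′ (g (suc N)) (begin
        (ι (suc i) * r (suc n) (suc N) + conv u (slice (suc i) g) k) + g (suc N)
          ≈⟨ trans (+-assoc _ _ _) (+-cong (trans (*-congʳ (sym (ι-slice (suc i) k))) (euler-r n (suc N) n<q)) (conv-u k (slice (suc i) g))) ⟩
        conv χ g (suc N) + conv w (slice (suc i) g) k
          ≈⟨ +-congˡ (conv-π (suc i) k g (ℕ.s≤s i<q)) ⟨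
        conv χ g (suc N) + conv π g (suc N)
          ≈⟨ conv-χ-suc N g ⟩
        g (suc N) + (conv χ g N + conv π g N)
          ≈⟨ +-comm _ _ ⟩
        (conv χ g N + conv π g N) + g (suc N)
          ≈⟨ +-congʳ (+-cong (trans (sym (euler-r n N n<q)) (*-congʳ (ι-slice i k))) (conv-π i k g (ℕₚ.m<n⇒m<1+n i<q))) ⟩
        (ι i * r (suc n) N + conv w (slice i g) k) + g (suc N) ∎)
        where
        g = r n
        N = i ℕ.+ k ℕ.* p
        n<q = ℕₚ.<-trans (ℕₚ.n<1+n n) n+1<q

      ι-1ˢ : ∀ i k → ι i * S.1ˢ (i ℕ.+ k) ≈ 0#
      ι-1ˢ zero    k = zeroˡ _
      ι-1ˢ (suc i) k = zeroʳ _

    e-rec : (Λ.ι (suc i) Λ.+ B) Λ.* e (suc i) Λ.≈ (Λ.ι i Λ.+ A) Λ.* e i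
    e-rec = P.≋-intro λ
      { zero _ → Y.trans (P.conv-distribʳ 0 (Λ.ι (suc i)) B (e (suc i))) (Y.trans (S.≋-intro λ k _ →
          trans (+-cong (trans (ι-times (suc i) (e (suc i)) 0 k) (ι-1ˢ (suc i) (k ℕ.* p))) (S.at (Y.zeroˡ (e (suc i) 0)) k tt))
            (sym (+-cong (trans (ι-times i (e i) 0 k) (ι-1ˢ i (k ℕ.* p))) (S.at (Y.zeroˡ (e i 0)) k tt)))) (Y.sym (P.conv-distribʳ 0 (Λ.ι i) A (e i))))
      ; (suc n) n+1<q → Y.trans (P.conv-distribʳ (suc n) (Λ.ι (suc i)) B (e (suc i))) (Y.trans (S.≋-intro λ k _ →
          trans (+-cong (ι-times (suc i) (e (suc i)) (suc n) k) (S.at (mono-times u (e (suc i)) n) k tt))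
            (trans (step n k n+1<q) (sym (+-cong (ι-times i (e i) (suc n) k) (S.at (mono-times w (e i) n) k tt)))))
          (Y.sym (P.conv-distribʳ (suc n) (Λ.ι i) A (e i)))) }

  -- The numbers `q ∸ i` and `suc i` add up to p, so they are opposite modulo p, and so are their
  -- inverses.
  inv-neg : ∀ i → i ℕ.< q → inv (q ℕ.∸ i) ≈ - inv (suc i)
  inv-neg i i<q = begin
    inv (q ℕ.∸ i)                                                    ≡⟨ ≡.cong inv (∸-suc i<q) ⟩
    a                                                                ≈⟨ solve 3 (λ a b x → a := a :* (con (ℤ.+ 1) :- b :* x) :+ (b :* x) :* a) refl a b x ⟩
    a * (1# - b * x) + (b * x) * a                                   ≈⟨ +-cong (trans (*-congˡ (x-y≈0 (sym (inv-ι i i<q)))) (zeroʳ a)) refl ⟩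
    0# + (b * x) * a                                                 ≈⟨ solve 4 (λ a b x y → con (ℤ.+ 0) :+ (b :* x) :* a := (b :* ((x :+ y) :* a)) :- b :* (a :* y)) refl a b x y ⟩
    b * ((x + y) * a) - b * (a * y)                                  ≈⟨ +-cong (*-congˡ (*-congʳ x+y)) (-‿cong (*-congˡ (inv-ι (q ℕ.∸ suc i) (ℕₚ.∸-monoʳ-< (ℕ.s≤s ℕ.z≤n) i<q)))) ⟩
    b * (0# * a) - b * 1#                                            ≈⟨ solve 2 (λ a b → b :* (con (ℤ.+ 0) :* a) :- b :* con (ℤ.+ 1) := :- b) refl a b ⟩
    - b ∎
    where
    open CharacteristicP K q char using (x-y≈0)
    a b x y : Carrier
    a = inv (suc (q ℕ.∸ suc i))
    b = inv (suc i)
    x = ι (suc i)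
    y = ι (suc (q ℕ.∸ suc i))
    x+y : x + y ≈ 0#
    x+y = trans (sym (ι-+ (suc i) (suc (q ℕ.∸ suc i)))) (trans (ι-cong (≡.cong suc (≡.trans (ℕₚ.+-suc i _) (ℕₚ.m+[n∸m]≡n i<q)))) ι-p)

  V : P.Series
  V = Λ.Σ< q (λ i → P.const (S.const (inv (suc i))) Λ.* e (suc i))

  private
    V-at : ∀ n k → V n k ≈ Σ< q (λ i → inv (suc i) * slice (suc i) (r n) k)
    V-at n k = trans (S.at (P.Σ-at q _ n) k tt) (trans (S.Σ-at q _ k) (Σ-cong q (λ i _ →
      trans (S.at (P.conv-const n _ (e (suc i))) k tt) (S.conv-const k _ (e (suc i) n)))))

  -- An exponent divisible by p arises from l prime to p in L and a complementary residue in the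
  -- other factor, and completing the residue costs one y. Periodicity of L repeats this over all
  -- blocks, in total y/(1-y) = u, and 1/(p-i) = -1/i gives the sign.
  conv-L-slice : ∀ n k → conv L (r n) (k ℕ.* p) ≈ conv u (λ j → - V n j) k
  conv-L-slice n zero    = trans (trans (*-congʳ L-0) (zeroˡ _)) (sym (zeroˡ _))
  conv-L-slice n (suc k) = begin
    conv L g (p ℕ.+ k ℕ.* p)
      ≈⟨ conv-block-periodic (k ℕ.* p) L g L-periodic ⟩
    (L 0 * g (p ℕ.+ k ℕ.* p) + Σ< q (λ v → L (suc v) * slice (q ℕ.∸ v) g k)) + conv L g (k ℕ.* p)
      ≈⟨ +-cong (trans (+-congʳ (trans (*-congʳ L-0) (zeroˡ _))) (trans (+-identityˡ _) (trans (Σ-reverse q _) residues))) (conv-L-slice n k) ⟩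
    - V n k + conv u (λ j → - V n j) k
      ≈⟨ +-comm _ _ ⟩
    conv u (λ j → - V n j) k + - V n k
      ≈⟨ conv-u k (λ j → - V n j) ⟩
    conv w (λ j → - V n j) k
      ≈⟨ trans (+-congʳ (zeroˡ _)) (+-identityˡ _) ⟨
    conv u (λ j → - V n j) (suc k) ∎
    where
    g = r n
    Σ-neg : ∀ m f → Σ< m (λ i → - f i) ≈ - Σ< m f
    Σ-neg zero    f = sym -0#≈0#
    Σ-neg (suc m) f = trans (+-congʳ (Σ-neg m f)) (-‿+-comm _ _)
    residues : Σ< q (λ i → L (suc (q ℕ.∸ suc i)) * slice (q ℕ.∸ (q ℕ.∸ suc i)) g k) ≈ - V n k
    residues = trans (Σ-cong q (λ i i<q → trans
        (*-cong (trans (L-inv (q ℕ.∸ suc i) (ℕₚ.∸-monoʳ-< (ℕ.s≤s ℕ.z≤n) i<q)) (trans (reflexive (≡.cong inv (≡.sym (∸-suc i<q)))) (inv-neg i i<q)))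
                (reflexive (≡.cong (λ j → slice j g k) (ℕₚ.m∸[m∸n]≡n i<q))))
        (sym (-‿distribˡ-* _ _))))
      (trans (Σ-neg q _) (-‿cong (sym (V-at n k))))

  euler-e₀ : P.euler (e 0) Λ.≈ e 0 Λ.* Φ
  euler-e₀ = Λ.trans euler-V (Λ.trans (Λ.-‿cong (Λ.*-congˡ {B} (contiguous-sum A B e B^q≈0 e-rec)))
    (Λ.solve 3 (λ b e s → Λ.:- (b Λ.:* (Λ.:- (e Λ.:* s))) Λ.:= e Λ.:* (b Λ.:* s)) Λ.refl B (e 0) (weightedPowerSums A B)))
    where
    euler-V : P.euler (e 0) Λ.≈ Λ.- (B Λ.* V)
    euler-V = P.≋-intro λ
      { zero _ → S.≋-intro λ k _ → trans (S.at (Y.zeroˡ (e 0 0)) k tt)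
          (sym (trans (-‿cong (S.at (Y.zeroˡ (V 0)) k tt)) -0#≈0#))
      ; (suc n) n+1<q → S.≋-intro λ k _ → begin
          conv (Y.ι (suc n)) (e 0 (suc n)) k       ≈⟨ trans (S.at (Y.*-congʳ (Y.sym (S.const-ι (suc n)))) k tt) (S.conv-const k (ι (suc n)) (e 0 (suc n))) ⟩
          ι (suc n) * r (suc n) (k ℕ.* p)          ≈⟨ ι-r n (k ℕ.* p) (ℕₚ.<-trans (ℕₚ.n<1+n n) n+1<q) ⟩
          conv L (r n) (k ℕ.* p)                   ≈⟨ conv-L-slice n k ⟩
          conv u (λ j → - V n j) k                 ≈⟨ conv-cong k (λ _ → refl) (λ j → solve 1 (λ x → :- x := (:- con (ℤ.+ 1)) :* x) refl _) ⟩
          conv u (λ j → - 1# * V n j) k            ≈⟨ conv-scaleʳ k (- 1#) u (V n) ⟩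
          - 1# * conv u (V n) k                    ≈⟨ solve 1 (λ x → (:- con (ℤ.+ 1)) :* x := :- x) refl _ ⟩
          - conv u (V n) k                         ≈⟨ -‿cong (S.at (mono-times u V n) k tt) ⟨
          - P.conv B V (suc n) k ∎ }

  w-power : ∀ N k → (w Y.^ suc N) k ≈ ι ((k ℕ.+ N) C k)
  w-power zero    k = trans (trans (S.conv-comm k w S.1ˢ) (trans (S.conv-const k 1# w) (*-identityˡ 1#)))
    (sym (trans (ι-cong (≡.trans (≡.cong (_C k) (ℕₚ.+-identityʳ k)) (nCn≡1 k))) ι-1))
  w-power (suc N) zero    = trans (*-identityˡ ((w Y.^ suc N) 0)) (trans (w-power N 0) (ι-cong (≡.trans (nC0≡1 N) (≡.sym (nC0≡1 (suc N))))))
  w-power (suc N) (suc k) = begin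
    1# * (w Y.^ suc N) (suc k) + (w Y.^ suc (suc N)) k
      ≈⟨ +-cong (trans (*-identityˡ ((w Y.^ suc N) (suc k))) (w-power N (suc k))) (w-power (suc N) k) ⟩
    ι ((suc k ℕ.+ N) C suc k) + ι ((k ℕ.+ suc N) C k)
      ≈⟨ +-comm (ι ((suc k ℕ.+ N) C suc k)) (ι ((k ℕ.+ suc N) C k)) ⟩
    ι ((k ℕ.+ suc N) C k) + ι ((suc k ℕ.+ N) C suc k)
      ≈⟨ trans (+-congˡ (ι-cong (≡.cong (_C suc k) (≡.sym (ℕₚ.+-suc k N))))) (sym (ι-+ ((k ℕ.+ suc N) C k) ((k ℕ.+ suc N) C suc k))) ⟩
    ι ((k ℕ.+ suc N) C k ℕ.+ (k ℕ.+ suc N) C suc k)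
      ≈⟨ ι-cong (nCk+nC[k+1]≡[n+1]C[k+1] (k ℕ.+ suc N) k) ⟩
    ι ((suc k ℕ.+ suc N) C suc k) ∎

  u-power-0 : ∀ N → (u Y.^ suc N) 0 ≈ 0#
  u-power-0 N = zeroˡ ((u Y.^ N) 0)

  u-power : ∀ N k → (u Y.^ suc N) (suc k) ≈ ι (k C N)
  u-power zero    k = trans (trans (S.conv-comm (suc k) u S.1ˢ) (trans (S.conv-const (suc k) 1# u) (*-identityˡ 1#)))
    (sym (trans (ι-cong (nC0≡1 k)) ι-1))
  u-power (suc N) k = trans (trans (+-congʳ (zeroˡ ((u Y.^ suc N) (suc k)))) (+-identityˡ (S.conv w (u Y.^ suc N) k))) (partial k)
    where
    partial : ∀ k → S.conv w (u Y.^ suc N) k ≈ ι (k C suc N)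
    partial zero    = trans (*-identityˡ ((u Y.^ suc N) 0)) (trans (u-power-0 N) (ι-cong (≡.sym (k>n⇒nCk≡0 {0} {suc N} (ℕ.s≤s ℕ.z≤n)))))
    partial (suc k) = trans (+-cong (trans (*-identityˡ ((u Y.^ suc N) (suc k))) (u-power N k)) (partial k))
      (trans (sym (ι-+ (k C N) (k C suc N))) (ι-cong (nCk+nC[k+1]≡[n+1]C[k+1] k N)))

  -- As Φ has no constant term in t, the right-hand side involves only coefficients of e_0 up to
  -- t^n, so e_0 is determined by its value at t = 0.
  e-0-rec : ∀ n k → suc n ℕ.< q → ι (suc n) * e 0 (suc n) k ≈ P.conv (Φ ∘ suc) (e 0) n k
  e-0-rec n k n+1<q = begin
    ι (suc n) * e 0 (suc n) k
      ≈⟨ trans (S.at (Y.*-congʳ {e 0 (suc n)} (Y.sym (S.const-ι (suc n)))) k tt) (S.conv-const k (ι (suc n)) (e 0 (suc n))) ⟨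
    P.euler (e 0) (suc n) k
      ≈⟨ S.at (P.at euler-e₀ (suc n) n+1<q) k tt ⟩
    P.conv (e 0) Φ (suc n) k
      ≈⟨ S.at (P.conv-comm (suc n) (e 0) Φ) k tt ⟩
    S.conv (Φ 0) (e 0 (suc n)) k + P.conv (Φ ∘ suc) (e 0) n k
      ≈⟨ +-congʳ (S.at (Y.trans (Y.*-congʳ {e 0 (suc n)} Φ-0) (Y.zeroˡ (e 0 (suc n)))) k tt) ⟩
    0# + P.conv (Φ ∘ suc) (e 0) n k
      ≈⟨ +-identityˡ (P.conv (Φ ∘ suc) (e 0) n k) ⟩
    P.conv (Φ ∘ suc) (e 0) n k ∎

  module ΦCoefficients (N : ℕ) (N+1<q : suc N ℕ.< q) where
    private
      M : ℕ
      M = suc N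
      c : Carrier
      c = inv M * β (q ℕ.∸ N)

      Φ-const : ∀ {s} → (Y.- Y.1#) Y.^ M Y.- u Y.^ M Y.- (Y.- w) Y.^ M Y.≈ s → ∀ k → Φ M k ≈ - (c * s k)
      Φ-const {s} h k = trans (S.at (Φ-suc N N+1<q) k tt) (-‿cong
        (trans (S.at (Y.*-cong (Y.sym (S.const-* (inv M) (β (q ℕ.∸ N)))) h) k tt) (S.conv-const k c s)))

    Φ-odd : M % 2 ≢ 0 → ∀ k → Φ M k ≈ - (c * ((- S.1ˢ k - (u Y.^ M) k) - - (w Y.^ M) k))
    Φ-odd odd = Φ-const {Y.- Y.1# Y.- u Y.^ M Y.- Y.- (w Y.^ M)}
      (Y.+-cong (Y.+-congʳ (±Y.sign-odd M odd)) (Y.-‿cong (Y.trans (Y.neg-^ w M)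
        (Y.trans (Y.*-congʳ (±Y.sign-odd M odd)) (Y.solve 1 (λ x → (Y.:- Y.con (ℤ.+ 1)) Y.:* x Y.:= Y.:- x) Y.refl (w Y.^ M))))))

    Φ-odd-0 : M % 2 ≢ 0 → Φ M 0 ≈ 0#
    Φ-odd-0 odd = trans (Φ-odd odd 0) (trans (-‿cong (*-congˡ {c} (+-cong (+-congˡ (-‿cong (u-power-0 N)))
        (-‿cong (-‿cong (trans (w-power N 0) (trans (ι-cong (nC0≡1 N)) ι-1)))))))
      (solve 1 (λ c → :- (c :* ((:- con (ℤ.+ 1) :- con (ℤ.+ 0)) :- :- con (ℤ.+ 1))) := con (ℤ.+ 0)) refl c))

    Φ-odd-suc : M % 2 ≢ 0 → ∀ k → Φ M (suc k) ≈ - (c * (ι ((suc k ℕ.+ N) C suc k) - ι (k C N)))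
    Φ-odd-suc odd k = trans (Φ-odd odd (suc k)) (-‿cong (*-congˡ {c} (trans
      (solve 2 (λ u w → (:- con (ℤ.+ 0) :- u) :- :- w := w :- u) refl ((u Y.^ M) (suc k)) ((w Y.^ M) (suc k)))
      (+-cong (w-power N (suc k)) (-‿cong (u-power N k))))))

    Φ-even : β (q ℕ.∸ N) ≈ 0# → ∀ k → Φ M k ≈ 0#
    Φ-even β≈0 k = trans (Φ-const Y.refl k) (trans (-‿cong (trans (*-congʳ (trans (*-congˡ β≈0) (zeroʳ _))) (zeroˡ _))) -0#≈0#)

  -- For a = 1 the bracket w - u - 1 vanishes. This removes the stand-in for B_(p-1), and it is why
  -- the letters may start at a = 3.
  Φ-1-suc : 1 ℕ.< q → ∀ k → Φ 1 (suc k) ≈ 0#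
  Φ-1-suc 1<q k = trans (Φ-odd-suc (λ ()) k) (trans (-‿cong (*-congˡ (trans
      (+-cong (trans (ι-cong (≡.trans (≡.cong (_C suc k) (ℕₚ.+-identityʳ (suc k))) (nCn≡1 (suc k)))) ι-1)
        (-‿cong (trans (ι-cong (nC0≡1 k)) ι-1)))
      (-‿inverseʳ 1#)))) (trans (-‿cong (zeroʳ _)) -0#≈0#))
    where open ΦCoefficients 0 1<q

  inv-*-ι : ∀ n x → n ℕ.< q → inv (suc n) * (ι (suc n) * x) ≈ x
  inv-*-ι n x n<q = trans (sym (*-assoc _ _ _)) (trans (*-congʳ (inv-ι n n<q)) (*-identityˡ x))

  logPower : ℕ → ℕ → Carrier
  logPower zero    = S.1ˢ
  logPower (suc n) = S.conv L (logPower n)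

  logPower≈n!r : ∀ n N → n ℕ.≤ q → logPower n N ≈ ι (n !) * r n N
  logPower≈n!r zero    N _   = sym (trans (*-congʳ {S.1ˢ N} ι-1) (*-identityˡ (S.1ˢ N)))
  logPower≈n!r (suc n) N n<q = begin
    S.conv L (logPower n) N                        ≈⟨ S.conv-cong N (λ _ → refl) (λ i → logPower≈n!r n i (ℕₚ.<⇒≤ n<q)) ⟩
    S.conv L (λ i → ι (n !) * r n i) N           ≈⟨ conv-scaleʳ N (ι (n !)) L (r n) ⟩
    ι (n !) * S.conv L (r n) N                   ≈⟨ *-congˡ {ι (n !)} (ι-r n N n<q) ⟨
    ι (n !) * (ι (suc n) * r (suc n) N)               ≈⟨ solve 3 (λ a b c → a :* (b :* c) := (b :* a) :* c) refl (ι (n !)) (ι (suc n)) (r (suc n) N) ⟩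
    (ι (suc n) * ι (n !)) * r (suc n) N               ≈⟨ *-congʳ {r (suc n) N} (ι-* (suc n) (n !)) ⟨
    ι (suc n !) * r (suc n) N ∎

-- Sums over words and their differential equations

record Reciprocals (F : CommutativeRing 0ℓ 0ℓ) : Set where
  open RingTools F
  field
    rc   : ℕ → Carrier
    rc-ι : ∀ n → rc (suc n) * ι (suc n) ≈ 1#

module TruncatedSeries (F : CommutativeRing 0ℓ 0ℓ) (b : ℕ) where
  open PowerSeries F (ℕ._≤ b) (ℕₚ.≤-trans (ℕₚ.n≤1+n _)) public
  T : CommutativeRing 0ℓ 0ℓ
  T = series-commutativeRing

-- Y ℓ s m collects the contributions of the words of length ℓ and weight m whose partial sums start from s.
record IteratedSums (F : CommutativeRing 0ℓ 0ℓ) (recs : Reciprocals F) (b : ℕ) : Set where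
  open Reciprocals recs
  open TruncatedSeries F b
  private module T = RingTools T
  field
    G     : ℕ → Series
    G-0   : G 0 ≋ 0ˢ
    Y     : ℕ → ℕ → ℕ → Series
    Y-0-0 : ∀ s → Y 0 s 0 ≋ 1ˢ
    Y-0-suc : ∀ s m → Y 0 s (suc m) ≋ 0ˢ
    Y-suc : ∀ ℓ s m → Y (suc ℓ) s m ≋
      T.Σ< m (λ i → const (rc (s ℕ.+ suc i)) *ˢ (G (suc i) *ˢ Y ℓ (s ℕ.+ suc i) (m ℕ.∸ suc i)))
    Y-top : ∀ s m → Y (suc b) s m ≋ 0ˢ

module IteratedSumsProperties (F : CommutativeRing 0ℓ 0ℓ) (recs : Reciprocals F) (b : ℕ) (sums : IteratedSums F recs b) where
  open Reciprocals recs
  private module F = RingTools F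
  module T = TruncatedSeries F b
  open T using (const; const-*; const-cong; const-ι; at; ≋-intro)
  open RingTools T.T
  open IteratedSums sums

  rcᵀ-ι : ∀ n → const (rc (suc n)) * ι (suc n) ≈ 1#
  rcᵀ-ι n = trans (*-congˡ {const (rc (suc n))} (sym (const-ι (suc n)))) (trans (sym (const-* _ _)) (const-cong (rc-ι n)))

  -- The last partial sum of every word is s + m, so multiplication by it cancels the denominator
  -- attached to the last letter. Since `Y-suc` peels off the first letter, the factor is carried
  -- past that letter by induction, and `Σ-triangle` exchanges the sums over the first and the last
  -- letter.
  last-letter : ∀ ℓ s m → ι (s ℕ.+ m) * Y (suc ℓ) s m ≈ Σ< m (λ i → G (suc i) * Y ℓ s (m ℕ.∸ suc i))
  last-letter zero s m = trans (*-congˡ {ι (s ℕ.+ m)} (Y-suc 0 s m)) (trans (Σ-*ˡ m (ι (s ℕ.+ m)) _) (Σ-cong m term))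
    where
    Y-0 : ∀ s s′ m → Y 0 s m ≈ Y 0 s′ m
    Y-0 s s′ zero    = trans (Y-0-0 s) (sym (Y-0-0 s′))
    Y-0 s s′ (suc m) = trans (Y-0-suc s m) (sym (Y-0-suc s′ m))
    swap : ∀ (a c g y : Carrier) → a * (c * (g * y)) ≈ g * ((c * a) * y)
    swap a c g y = solve 4 (λ a c g y → a :* (c :* (g :* y)) := g :* ((c :* a) :* y)) refl a c g y
    term : ∀ i → i ℕ.< m →
      ι (s ℕ.+ m) * (const (rc (s ℕ.+ suc i)) * (G (suc i) * Y 0 (s ℕ.+ suc i) (m ℕ.∸ suc i))) ≈ G (suc i) * Y 0 s (m ℕ.∸ suc i)
    term i i<m with m ℕ.∸ suc i in eq
    ... | zero = trans (swap (ι (s ℕ.+ m)) _ (G (suc i)) _) (*-congˡ {G (suc i)} (trans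
          (*-congʳ {Y 0 (s ℕ.+ suc i) 0} unit)
          (trans (*-identityˡ _) (Y-0 (s ℕ.+ suc i) s 0))))
      where
      unit : const (rc (s ℕ.+ suc i)) * ι (s ℕ.+ m) ≈ 1#
      unit = ≡.subst₂ (λ k l → const (rc k) * ι (s ℕ.+ l) ≈ 1#) (≡.sym (ℕₚ.+-suc s i)) (ℕₚ.≤-antisym i<m (ℕₚ.m∸n≡0⇒m≤n eq))
        (≡.subst (λ k → const (rc (suc (s ℕ.+ i))) * ι k ≈ 1#) (≡.sym (ℕₚ.+-suc s i)) (rcᵀ-ι (s ℕ.+ i)))
    ... | suc m′ = trans (swap (ι (s ℕ.+ m)) _ (G (suc i)) _) (*-congˡ {G (suc i)}
          (trans (*-congˡ {const (rc (s ℕ.+ suc i)) * ι (s ℕ.+ m)} (Y-0-suc (s ℕ.+ suc i) m′)) (trans (zeroʳ _) (sym (Y-0-suc s m′)))))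
  last-letter (suc ℓ) s m = begin
    ι (s ℕ.+ m) * Y (suc (suc ℓ)) s m
      ≈⟨ trans (*-congˡ {ι (s ℕ.+ m)} (Y-suc (suc ℓ) s m)) (Σ-*ˡ m (ι (s ℕ.+ m)) _) ⟩
    Σ< m (λ i → ι (s ℕ.+ m) * (c i * (G (suc i) * Y (suc ℓ) (s ℕ.+ suc i) (m ℕ.∸ suc i))))
      ≈⟨ Σ-cong m inner ⟩
    Σ< m (λ i → Σ< (m ℕ.∸ suc i) (λ j → G (suc j) * (c i * (G (suc i) * Y ℓ (s ℕ.+ suc i) (m ℕ.∸ suc i ℕ.∸ suc j)))))
      ≈⟨ Σ-triangle m _ ⟩
    Σ< m (λ j → Σ< (m ℕ.∸ suc j) (λ i → G (suc j) * (c i * (G (suc i) * Y ℓ (s ℕ.+ suc i) (m ℕ.∸ suc i ℕ.∸ suc j)))))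
      ≈⟨ Σ-cong m outer ⟩
    Σ< m (λ j → G (suc j) * Y (suc ℓ) s (m ℕ.∸ suc j)) ∎
    where
    c : ℕ → Carrier
    c i = const (rc (s ℕ.+ suc i))
    inner : ∀ i → i ℕ.< m →
      ι (s ℕ.+ m) * (c i * (G (suc i) * Y (suc ℓ) (s ℕ.+ suc i) (m ℕ.∸ suc i))) ≈
      Σ< (m ℕ.∸ suc i) (λ j → G (suc j) * (c i * (G (suc i) * Y ℓ (s ℕ.+ suc i) (m ℕ.∸ suc i ℕ.∸ suc j))))
    inner i i<m = begin
      ι (s ℕ.+ m) * (c i * (G (suc i) * Y (suc ℓ) (s ℕ.+ suc i) (m ℕ.∸ suc i)))
        ≈⟨ solve 4 (λ a c g y → a :* (c :* (g :* y)) := (c :* g) :* (a :* y)) refl (ι (s ℕ.+ m)) (c i) (G (suc i)) _ ⟩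
      (c i * G (suc i)) * (ι (s ℕ.+ m) * Y (suc ℓ) (s ℕ.+ suc i) (m ℕ.∸ suc i))
        ≡⟨ ≡.cong (λ k → (c i * G (suc i)) * (ι k * Y (suc ℓ) (s ℕ.+ suc i) (m ℕ.∸ suc i)))
             (≡.sym (≡.trans (ℕₚ.+-assoc s (suc i) (m ℕ.∸ suc i)) (≡.cong (s ℕ.+_) (ℕₚ.m+[n∸m]≡n i<m)))) ⟩
      (c i * G (suc i)) * (ι (s ℕ.+ suc i ℕ.+ (m ℕ.∸ suc i)) * Y (suc ℓ) (s ℕ.+ suc i) (m ℕ.∸ suc i))
        ≈⟨ *-congˡ {c i * G (suc i)} (last-letter ℓ (s ℕ.+ suc i) (m ℕ.∸ suc i)) ⟩
      (c i * G (suc i)) * Σ< (m ℕ.∸ suc i) (λ j → G (suc j) * Y ℓ (s ℕ.+ suc i) (m ℕ.∸ suc i ℕ.∸ suc j))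
        ≈⟨ Σ-*ˡ (m ℕ.∸ suc i) (c i * G (suc i)) _ ⟩
      Σ< (m ℕ.∸ suc i) (λ j → (c i * G (suc i)) * (G (suc j) * Y ℓ (s ℕ.+ suc i) (m ℕ.∸ suc i ℕ.∸ suc j)))
        ≈⟨ Σ-cong (m ℕ.∸ suc i) (λ j _ → solve 4 (λ c g h y → (c :* g) :* (h :* y) := h :* (c :* (g :* y))) refl (c i) (G (suc i)) (G (suc j)) _) ⟩
      Σ< (m ℕ.∸ suc i) (λ j → G (suc j) * (c i * (G (suc i) * Y ℓ (s ℕ.+ suc i) (m ℕ.∸ suc i ℕ.∸ suc j)))) ∎
    outer : ∀ j → j ℕ.< m →
      Σ< (m ℕ.∸ suc j) (λ i → G (suc j) * (c i * (G (suc i) * Y ℓ (s ℕ.+ suc i) (m ℕ.∸ suc i ℕ.∸ suc j)))) ≈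
      G (suc j) * Y (suc ℓ) s (m ℕ.∸ suc j)
    outer j _ = begin
      Σ< (m ℕ.∸ suc j) (λ i → G (suc j) * (c i * (G (suc i) * Y ℓ (s ℕ.+ suc i) (m ℕ.∸ suc i ℕ.∸ suc j))))
        ≈⟨ Σ-cong (m ℕ.∸ suc j) (λ i _ → reflexive (≡.cong (λ k → G (suc j) * (c i * (G (suc i) * Y ℓ (s ℕ.+ suc i) k))) (∸-swap i j))) ⟩
      Σ< (m ℕ.∸ suc j) (λ i → G (suc j) * (c i * (G (suc i) * Y ℓ (s ℕ.+ suc i) (m ℕ.∸ suc j ℕ.∸ suc i))))
        ≈⟨ Σ-*ˡ (m ℕ.∸ suc j) (G (suc j)) _ ⟨
      G (suc j) * Σ< (m ℕ.∸ suc j) (λ i → c i * (G (suc i) * Y ℓ (s ℕ.+ suc i) (m ℕ.∸ suc j ℕ.∸ suc i)))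
        ≈⟨ *-congˡ {G (suc j)} (Y-suc ℓ s (m ℕ.∸ suc j)) ⟨
      G (suc j) * Y (suc ℓ) s (m ℕ.∸ suc j) ∎
      where
      ∸-swap : ∀ i j → m ℕ.∸ suc i ℕ.∸ suc j ≡ m ℕ.∸ suc j ℕ.∸ suc i
      ∸-swap i j = ≡.trans (ℕₚ.∸-+-assoc m (suc i) (suc j))
        (≡.trans (≡.cong (m ℕ.∸_) (ℕₚ.+-comm (suc i) (suc j))) (≡.sym (ℕₚ.∸-+-assoc m (suc j) (suc i))))

  module 𝕐 = PowerSeries T.T (λ _ → ⊤) (λ _ → tt)
  private module 𝕐R = RingTools 𝕐.series-commutativeRing

  X H : 𝕐.Series
  X m = Σ< (suc b) (λ ℓ → Y ℓ 0 m)
  H k = const (rc k) * G k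

  X-0 : X 0 ≈ 1#
  X-0 = trans (Σ-head b (λ ℓ → Y ℓ 0 0)) (trans (+-cong (Y-0-0 0) (Σ-zero b (λ ℓ _ → Y-suc ℓ 0 0))) (+-identityʳ 1#))

  euler-X : 𝕐.euler X 𝕐.≋ G 𝕐.*ˢ X
  euler-X = 𝕐.≋-intro λ
    { zero    _ → trans (zeroˡ (X 0)) (sym (trans (*-congʳ {X 0} G-0) (zeroˡ (X 0))))
    ; (suc m) _ → begin
        ι (suc m) * Σ< (suc b) (λ ℓ → Y ℓ 0 (suc m))
          -- At positive weight the empty word contributes nothing, and words of length b + 1 vanish
          -- in degrees up to b, so ℓ can be shifted by one within the same range.
          ≈⟨ *-congˡ {ι (suc m)} (trans (Σ-head b (λ ℓ → Y ℓ 0 (suc m))) (trans (+-congʳ (Y-0-suc 0 m)) (trans (+-identityˡ _)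
               (sym (trans (+-congˡ (Y-top 0 (suc m))) (+-identityʳ _)))))) ⟩
        ι (suc m) * Σ< (suc b) (λ ℓ → Y (suc ℓ) 0 (suc m))
          ≈⟨ trans (Σ-*ˡ (suc b) (ι (suc m)) _) (Σ-cong (suc b) (λ ℓ _ → last-letter ℓ 0 (suc m))) ⟩
        Σ< (suc b) (λ ℓ → Σ< (suc m) (λ i → G (suc i) * Y ℓ 0 (m ℕ.∸ i)))
          ≈⟨ trans (Σ-swap (suc b) (suc m) _) (Σ-cong (suc m) (λ i _ → sym (Σ-*ˡ (suc b) (G (suc i)) _))) ⟩
        Σ< (suc m) (λ i → G (suc i) * X (m ℕ.∸ i))
          ≈⟨ 𝕐.conv-Σ m (G ∘ suc) X ⟨
        𝕐.conv (G ∘ suc) X m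
          ≈⟨ trans (+-congʳ (trans (*-congʳ {X (suc m)} G-0) (zeroˡ (X (suc m))))) (+-identityˡ _) ⟨
        G 0 * X (suc m) + 𝕐.conv (G ∘ suc) X m ∎ }

  euler-H : 𝕐.euler H 𝕐.≋ G
  euler-H = 𝕐.≋-intro λ
    { zero    _ → trans (zeroˡ (H 0)) (sym G-0)
    ; (suc k) _ → begin
        ι (suc k) * (const (rc (suc k)) * G (suc k))     ≈⟨ solve 3 (λ a c g → a :* (c :* g) := (c :* a) :* g) refl (ι (suc k)) (const (rc (suc k))) (G (suc k)) ⟩
        (const (rc (suc k)) * ι (suc k)) * G (suc k)     ≈⟨ trans (*-congʳ {G (suc k)} (rcᵀ-ι k)) (*-identityˡ _) ⟩
        G (suc k) ∎ }

  τ : 𝕐.Series → 𝕐.Series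
  τ f m = T.euler (f m)

  τ-cong : ∀ {f g} → f 𝕐.≋ g → τ f 𝕐.≋ τ g
  τ-cong h = 𝕐.≋-intro λ m _ → T.euler-cong (𝕐.at h m tt)

  euler-+ : ∀ f g → T.euler (f + g) ≈ T.euler f + T.euler g
  euler-+ f g = ≋-intro λ n _ → F.distribˡ _ _ _

  τ-conv : ∀ m f g → T.euler (𝕐.conv f g m) ≈ 𝕐.conv (τ f) g m + 𝕐.conv f (τ g) m
  τ-conv zero    f g = T.leibniz (f 0) (g 0)
  τ-conv (suc m) f g = trans (euler-+ (f 0 * g (suc m)) (𝕐.conv (f ∘ suc) g m))
    (trans (+-cong (T.leibniz (f 0) (g (suc m))) (τ-conv m (f ∘ suc) g))
    (solve 4 (λ a b c d → (a :+ b) :+ (c :+ d) := (a :+ c) :+ (b :+ d)) refl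
      (T.euler (f 0) * g (suc m)) (f 0 * T.euler (g (suc m))) (𝕐.conv (τ (f ∘ suc)) g m) (𝕐.conv (f ∘ suc) (τ g) m)))

  τ-* : ∀ f g → τ (f 𝕐.*ˢ g) 𝕐.≋ τ f 𝕐.*ˢ g 𝕐.+ˢ f 𝕐.*ˢ τ g
  τ-* f g = 𝕐.≋-intro λ m _ → τ-conv m f g

  τ-euler : ∀ f → τ (𝕐.euler f) 𝕐.≋ 𝕐.euler (τ f)
  τ-euler f = 𝕐.≋-intro λ m _ → trans (T.leibniz (ι m) (f m))
    (trans (+-congʳ (trans (*-congʳ {f m} (euler-ι m)) (zeroˡ (f m)))) (+-identityˡ _))
    where
    euler-const : ∀ c → T.euler (const c) ≈ 0#
    euler-const c = ≋-intro λ { zero _ → F.zeroˡ c ; (suc n) _ → F.zeroʳ _ }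
    euler-ι : ∀ m → T.euler (ι m) ≈ 0#
    euler-ι m = trans (T.euler-cong (sym (const-ι m))) (euler-const (F.ι m))

  -- With θ = y d/dy, both τX and (τH)X solve θZ = GZ + (τG)X, and they agree at y = 0.
  τ-X : τ X 𝕐.≋ τ H 𝕐.*ˢ X
  τ-X = 𝕐.≋-intro λ m _ → x≈y (Z-zero m m ℕₚ.≤-refl)
    where
    x≈y : ∀ {x y : Carrier} → x + - y ≈ 0# → x ≈ y
    x≈y {x} {y} h = +-cancelʳ′ (- y) (trans h (sym (-‿inverseʳ y)))
    Z : 𝕐.Series
    Z = τ X 𝕐R.- (τ H 𝕐R.* X)
    euler-neg : ∀ f → 𝕐.euler (𝕐R.- f) 𝕐R.≈ 𝕐R.- 𝕐.euler f
    euler-neg f = 𝕐.≋-intro λ m _ → sym (-‿distribʳ-* (ι m) (f m))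
    euler-Z : 𝕐.euler Z 𝕐R.≈ G 𝕐R.* Z
    euler-Z = 𝕐R.begin
      𝕐.euler Z
        𝕐R.≈⟨ 𝕐.≋-intro (λ m _ → distribˡ (ι m) _ _) ⟩
      𝕐.euler (τ X) 𝕐R.+ 𝕐.euler (𝕐R.- (τ H 𝕐R.* X))
        𝕐R.≈⟨ 𝕐R.+-cong (𝕐R.trans (𝕐R.sym (τ-euler X)) (𝕐R.trans (τ-cong euler-X) (τ-* G X)))
              (𝕐R.trans (euler-neg (τ H 𝕐R.* X)) (𝕐R.-‿cong (𝕐R.trans (𝕐.leibniz (τ H) X)
                (𝕐R.+-cong (𝕐R.*-congʳ {X} (𝕐R.trans (𝕐R.sym (τ-euler H)) (τ-cong euler-H))) (𝕐R.*-congˡ {τ H} euler-X))))) ⟩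
      (τ G 𝕐R.* X 𝕐R.+ G 𝕐R.* τ X) 𝕐R.- (τ G 𝕐R.* X 𝕐R.+ τ H 𝕐R.* (G 𝕐R.* X))
        𝕐R.≈⟨ 𝕐R.solve 5 (λ a x g y h → (a 𝕐R.:* x 𝕐R.:+ g 𝕐R.:* y) 𝕐R.:- (a 𝕐R.:* x 𝕐R.:+ h 𝕐R.:* (g 𝕐R.:* x)) 𝕐R.:= g 𝕐R.:* (y 𝕐R.:- h 𝕐R.:* x))
               𝕐R.refl (τ G) X G (τ X) (τ H) ⟩
      G 𝕐R.* Z 𝕐R.∎
    Z-0 : Z 0 ≈ 0#
    Z-0 = trans (+-cong (T.euler-cong X-0) (-‿cong (trans (*-congʳ {X 0} (T.euler-cong (trans (*-congˡ {const (rc 0)} G-0) (zeroʳ (const (rc 0)))))) (trans (*-congʳ {X 0} euler-0) (zeroˡ (X 0))))))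
      (trans (+-cong euler-1 -0#≈0#) (+-identityʳ 0#))
      where
      euler-0 : T.euler 0# ≈ 0#
      euler-0 = ≋-intro λ n _ → F.zeroʳ _
      euler-1 : T.euler 1# ≈ 0#
      euler-1 = ≋-intro λ { zero _ → F.zeroˡ _ ; (suc n) _ → F.zeroʳ _ }
    Z-zero : ∀ M m → m ℕ.≤ M → Z m ≈ 0#
    Z-zero M       zero    _   = Z-0
    Z-zero (suc M) (suc m) m≤M = begin
      Z (suc m)                                           ≈⟨ trans (*-congʳ {Z (suc m)} (rcᵀ-ι m)) (*-identityˡ _) ⟨
      (const (rc (suc m)) * ι (suc m)) * Z (suc m)        ≈⟨ *-assoc (const (rc (suc m))) (ι (suc m)) (Z (suc m)) ⟩
      const (rc (suc m)) * (ι (suc m) * Z (suc m))        ≈⟨ *-congˡ {const (rc (suc m))} (𝕐.at euler-Z (suc m) tt) ⟩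
      const (rc (suc m)) * (G 0 * Z (suc m) + 𝕐.conv (G ∘ suc) Z m)
        ≈⟨ *-congˡ {const (rc (suc m))} (trans (+-cong (trans (*-congʳ {Z (suc m)} G-0) (zeroˡ (Z (suc m))))
             (trans (𝕐.conv-cong-≤ m {g′ = λ _ → 0#} (λ _ _ → refl) (λ i i≤m → Z-zero M i (ℕₚ.≤-trans i≤m (ℕ.s≤s⁻¹ m≤M))))
               (trans (𝕐.conv-comm m (G ∘ suc) _) (𝕐.conv-zeroˡ m (G ∘ suc))))) (+-identityʳ 0#)) ⟩
      const (rc (suc m)) * 0#                             ≈⟨ zeroʳ (const (rc (suc m))) ⟩
      0# ∎

-- Rational numbers and the two sides as coefficients

module Q = RingTools ℚₚ.+-*-commutativeRing

fromℚᵘ-+ : ∀ x y → fromℚᵘ (x ℚᵘ.+ y) ≡ fromℚᵘ x ℚ.+ fromℚᵘ y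
fromℚᵘ-+ x y = ℚₚ.toℚᵘ-injective (ℚᵘₚ.≃-trans (ℚₚ.toℚᵘ-fromℚᵘ (x ℚᵘ.+ y)) (ℚᵘₚ.≃-sym
  (ℚᵘₚ.≃-trans (ℚₚ.toℚᵘ-homo-+ (fromℚᵘ x) (fromℚᵘ y)) (ℚᵘₚ.+-cong (ℚₚ.toℚᵘ-fromℚᵘ x) (ℚₚ.toℚᵘ-fromℚᵘ y)))))

fromℚᵘ-* : ∀ x y → fromℚᵘ (x ℚᵘ.* y) ≡ fromℚᵘ x ℚ.* fromℚᵘ y
fromℚᵘ-* x y = ℚₚ.toℚᵘ-injective (ℚᵘₚ.≃-trans (ℚₚ.toℚᵘ-fromℚᵘ (x ℚᵘ.* y)) (ℚᵘₚ.≃-sym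
  (ℚᵘₚ.≃-trans (ℚₚ.toℚᵘ-homo-* (fromℚᵘ x) (fromℚᵘ y)) (ℚᵘₚ.*-cong (ℚₚ.toℚᵘ-fromℚᵘ x) (ℚₚ.toℚᵘ-fromℚᵘ y)))))

ℤtoℚ-+ : ∀ i j → ℤtoℚ (i ℤ.+ j) ≡ ℤtoℚ i ℚ.+ ℤtoℚ j
ℤtoℚ-+ i j = ≡.trans (ℚₚ.fromℚᵘ-cong {mkℚᵘ (i ℤ.+ j) 0} {mkℚᵘ i 0 ℚᵘ.+ mkℚᵘ j 0} (*≡* (≡.cong (ℤ._* + 1) (≡.sym (≡.cong₂ ℤ._+_ (ℤₚ.*-identityʳ i) (ℤₚ.*-identityʳ j))))))
  (fromℚᵘ-+ (mkℚᵘ i 0) (mkℚᵘ j 0))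

ℤtoℚ-* : ∀ i j → ℤtoℚ (i ℤ.* j) ≡ ℤtoℚ i ℚ.* ℤtoℚ j
ℤtoℚ-* i j = fromℚᵘ-* (mkℚᵘ i 0) (mkℚᵘ j 0)

ℤtoℚ-injective : ∀ {i j} → ℤtoℚ i ≡ ℤtoℚ j → i ≡ j
ℤtoℚ-injective {i} {j} h with ℚₚ.fromℚᵘ-injective {mkℚᵘ i 0} {mkℚᵘ j 0} h
... | *≡* e = ≡.trans (≡.sym (ℤₚ.*-identityʳ i)) (≡.trans e (ℤₚ.*-identityʳ j))

ℕtoℚ-ι : ∀ n → ℕtoℚ n ≡ Q.ι n
ℕtoℚ-ι zero    = ≡.refl
ℕtoℚ-ι (suc n) = ≡.trans (ℤtoℚ-+ (+ 1) (+ n)) (≡.cong (1ℚ ℚ.+_) (ℕtoℚ-ι n))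

recip-ℕtoℚ : ∀ n → recip (suc n) ℚ.* ℕtoℚ (suc n) ≡ 1ℚ
recip-ℕtoℚ n = ≡.trans (≡.sym (fromℚᵘ-* x y)) (ℚₚ.fromℚᵘ-cong {x ℚᵘ.* y} {mkℚᵘ (+ 1) 0}
  (*≡* (≡.trans (ℤₚ.*-identityʳ (+ 1 ℤ.* + suc n)) (≡.cong (λ k → + 1 ℤ.* + suc k) (≡.sym (ℕₚ.*-identityʳ n))))))
  where
  x y : ℚᵘ
  x = mkℚᵘ (+ 1) n
  y = mkℚᵘ (+ suc n) 0

recip-ι : ∀ n → recip (suc n) ℚ.* Q.ι (suc n) ≡ 1ℚ
recip-ι n = ≡.trans (≡.cong (recip (suc n) ℚ.*_) (≡.sym (ℕtoℚ-ι (suc n)))) (recip-ℕtoℚ n)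

recip-* : ∀ a b → recip (a ℕ.* b) ≡ recip a ℚ.* recip b
recip-* zero    b       = ≡.sym (ℚₚ.*-zeroˡ (recip b))
recip-* (suc a) zero    = ≡.trans (≡.cong recip (ℕₚ.*-zeroʳ (suc a))) (≡.sym (ℚₚ.*-zeroʳ (recip (suc a))))
recip-* (suc a) (suc b) = fromℚᵘ-* (mkℚᵘ (+ 1) a) (mkℚᵘ (+ 1) b)

↥-↧ : ∀ x → x ℚ.* ℕtoℚ (↧ₙ x) ≡ ℤtoℚ (↥ x)
↥-↧ x@(ℚ.mkℚ i d _) = ≡.trans (≡.cong (ℚ._* ℕtoℚ (suc d)) (≡.sym (ℚₚ.fromℚᵘ-toℚᵘ x)))
  (≡.trans (≡.sym (fromℚᵘ-* (mkℚᵘ i d) (mkℚᵘ (+ suc d) 0)))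
  (ℚₚ.fromℚᵘ-cong {mkℚᵘ i d ℚᵘ.* mkℚᵘ (+ suc d) 0} {mkℚᵘ i 0}
    (*≡* (≡.trans (ℤₚ.*-identityʳ (i ℤ.* + suc d)) (≡.cong (λ k → i ℤ.* + suc k) (≡.sym (ℕₚ.*-identityʳ d)))))))

ℚ-reciprocals : Reciprocals ℚₚ.+-*-commutativeRing
ℚ-reciprocals = record { rc = recip ; rc-ι = recip-ι }

-- Sums over lists

sumOver : {A : Set} → (A → ℚ) → List A → ℚ
sumOver f xs = sumℚ (map f xs)

module _ {A : Set} where
  sumOver-++ : ∀ (f : A → ℚ) xs ys → sumOver f (xs ++ ys) ≡ sumOver f xs ℚ.+ sumOver f ys
  sumOver-++ f []       ys = ≡.sym (ℚₚ.+-identityˡ _)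
  sumOver-++ f (x ∷ xs) ys = ≡.trans (≡.cong (f x ℚ.+_) (sumOver-++ f xs ys)) (≡.sym (ℚₚ.+-assoc (f x) _ _))

  sumOver-concatMap : {B : Set} (f : A → ℚ) (g : B → List A) → ∀ xs → sumOver f (concatMap g xs) ≡ sumOver (sumOver f ∘ g) xs
  sumOver-concatMap f g []       = ≡.refl
  sumOver-concatMap f g (x ∷ xs) = ≡.trans (sumOver-++ f (g x) _) (≡.cong (sumOver f (g x) ℚ.+_) (sumOver-concatMap f g xs))

  sumOver-map : {B : Set} (f : A → ℚ) (g : B → A) → ∀ xs → sumOver f (map g xs) ≡ sumOver (f ∘ g) xs
  sumOver-map f g []       = ≡.refl
  sumOver-map f g (x ∷ xs) = ≡.cong (f (g x) ℚ.+_) (sumOver-map f g xs)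

  sumOver-cong : {f g : A → ℚ} → (∀ x → f x ≡ g x) → ∀ xs → sumOver f xs ≡ sumOver g xs
  sumOver-cong h []       = ≡.refl
  sumOver-cong h (x ∷ xs) = ≡.cong₂ ℚ._+_ (h x) (sumOver-cong h xs)

  sumOver-*ˡ : ∀ c (f : A → ℚ) xs → sumOver (λ x → c ℚ.* f x) xs ≡ c ℚ.* sumOver f xs
  sumOver-*ˡ c f []       = ≡.sym (ℚₚ.*-zeroʳ c)
  sumOver-*ˡ c f (x ∷ xs) = ≡.trans (≡.cong (c ℚ.* f x ℚ.+_) (sumOver-*ˡ c f xs)) (≡.sym (ℚₚ.*-distribˡ-+ c _ _))

  sumOver-0 : ∀ (xs : List A) → sumOver (λ _ → 0ℚ) xs ≡ 0ℚ
  sumOver-0 []       = ≡.refl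
  sumOver-0 (x ∷ xs) = ≡.trans (ℚₚ.+-identityˡ _) (sumOver-0 xs)

  sumOver-+ : ∀ (f g : A → ℚ) xs → sumOver (λ x → f x ℚ.+ g x) xs ≡ sumOver f xs ℚ.+ sumOver g xs
  sumOver-+ f g []       = ≡.refl
  sumOver-+ f g (x ∷ xs) = ≡.trans (≡.cong (f x ℚ.+ g x ℚ.+_) (sumOver-+ f g xs))
    (Q.solve 4 (λ a b c d → (a Q.:+ b) Q.:+ (c Q.:+ d) Q.:= (a Q.:+ c) Q.:+ (b Q.:+ d)) ≡.refl (f x) (g x) _ _)

  sumOver-Σ : ∀ n (f : A → ℕ → ℚ) xs → sumOver (λ x → Q.Σ< n (f x)) xs ≡ Q.Σ< n (λ i → sumOver (λ x → f x i) xs)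
  sumOver-Σ zero    f xs = sumOver-0 xs
  sumOver-Σ (suc n) f xs = ≡.trans (sumOver-+ _ _ xs) (≡.cong (ℚ._+ sumOver (λ x → f x n) xs) (sumOver-Σ n f xs))

  sumOver-filter : ∀ (g : A → Bool) (f : A → ℚ) xs →
    sumOver f (filter (λ x → g x Bool.≟ true) xs) ≡ sumOver (λ x → if g x then f x else 0ℚ) xs
  sumOver-filter g f []       = ≡.refl
  sumOver-filter g f (x ∷ xs) with g x
  ... | true  = ≡.cong (f x ℚ.+_) (sumOver-filter g f xs)
  ... | false = ≡.trans (sumOver-filter g f xs) (≡.sym (ℚₚ.+-identityˡ _))

  sumOver-applyUpTo : ∀ (f : A → ℚ) (h : ℕ → A) n → sumOver f (applyUpTo h n) ≡ Q.Σ< n (f ∘ h)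
  sumOver-applyUpTo f h zero    = ≡.refl
  sumOver-applyUpTo f h (suc n) = ≡.trans (≡.cong (f (h 0) ℚ.+_) (sumOver-applyUpTo f (h ∘ suc) n)) (≡.sym (Q.Σ-head n (f ∘ h)))

sumOver-1⋯n : ∀ (f : ℕ → ℚ) n → sumOver f (map suc (upTo n)) ≡ Q.Σ< n (f ∘ suc)
sumOver-1⋯n f n = ≡.trans (sumOver-map f suc (upTo n)) (sumOver-applyUpTo (f ∘ suc) id n)

sumOver-compositions : ∀ (F : List ℕ → ℚ) k N →
  sumOver F (compositions (suc k) N) ≡ Q.Σ< N (λ i → sumOver (λ ls → F (suc i ∷ ls)) (compositions k (N ℕ.∸ suc i)))
sumOver-compositions F k N = ≡.trans (sumOver-concatMap F _ (map suc (upTo N)))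
  (≡.trans (sumOver-1⋯n _ N) (Q.Σ-cong N (λ i _ → sumOver-map F (suc i ∷_) (compositions k (N ℕ.∸ suc i)))))

sumOver-compositions-cong : ∀ (F G : List ℕ → ℚ) k N → (∀ ls → sum ls ≡ N → F ls ≡ G ls) →
  sumOver F (compositions k N) ≡ sumOver G (compositions k N)
sumOver-compositions-cong F G zero    zero    h = ≡.cong (ℚ._+ 0ℚ) (h [] ≡.refl)
sumOver-compositions-cong F G zero    (suc N) h = ≡.refl
sumOver-compositions-cong F G (suc k) N       h = ≡.trans (sumOver-compositions F k N)
  (≡.trans (Q.Σ-cong N (λ i i<N → sumOver-compositions-cong _ _ k (N ℕ.∸ suc i) (λ ls e →
    h (suc i ∷ ls) (≡.trans (≡.cong (suc i ℕ.+_) e) (ℕₚ.m+[n∸m]≡n i<N))))) (≡.sym (sumOver-compositions G k N)))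

module Qˢ = PowerSeries ℚₚ.+-*-commutativeRing (λ _ → ⊤) (λ _ → tt)

conv-Σ⁺ : ∀ n f g → f 0 ≡ 0ℚ → Qˢ.conv f g n ≡ Q.Σ< n (λ i → f (suc i) ℚ.* g (n ℕ.∸ suc i))
conv-Σ⁺ n f g f₀ = begin
  Qˢ.conv f g n                                    ≡⟨ Qˢ.conv-Σ n f g ⟩
  Q.Σ< (suc n) (λ i → f i ℚ.* g (n ℕ.∸ i))         ≡⟨ Q.Σ-head n (λ i → f i ℚ.* g (n ℕ.∸ i)) ⟩
  f 0 ℚ.* g n ℚ.+ rest                             ≡⟨ ≡.cong (λ x → x ℚ.* g n ℚ.+ rest) f₀ ⟩
  0ℚ ℚ.* g n ℚ.+ rest                              ≡⟨ ≡.cong (ℚ._+ rest) (ℚₚ.*-zeroˡ (g n)) ⟩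
  0ℚ ℚ.+ rest                                      ≡⟨ ℚₚ.+-identityˡ rest ⟩
  rest                                             ∎
  where
  open ≡.≡-Reasoning
  rest : ℚ
  rest = Q.Σ< n (λ i → f (suc i) ℚ.* g (n ℕ.∸ suc i))

-- The sum R as a coefficient

module _ (p : ℕ) where
  logℚ : ℕ → ℚ
  logℚ l = if notDivBy p l then recip l else 0ℚ

  logℚ-0 : logℚ 0 ≡ 0ℚ
  logℚ-0 with notDivBy p 0
  ... | true  = ≡.refl
  ... | false = ≡.refl

  power : ℕ → ℕ → ℚ
  power zero    = Qˢ.1ˢ
  power (suc n) = Qˢ.conv logℚ (power n)

  private
    weight : List ℕ → ℚ
    weight ls = if allB (notDivBy p) ls then recip (foldr ℕ._*_ 1 ls) else 0ℚ

    weight-∷ : ∀ l ls → weight (l ∷ ls) ≡ logℚ l ℚ.* weight ls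
    weight-∷ l ls with notDivBy p l | allB (notDivBy p) ls
    ... | true  | true  = recip-* l (foldr ℕ._*_ 1 ls)
    ... | true  | false = ≡.sym (ℚₚ.*-zeroʳ (recip l))
    ... | false | b     = ≡.sym (ℚₚ.*-zeroˡ (if b then recip (foldr ℕ._*_ 1 ls) else 0ℚ))

    sumOver-weight : ∀ n N → sumOver weight (compositions n N) ≡ power n N
    sumOver-weight zero    zero    = ≡.refl
    sumOver-weight zero    (suc N) = ≡.refl
    sumOver-weight (suc n) N       = begin
      sumOver weight (compositions (suc n) N)
        ≡⟨ sumOver-compositions weight n N ⟩
      Q.Σ< N (λ i → sumOver (λ ls → weight (suc i ∷ ls)) (compositions n (N ℕ.∸ suc i)))
        ≡⟨ Q.Σ-cong N (λ i _ → peel i (compositions n (N ℕ.∸ suc i)) (sumOver-weight n (N ℕ.∸ suc i))) ⟩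
      Q.Σ< N (λ i → logℚ (suc i) ℚ.* power n (N ℕ.∸ suc i))
        ≡⟨ conv-Σ⁺ N logℚ (power n) logℚ-0 ⟨
      power (suc n) N ∎
      where
      open ≡.≡-Reasoning
      peel : ∀ i xs {c} → sumOver weight xs ≡ c → sumOver (λ ls → weight (suc i ∷ ls)) xs ≡ logℚ (suc i) ℚ.* c
      peel i xs h = ≡.trans (sumOver-cong (weight-∷ (suc i)) xs)
        (≡.trans (sumOver-*ˡ (logℚ (suc i)) weight xs) (≡.cong (logℚ (suc i) ℚ.*_) h))

  R≡power : ∀ n m q → R n m p q ≡ power n (m ℕ.* q)
  R≡power n m q = ≡.trans (sumOver-filter (allB (notDivBy p)) (recip ∘ foldr ℕ._*_ 1) (compositions n (m ℕ.* q)))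
    (sumOver-weight n (m ℕ.* q))

open BinomialTransform ℚₚ.+-*-commutativeRing using (T-explicit; T-T; T-0; T-cong; T-+; T-neg; T-low-suc; δ₁) renaming (T to Tℚ)

-- Bernoulli numbers

bernoulliRev≡map : ∀ n → bernoulliRev n ≡ map bernoulli (downFrom (suc n))
bernoulliRev≡map zero    = ≡.refl
bernoulliRev≡map (suc n) = ≡.cong (bernoulli (suc n) ∷_) (bernoulliRev≡map n)

bernoulli-suc : ∀ n → bernoulli (suc n) ≡
  ℚ.- (recip (suc (suc n)) ℚ.* Q.Σ< (suc n) (λ k → ℕtoℚ (suc (suc n) C k) ℚ.* bernoulli k))
bernoulli-suc n = ≡.cong (λ x → ℚ.- (recip (suc (suc n)) ℚ.* x))
  (≡.trans (≡.cong (λ bs → sumℚ (zipWith f (downFrom (suc n)) bs)) (bernoulliRev≡map n)) (zip (suc n)))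
  where
  f : ℕ → ℚ → ℚ
  f k b = ℕtoℚ (suc (suc n) C k) ℚ.* b
  zip : ∀ m → sumℚ (zipWith f (downFrom m) (map bernoulli (downFrom m))) ≡ Q.Σ< m (λ k → f k (bernoulli k))
  zip zero    = ≡.refl
  zip (suc m) = ≡.trans (ℚₚ.+-comm (f m (bernoulli m)) _) (≡.cong (ℚ._+ f m (bernoulli m)) (zip m))

1^n : ∀ n → 1ℚ Q.^ n ≡ 1ℚ
1^n zero    = ≡.refl
1^n (suc n) = ≡.trans (ℚₚ.*-identityˡ (1ℚ Q.^ n)) (1^n n)

-- Umbrally (1 + B)^n = B^n + δ_(n,1). For n ≥ 2 the defining equation of B_(n-1) says that all
-- terms below the last one sum to zero.
bernoulli-rec : ∀ n → Tℚ 1ℚ bernoulli n ≡ bernoulli n ℚ.+ δ₁ n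
bernoulli-rec zero          = ≡.refl
bernoulli-rec (suc zero)    = ≡.refl
bernoulli-rec (suc (suc n)) = begin
  Tℚ 1ℚ bernoulli (suc (suc n))
    ≡⟨ T-explicit (suc (suc n)) 1ℚ bernoulli ⟩
  (Q.Σ< (suc n) t ℚ.+ t (suc n)) ℚ.+ t (suc (suc n))
    ≡⟨ ≡.cong₂ (λ x y → (x ℚ.+ t (suc n)) ℚ.+ y) (Q.Σ-cong (suc n) (λ k _ → t≡ k)) (≡.trans (t≡ (suc (suc n))) last-term) ⟩
  (s ℚ.+ t (suc n)) ℚ.+ bernoulli (suc (suc n))
    ≡⟨ ≡.cong (ℚ._+ bernoulli (suc (suc n))) cancel ⟩
  0ℚ ℚ.+ bernoulli (suc (suc n))
    ≡⟨ ℚₚ.+-comm 0ℚ (bernoulli (suc (suc n))) ⟩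
  bernoulli (suc (suc n)) ℚ.+ 0ℚ ∎
  where
  open ≡.≡-Reasoning
  t : ℕ → ℚ
  t k = Q.ι (suc (suc n) C k) ℚ.* (1ℚ Q.^ (suc (suc n) ℕ.∸ k) ℚ.* bernoulli k)
  s : ℚ
  s = Q.Σ< (suc n) (λ k → ℕtoℚ (suc (suc n) C k) ℚ.* bernoulli k)
  t≡ : ∀ k → t k ≡ ℕtoℚ (suc (suc n) C k) ℚ.* bernoulli k
  t≡ k = ≡.cong₂ ℚ._*_ (≡.sym (ℕtoℚ-ι (suc (suc n) C k)))
    (≡.trans (≡.cong (ℚ._* bernoulli k) (1^n (suc (suc n) ℕ.∸ k))) (ℚₚ.*-identityˡ (bernoulli k)))
  last-term : ℕtoℚ (suc (suc n) C suc (suc n)) ℚ.* bernoulli (suc (suc n)) ≡ bernoulli (suc (suc n))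
  last-term = ≡.trans (≡.cong (λ c → ℕtoℚ c ℚ.* bernoulli (suc (suc n))) (nCn≡1 (suc (suc n)))) (ℚₚ.*-identityˡ (bernoulli (suc (suc n))))
  C≡ : suc (suc n) C suc n ≡ suc (suc n)
  C≡ = ℕₚ.*-cancelˡ-≡ _ _ (suc n) (≡.trans ([1+k]*[1+n]C[1+k] (suc n) n)
    (≡.trans (≡.cong (suc (suc n) ℕ.*_) (C′ n)) (ℕₚ.*-comm (suc (suc n)) (suc n))))
    where
    C′ : ∀ n → suc n C n ≡ suc n
    C′ zero    = ≡.refl
    C′ (suc n) = ℕₚ.*-cancelˡ-≡ _ _ (suc n) (≡.trans ([1+k]*[1+n]C[1+k] (suc n) n)
      (≡.trans (≡.cong (suc (suc n) ℕ.*_) (C′ n)) (ℕₚ.*-comm (suc (suc n)) (suc n))))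
  cancel : s ℚ.+ t (suc n) ≡ 0ℚ
  cancel = begin
    s ℚ.+ t (suc n)
      ≡⟨ ≡.cong (s ℚ.+_) (≡.trans (t≡ (suc n)) (≡.cong₂ ℚ._*_ (≡.cong ℕtoℚ C≡) (bernoulli-suc n))) ⟩
    s ℚ.+ N ℚ.* (ℚ.- (recip (suc (suc n)) ℚ.* s))
      ≡⟨ Q.solve 3 (λ s N r → s Q.:+ N Q.:* (Q.:- (r Q.:* s)) Q.:= s Q.:- (r Q.:* N) Q.:* s) ≡.refl s N (recip (suc (suc n))) ⟩
    s ℚ.- (recip (suc (suc n)) ℚ.* N) ℚ.* s
      ≡⟨ ≡.cong (λ x → s ℚ.- x ℚ.* s) (recip-ℕtoℚ (suc n)) ⟩
    s ℚ.- 1ℚ ℚ.* s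
      ≡⟨ Q.solve 1 (λ s → s Q.:- Q.con (+ 1) Q.:* s Q.:= Q.con (+ 0)) ≡.refl s ⟩
    0ℚ ∎
    where
    N : ℚ
    N = ℕtoℚ (suc (suc n))

ι-suc-cancel : ∀ n {x} → Q.ι (suc n) ℚ.* x ≡ 0ℚ → x ≡ 0ℚ
ι-suc-cancel n {x} h = begin
  x                                        ≡⟨ ℚₚ.*-identityˡ x ⟨
  1ℚ ℚ.* x                                 ≡⟨ ≡.cong (ℚ._* x) (recip-ι n) ⟨
  (recip (suc n) ℚ.* Q.ι (suc n)) ℚ.* x    ≡⟨ ℚₚ.*-assoc (recip (suc n)) (Q.ι (suc n)) x ⟩
  recip (suc n) ℚ.* (Q.ι (suc n) ℚ.* x)    ≡⟨ ≡.cong (recip (suc n) ℚ.*_) h ⟩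
  recip (suc n) ℚ.* 0ℚ                     ≡⟨ ℚₚ.*-zeroʳ (recip (suc n)) ⟩
  0ℚ ∎
  where open ≡.≡-Reasoning

-- If a vanishes below n, the equation at n + 1 reads (n+1) a_n + a_(n+1) = a_(n+1). Applied to a
-- difference of two solutions, this shows that the Bernoulli recursion has only one.
T-fixed⇒0 : ∀ a → (∀ n → Tℚ 1ℚ a n ≡ a n) → ∀ n → a n ≡ 0ℚ
T-fixed⇒0 a h n = below n n ℕₚ.≤-refl
  where
  below : ∀ N n → n ℕ.≤ N → a n ≡ 0ℚ
  below N n n≤N = ι-suc-cancel n (Q.+-cancelʳ′ (a (suc n)) (≡.trans
    (≡.sym (T-low-suc n a (low N n n≤N))) (≡.trans (h (suc n)) (≡.sym (ℚₚ.+-identityˡ (a (suc n)))))))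
    where
    low : ∀ N n → n ℕ.≤ N → ∀ i → i ℕ.< n → a i ≡ 0ℚ
    low (suc N) n n≤N i i<n = below N i (ℕ.s≤s⁻¹ (ℕₚ.≤-trans i<n n≤N))
    low zero    n n≤N i i<n = contradiction (ℕₚ.≤-trans i<n n≤N) (λ ())

-- The sequence (-1)^n (B_n + δ_{n,1}) satisfies the recursion of the Bernoulli numbers.
bernoulli-reflect : ∀ n → (ℚ.- 1ℚ) Q.^ n ℚ.* (bernoulli n ℚ.+ δ₁ n) ≡ bernoulli n
bernoulli-reflect n = minus-cancel (T-fixed⇒0 D D-fixed n)
  where
  open ≡.≡-Reasoning
  S D : ℕ → ℚ
  S n = (ℚ.- 1ℚ) Q.^ n ℚ.* (bernoulli n ℚ.+ δ₁ n)
  D n = S n ℚ.+ ℚ.- 1ℚ ℚ.* bernoulli n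
  minus-cancel : ∀ {x y} → x ℚ.+ ℚ.- 1ℚ ℚ.* y ≡ 0ℚ → x ≡ y
  minus-cancel {x} {y} h = begin
    x                                  ≡⟨ Q.solve 2 (λ x y → x Q.:= (x Q.:+ (Q.:- Q.con (+ 1)) Q.:* y) Q.:+ y) ≡.refl x y ⟩
    (x ℚ.+ ℚ.- 1ℚ ℚ.* y) ℚ.+ y         ≡⟨ ≡.cong (ℚ._+ y) h ⟩
    0ℚ ℚ.+ y                           ≡⟨ ℚₚ.+-identityˡ y ⟩
    y ∎
  sign-δ₁ : ∀ n → (ℚ.- 1ℚ) Q.^ n ℚ.* δ₁ n ≡ ℚ.- δ₁ n
  sign-δ₁ zero          = ≡.refl
  sign-δ₁ (suc zero)    = ≡.refl
  sign-δ₁ (suc (suc n)) = ℚₚ.*-zeroʳ ((ℚ.- 1ℚ) Q.^ suc (suc n))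
  T-S : ∀ n → Tℚ 1ℚ S n ≡ S n ℚ.+ δ₁ n
  T-S n = begin
    Tℚ 1ℚ S n
      ≡⟨ T-neg n 1ℚ (λ i → bernoulli i ℚ.+ δ₁ i) ⟩
    (ℚ.- 1ℚ) Q.^ n ℚ.* Tℚ (ℚ.- 1ℚ) (λ i → bernoulli i ℚ.+ δ₁ i) n
      ≡⟨ ≡.cong ((ℚ.- 1ℚ) Q.^ n ℚ.*_) (≡.trans (T-cong n ≡.refl (λ i _ → ≡.sym (bernoulli-rec i)))
           (≡.trans (T-T n (ℚ.- 1ℚ) 1ℚ bernoulli) (T-0 n bernoulli))) ⟩
    (ℚ.- 1ℚ) Q.^ n ℚ.* bernoulli n
      ≡⟨ Q.solve 3 (λ s b d → s Q.:* b Q.:= s Q.:* (b Q.:+ d) Q.:- s Q.:* d) ≡.refl ((ℚ.- 1ℚ) Q.^ n) (bernoulli n) (δ₁ n) ⟩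
    S n ℚ.- (ℚ.- 1ℚ) Q.^ n ℚ.* δ₁ n
      ≡⟨ ≡.cong (λ x → S n ℚ.- x) (sign-δ₁ n) ⟩
    S n ℚ.- ℚ.- δ₁ n
      ≡⟨ Q.solve 2 (λ c d → c Q.:- Q.:- d Q.:= c Q.:+ d) ≡.refl (S n) (δ₁ n) ⟩
    S n ℚ.+ δ₁ n ∎
  D-fixed : ∀ n → Tℚ 1ℚ D n ≡ D n
  D-fixed n = begin
    Tℚ 1ℚ D n
      ≡⟨ T-+ n 1ℚ S (λ i → ℚ.- 1ℚ ℚ.* bernoulli i) ⟩
    Tℚ 1ℚ S n ℚ.+ Tℚ 1ℚ (λ i → ℚ.- 1ℚ ℚ.* bernoulli i) n
      ≡⟨ ≡.cong₂ ℚ._+_ (T-S n) (≡.trans (BinomialTransform.T-scale ℚₚ.+-*-commutativeRing n 1ℚ (ℚ.- 1ℚ) bernoulli)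
           (≡.cong (ℚ.- 1ℚ ℚ.*_) (bernoulli-rec n))) ⟩
    (S n ℚ.+ δ₁ n) ℚ.+ ℚ.- 1ℚ ℚ.* (bernoulli n ℚ.+ δ₁ n)
      ≡⟨ Q.solve 3 (λ c b d → (c Q.:+ d) Q.:+ (Q.:- Q.con (+ 1)) Q.:* (b Q.:+ d) Q.:= c Q.:+ (Q.:- Q.con (+ 1)) Q.:* b) ≡.refl (S n) (bernoulli n) (δ₁ n) ⟩
    D n ∎

-- From index 2 on `δ₁` vanishes, so for an odd index the reflection reads -B = B.
bernoulli-odd : ∀ n → (ℚ.- 1ℚ) Q.^ suc (suc n) ≡ ℚ.- 1ℚ → bernoulli (suc (suc n)) ≡ 0ℚ
bernoulli-odd n odd = ι-suc-cancel 1 (begin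
  Q.ι 2 ℚ.* b                     ≡⟨ Q.solve 1 (λ b → (Q.con (+ 1) Q.:+ (Q.con (+ 1) Q.:+ Q.con (+ 0))) Q.:* b Q.:= b Q.:- (Q.:- Q.con (+ 1)) Q.:* (b Q.:+ Q.con (+ 0))) ≡.refl b ⟩
  b ℚ.- (ℚ.- 1ℚ) ℚ.* (b ℚ.+ 0ℚ)   ≡⟨ ≡.cong (λ s → b ℚ.- s ℚ.* (b ℚ.+ 0ℚ)) (≡.sym odd) ⟩
  b ℚ.- (ℚ.- 1ℚ) Q.^ suc (suc n) ℚ.* (b ℚ.+ 0ℚ) ≡⟨ ≡.cong (λ x → b ℚ.- x) (bernoulli-reflect (suc (suc n))) ⟩
  b ℚ.- b                         ≡⟨ ℚₚ.+-inverseʳ b ⟩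
  0ℚ ∎)
  where
  open ≡.≡-Reasoning
  b : ℚ
  b = bernoulli (suc (suc n))

-- The right-hand side as a sum of iterated sums

module _ (p : ℕ) where
  open ≡.≡-Reasoning

  -- The coefficient of y^k t^a in y ∂H/∂y. Words have positive k only; the value 0 at k = 0 makes
  -- this series start at y.
  letter : ℕ → ℕ → ℚ
  letter zero    a = 0ℚ
  letter (suc k) a = if oddGe3 a then factor p (suc k) a else 0ℚ

  -- The product includes the complete sum, which for s = 0 is m: this is where the factor 1/m of
  -- the theorem goes.
  partialSumWeight : ℕ → List ℕ → ℚ
  partialSumWeight s []       = 1ℚ
  partialSumWeight s (k ∷ ks) = recip (s ℕ.+ k) ℚ.* partialSumWeight (s ℕ.+ k) ks

  initPartialSums-weight : ∀ s k ks →
    prodℚ (map recip (initPartialSums (s ℕ.+ k ∷ ks))) ℚ.* recip (s ℕ.+ k ℕ.+ sum ks) ≡ partialSumWeight s (k ∷ ks)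
  initPartialSums-weight s k []            = begin
    1ℚ ℚ.* recip (s ℕ.+ k ℕ.+ 0)    ≡⟨ ℚₚ.*-identityˡ (recip (s ℕ.+ k ℕ.+ 0)) ⟩
    recip (s ℕ.+ k ℕ.+ 0)           ≡⟨ ≡.cong recip (ℕₚ.+-identityʳ (s ℕ.+ k)) ⟩
    recip (s ℕ.+ k)                 ≡⟨ ℚₚ.*-identityʳ (recip (s ℕ.+ k)) ⟨
    recip (s ℕ.+ k) ℚ.* 1ℚ ∎
  initPartialSums-weight s k (k′ ∷ ks) = begin
    prodℚ (map recip (initPartialSums (s ℕ.+ k ∷ k′ ∷ ks))) ℚ.* recip (s ℕ.+ k ℕ.+ (k′ ℕ.+ sum ks))
      ≡⟨ ≡.cong₂ (λ l n → prodℚ (map recip l) ℚ.* recip n) (merge (s ℕ.+ k) k′ ks) (≡.sym (ℕₚ.+-assoc (s ℕ.+ k) k′ (sum ks))) ⟩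
    recip (s ℕ.+ k) ℚ.* prodℚ (map recip (initPartialSums (s ℕ.+ k ℕ.+ k′ ∷ ks))) ℚ.* recip (s ℕ.+ k ℕ.+ k′ ℕ.+ sum ks)
      ≡⟨ ℚₚ.*-assoc (recip (s ℕ.+ k)) (prodℚ (map recip (initPartialSums (s ℕ.+ k ℕ.+ k′ ∷ ks)))) (recip (s ℕ.+ k ℕ.+ k′ ℕ.+ sum ks)) ⟩
    recip (s ℕ.+ k) ℚ.* (prodℚ (map recip (initPartialSums (s ℕ.+ k ℕ.+ k′ ∷ ks))) ℚ.* recip (s ℕ.+ k ℕ.+ k′ ℕ.+ sum ks))
      ≡⟨ ≡.cong (recip (s ℕ.+ k) ℚ.*_) (initPartialSums-weight (s ℕ.+ k) k′ ks) ⟩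
    recip (s ℕ.+ k) ℚ.* partialSumWeight (s ℕ.+ k) (k′ ∷ ks) ∎
    where
    -- Adding x to the next entry has the same effect as carrying x in the accumulator of
    -- `initPartialSums`.
    merge : ∀ x y zs → initPartialSums (x ∷ y ∷ zs) ≡ x ∷ initPartialSums (x ℕ.+ y ∷ zs)
    merge x y []       = ≡.refl
    merge x y (z ∷ zs) = ≡.refl

  wordWeight : ℕ → List ℕ → List ℕ → ℚ
  wordWeight s ks as = if allB oddGe3 as then partialSumWeight s ks ℚ.* prodℚ (zipWith (factor p) ks as) else 0ℚ

  wordWeight-∷ : ∀ s k ks a as →
    wordWeight s (suc k ∷ ks) (a ∷ as) ≡ recip (s ℕ.+ suc k) ℚ.* (letter (suc k) a ℚ.* wordWeight (s ℕ.+ suc k) ks as)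
  wordWeight-∷ s k ks a as with oddGe3 a | allB oddGe3 as
  ... | true  | true  = Q.solve 4 (λ r w f x → (r Q.:* w) Q.:* (f Q.:* x) Q.:= r Q.:* (f Q.:* (w Q.:* x))) ≡.refl
    (recip (s ℕ.+ suc k)) (partialSumWeight (s ℕ.+ suc k) ks) (factor p (suc k) a) (prodℚ (zipWith (factor p) ks as))
  ... | true  | false = Q.solve 2 (λ r f → Q.con (+ 0) Q.:= r Q.:* (f Q.:* Q.con (+ 0))) ≡.refl (recip (s ℕ.+ suc k)) (factor p (suc k) a)
  ... | false | true  = Q.solve 2 (λ r x → Q.con (+ 0) Q.:= r Q.:* (Q.con (+ 0) Q.:* x)) ≡.refl (recip (s ℕ.+ suc k)) (partialSumWeight (s ℕ.+ suc k) ks ℚ.* prodℚ (zipWith (factor p) ks as))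
  ... | false | false = Q.solve 1 (λ r → Q.con (+ 0) Q.:= r Q.:* (Q.con (+ 0) Q.:* Q.con (+ 0))) ≡.refl (recip (s ℕ.+ suc k))

  wordSum : ℕ → ℕ → ℕ → ℕ → ℚ
  wordSum ℓ s m n = sumOver (λ ks → sumOver (wordWeight s ks) (compositions ℓ n)) (compositions ℓ m)

  wordSum-suc : ∀ ℓ s m n → wordSum (suc ℓ) s m n ≡
    Q.Σ< m (λ i → Q.Σ< n (λ j → recip (s ℕ.+ suc i) ℚ.* (letter (suc i) (suc j) ℚ.* wordSum ℓ (s ℕ.+ suc i) (m ℕ.∸ suc i) (n ℕ.∸ suc j))))
  wordSum-suc ℓ s m n = ≡.trans (sumOver-compositions (λ ks → sumOver (wordWeight s ks) (compositions (suc ℓ) n)) ℓ m)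
    (Q.Σ-cong m (λ i _ → ≡.trans
      (sumOver-cong (λ ks → sumOver-compositions (wordWeight s (suc i ∷ ks)) ℓ n) (compositions ℓ (m ℕ.∸ suc i)))
      (≡.trans (sumOver-Σ n (λ ks j → sumOver (λ as → wordWeight s (suc i ∷ ks) (suc j ∷ as)) (compositions ℓ (n ℕ.∸ suc j))) (compositions ℓ (m ℕ.∸ suc i)))
        (Q.Σ-cong n (λ j _ → ≡.trans (sumOver-cong (inner i j) (compositions ℓ (m ℕ.∸ suc i))) (outer i j))))))
    where
    c : ℕ → ℚ
    c i = recip (s ℕ.+ suc i)
    inner : ∀ i j ks → sumOver (λ as → wordWeight s (suc i ∷ ks) (suc j ∷ as)) (compositions ℓ (n ℕ.∸ suc j)) ≡
      c i ℚ.* (letter (suc i) (suc j) ℚ.* sumOver (wordWeight (s ℕ.+ suc i) ks) (compositions ℓ (n ℕ.∸ suc j)))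
    inner i j ks = ≡.trans (sumOver-cong (wordWeight-∷ s i ks (suc j)) as)
      (≡.trans (sumOver-*ˡ (c i) (λ xs → letter (suc i) (suc j) ℚ.* wordWeight (s ℕ.+ suc i) ks xs) as)
        (≡.cong (c i ℚ.*_) (sumOver-*ˡ (letter (suc i) (suc j)) (wordWeight (s ℕ.+ suc i) ks) as)))
      where as = compositions ℓ (n ℕ.∸ suc j)
    outer : ∀ i j → sumOver (λ ks → c i ℚ.* (letter (suc i) (suc j) ℚ.* sumOver (wordWeight (s ℕ.+ suc i) ks) (compositions ℓ (n ℕ.∸ suc j)))) (compositions ℓ (m ℕ.∸ suc i)) ≡
      c i ℚ.* (letter (suc i) (suc j) ℚ.* wordSum ℓ (s ℕ.+ suc i) (m ℕ.∸ suc i) (n ℕ.∸ suc j))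
    outer i j = ≡.trans (sumOver-*ˡ (c i) (λ ks → letter (suc i) (suc j) ℚ.* F ks) xs)
      (≡.cong (c i ℚ.*_) (sumOver-*ˡ (letter (suc i) (suc j)) F xs))
      where
      xs = compositions ℓ (m ℕ.∸ suc i)
      F : List ℕ → ℚ
      F ks = sumOver (wordWeight (s ℕ.+ suc i) ks) (compositions ℓ (n ℕ.∸ suc j))

  oddGe3⇒3≤ : ∀ a → oddGe3 a ≡ true → 3 ℕ.≤ a
  oddGe3⇒3≤ (suc (suc (suc a))) _ = ℕ.s≤s (ℕ.s≤s (ℕ.s≤s ℕ.z≤n))

  sumOver-oddGe3 : ∀ ℓ n (h : List ℕ → ℚ) → n ℕ.< ℓ ℕ.* 3 →
    sumOver (λ as → if allB oddGe3 as then h as else 0ℚ) (compositions ℓ n) ≡ 0ℚ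
  sumOver-oddGe3 (suc ℓ) n h n<3ℓ = ≡.trans (sumOver-compositions _ ℓ n) (Q.Σ-zero n (λ j j<n → go j j<n))
    where
    go : ∀ j → j ℕ.< n → sumOver (λ as → if oddGe3 (suc j) ∧ allB oddGe3 as then h (suc j ∷ as) else 0ℚ) (compositions ℓ (n ℕ.∸ suc j)) ≡ 0ℚ
    go j j<n with oddGe3 (suc j) in eq
    ... | false = sumOver-0 (compositions ℓ (n ℕ.∸ suc j))
    ... | true  = sumOver-oddGe3 ℓ (n ℕ.∸ suc j) (h ∘ (suc j ∷_))
      (ℕₚ.≤-<-trans (ℕₚ.∸-monoʳ-≤ n (oddGe3⇒3≤ (suc j) eq)) (ℕₚ.+-cancelˡ-< 3 _ _
        (ℕₚ.≤-<-trans (ℕₚ.≤-reflexive (ℕₚ.m+[n∸m]≡n (ℕₚ.≤-trans (oddGe3⇒3≤ (suc j) eq) j<n))) n<3ℓ)))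

  -- Every letter has a ≥ 3, so a word of length ℓ has t-degree at least 3ℓ. This bounds ℓ by n/3
  -- and supplies `Y-top`.
  wordSum-zero : ∀ ℓ s m n → n ℕ.< ℓ ℕ.* 3 → wordSum ℓ s m n ≡ 0ℚ
  wordSum-zero ℓ s m n h = ≡.trans
    (sumOver-cong (λ ks → sumOver-oddGe3 ℓ n (λ as → partialSumWeight s ks ℚ.* prodℚ (zipWith (factor p) ks as)) h) (compositions ℓ m))
    (sumOver-0 (compositions ℓ m))

  letter-0 : ∀ k → letter k 0 ≡ 0ℚ
  letter-0 zero    = ≡.refl
  letter-0 (suc k) = ≡.refl

  module _ (b : ℕ) where
    private
      module T = TruncatedSeries ℚₚ.+-*-commutativeRing b
      module TR = RingTools T.T

    word-sums : IteratedSums ℚₚ.+-*-commutativeRing ℚ-reciprocals b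
    word-sums = record
      { G       = letter
      ; G-0     = T.≋-intro λ _ _ → ≡.refl
      ; Y       = wordSum
      ; Y-0-0   = λ s → T.≋-intro λ { zero _ → ≡.refl ; (suc n) _ → ≡.refl }
      ; Y-0-suc = λ s m → T.≋-intro λ _ _ → ≡.refl
      ; Y-suc   = λ ℓ s m → T.≋-intro λ n _ → Y-suc ℓ s m n
      ; Y-top   = λ s m → T.≋-intro λ n n≤b → wordSum-zero (suc b) s m n
          (ℕₚ.≤-<-trans n≤b (ℕₚ.<-≤-trans (ℕₚ.n<1+n b) (ℕₚ.m≤m*n (suc b) 3)))
      }
      where
      Y-suc : ∀ ℓ s m n → wordSum (suc ℓ) s m n ≡
        TR.Σ< m (λ i → T.const (recip (s ℕ.+ suc i)) T.*ˢ (letter (suc i) T.*ˢ wordSum ℓ (s ℕ.+ suc i) (m ℕ.∸ suc i))) n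
      Y-suc ℓ s m n = ≡.trans (wordSum-suc ℓ s m n) (≡.sym (≡.trans (T.Σ-at m _ n) (Q.Σ-cong m (λ i _ → ≡.trans
        (T.conv-const n (recip (s ℕ.+ suc i)) (letter (suc i) T.*ˢ wordSum ℓ (s ℕ.+ suc i) (m ℕ.∸ suc i)))
        (≡.trans (≡.cong (recip (s ℕ.+ suc i) ℚ.*_) (conv-Σ⁺ n (letter (suc i)) (wordSum ℓ (s ℕ.+ suc i) (m ℕ.∸ suc i)) (letter-0 (suc i))))
          (Q.Σ-*ˡ n (recip (s ℕ.+ suc i)) _))))))

  -- The factor 1/m becomes the reciprocal of the last partial sum. The range of ℓ grows to 0, ...,
  -- n by zeros only: the empty word has weight 0 ≠ m, and lengths above n/3 need degree greater
  -- than n.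
  RHS≡wordSums : ∀ n m → 1 ℕ.≤ m → RHS n m p ≡ ℕtoℚ (n !) ℚ.* Q.Σ< (suc n) (λ ℓ → wordSum ℓ 0 m n)
  RHS≡wordSums n m@(suc _) 1≤m = begin
    RHS n m p
      ≡⟨ ≡.cong (ℕtoℚ (n !) ℚ.* recip m ℚ.*_) expand ⟩
    ℕtoℚ (n !) ℚ.* recip m ℚ.* Q.Σ< (n / 3) (λ i → plain (suc i))
      ≡⟨ ℚₚ.*-assoc (ℕtoℚ (n !)) (recip m) (Q.Σ< (n / 3) (λ i → plain (suc i))) ⟩
    ℕtoℚ (n !) ℚ.* (recip m ℚ.* Q.Σ< (n / 3) (λ i → plain (suc i)))
      ≡⟨ ≡.cong (ℕtoℚ (n !) ℚ.*_) (≡.trans (Q.Σ-*ˡ (n / 3) (recip m) (λ i → plain (suc i))) (Q.Σ-cong (n / 3) (λ i _ → recip-plain (suc i)))) ⟩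
    ℕtoℚ (n !) ℚ.* Q.Σ< (n / 3) (λ i → wordSum (suc i) 0 m n)
      ≡⟨ ≡.cong (ℕtoℚ (n !) ℚ.*_) (≡.sym extend) ⟩
    ℕtoℚ (n !) ℚ.* Q.Σ< (suc n) (λ ℓ → wordSum ℓ 0 m n) ∎
    where
    word : List ℕ → List ℕ → ℚ
    word ks as = prodℚ (map recip (initPartialSums ks)) ℚ.* prodℚ (zipWith (factor p) ks as)
    plain : ℕ → ℚ
    plain ℓ = sumOver (λ ks → sumOver (λ as → if allB oddGe3 as then word ks as else 0ℚ) (compositions ℓ n)) (compositions ℓ m)

    sumℚ≡sumOver : ∀ xs → sumℚ xs ≡ sumOver id xs
    sumℚ≡sumOver xs = ≡.cong sumℚ (≡.sym (map-id xs))

    words : ℕ → List ℕ → List ℚ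
    words ℓ ks = map (word ks) (oddComps ℓ n)

    expand : sumℚ (concatMap (λ ℓ → concatMap (words ℓ) (compositions ℓ m)) (map suc (upTo (n / 3)))) ≡ Q.Σ< (n / 3) (λ i → plain (suc i))
    expand = begin
      sumℚ (concatMap (λ ℓ → concatMap (words ℓ) (compositions ℓ m)) (map suc (upTo (n / 3))))
        ≡⟨ sumℚ≡sumOver (concatMap (λ ℓ → concatMap (words ℓ) (compositions ℓ m)) (map suc (upTo (n / 3)))) ⟩
      sumOver id (concatMap (λ ℓ → concatMap (words ℓ) (compositions ℓ m)) (map suc (upTo (n / 3))))
        ≡⟨ sumOver-concatMap id (λ ℓ → concatMap (words ℓ) (compositions ℓ m)) (map suc (upTo (n / 3))) ⟩
      sumOver (λ ℓ → sumOver id (concatMap (words ℓ) (compositions ℓ m))) (map suc (upTo (n / 3)))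
        ≡⟨ sumOver-cong (λ ℓ → ≡.trans (sumOver-concatMap id (words ℓ) (compositions ℓ m)) (sumOver-cong (λ ks →
             ≡.trans (sumOver-map id (word ks) (oddComps ℓ n)) (sumOver-filter (allB oddGe3) (word ks) (compositions ℓ n))) (compositions ℓ m)))
             (map suc (upTo (n / 3))) ⟩
      sumOver plain (map suc (upTo (n / 3)))
        ≡⟨ sumOver-1⋯n plain (n / 3) ⟩
      Q.Σ< (n / 3) (λ i → plain (suc i)) ∎

    recip-plain : ∀ ℓ → recip m ℚ.* plain ℓ ≡ wordSum ℓ 0 m n
    recip-plain ℓ = ≡.trans (≡.sym (sumOver-*ˡ (recip m) _ (compositions ℓ m))) (sumOver-compositions-cong _ _ ℓ m pointwise)
      where
      pointwise : ∀ ks → sum ks ≡ m →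
        recip m ℚ.* sumOver (λ as → if allB oddGe3 as then word ks as else 0ℚ) (compositions ℓ n) ≡ sumOver (wordWeight 0 ks) (compositions ℓ n)
      pointwise (k ∷ ks) e = ≡.trans (≡.sym (sumOver-*ˡ (recip m) _ (compositions ℓ n))) (sumOver-cong weights (compositions ℓ n))
        where
        weights : ∀ as → recip m ℚ.* (if allB oddGe3 as then word (k ∷ ks) as else 0ℚ) ≡ wordWeight 0 (k ∷ ks) as
        weights as with allB oddGe3 as
        ... | false = ℚₚ.*-zeroʳ (recip m)
        ... | true  = begin
          recip m ℚ.* (u ℚ.* z)
            ≡⟨ ≡.cong (λ x → recip x ℚ.* (u ℚ.* z)) (≡.sym e) ⟩
          recip (k ℕ.+ sum ks) ℚ.* (u ℚ.* z)
            ≡⟨ Q.solve 3 (λ r u z → r Q.:* (u Q.:* z) Q.:= (u Q.:* r) Q.:* z) ≡.refl (recip (k ℕ.+ sum ks)) u z ⟩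
          (u ℚ.* recip (k ℕ.+ sum ks)) ℚ.* z
            ≡⟨ ≡.cong (ℚ._* z) (initPartialSums-weight 0 k ks) ⟩
          partialSumWeight 0 (k ∷ ks) ℚ.* z ∎
          where
          u z : ℚ
          u = prodℚ (map recip (initPartialSums (k ∷ ks)))
          z = prodℚ (zipWith (factor p) (k ∷ ks) as)

    extend : Q.Σ< (suc n) (λ ℓ → wordSum ℓ 0 m n) ≡ Q.Σ< (n / 3) (λ i → wordSum (suc i) 0 m n)
    extend = begin
      Q.Σ< (suc n) (λ ℓ → wordSum ℓ 0 m n)
        ≡⟨ Q.Σ-head n (λ ℓ → wordSum ℓ 0 m n) ⟩
      0ℚ ℚ.+ Q.Σ< n f
        ≡⟨ ℚₚ.+-identityˡ (Q.Σ< n f) ⟩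
      Q.Σ< n f
        ≡⟨ ≡.cong (λ k → Q.Σ< k f) (≡.sym (ℕₚ.m+[n∸m]≡n (m/n≤m n 3))) ⟩
      Q.Σ< (n / 3 ℕ.+ (n ℕ.∸ n / 3)) f
        ≡⟨ Q.Σ-split (n / 3) (n ℕ.∸ n / 3) f ⟩
      Q.Σ< (n / 3) f ℚ.+ Q.Σ< (n ℕ.∸ n / 3) (λ i → f (n / 3 ℕ.+ i))
        ≡⟨ ≡.cong (Q.Σ< (n / 3) f ℚ.+_) (Q.Σ-zero (n ℕ.∸ n / 3) (λ i _ → wordSum-zero (suc (n / 3 ℕ.+ i)) 0 m n (long i))) ⟩
      Q.Σ< (n / 3) f ℚ.+ 0ℚ
        ≡⟨ ℚₚ.+-identityʳ (Q.Σ< (n / 3) f) ⟩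
      Q.Σ< (n / 3) f ∎
      where
      f : ℕ → ℚ
      f i = wordSum (suc i) 0 m n
      long : ∀ i → n ℕ.< suc (n / 3 ℕ.+ i) ℕ.* 3
      long i = ℕₚ.≤-<-trans (ℕₚ.≤-reflexive (m≡m%n+[m/n]*n n 3))
        (ℕₚ.+-mono-<-≤ (m%n<n n 3) (ℕₚ.*-monoˡ-≤ 3 (ℕₚ.m≤m+n (n / 3) i)))

-- Rationals integral at p, modulo p

module Localization (p : ℕ) (p-prime : Prime p) where
  record Integral (x : ℚ) : Set where
    constructor integral
    field
      den  : ℕ
      num  : ℤ
      p∤d  : ¬ p ∣ den
      x*d≡ : x ℚ.* ℕtoℚ den ≡ ℤtoℚ num

  record InMaximalIdeal (x : ℚ) : Set where
    constructor inIdeal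
    field
      den  : ℕ
      num  : ℤ
      p∤d  : ¬ p ∣ den
      x*d≡ : x ℚ.* ℕtoℚ den ≡ ℤtoℚ (+ p ℤ.* num)

  p∤1 : ¬ p ∣ 1
  p∤1 h with ∣1⇒≡1 h
  ... | ≡.refl = ¬prime[1] p-prime

  p∤* : ∀ {d d′} → ¬ p ∣ d → ¬ p ∣ d′ → ¬ p ∣ d ℕ.* d′
  p∤* {d} {d′} h h′ dd′ with euclidsLemma d d′ p-prime dd′
  ... | inj₁ x = h x
  ... | inj₂ x = h′ x

  private
    +-common : ∀ x y d d′ c c′ → x ℚ.* ℕtoℚ d ≡ ℤtoℚ c → y ℚ.* ℕtoℚ d′ ≡ ℤtoℚ c′ →
      (x ℚ.+ y) ℚ.* ℕtoℚ (d ℕ.* d′) ≡ ℤtoℚ (c ℤ.* + d′ ℤ.+ c′ ℤ.* + d)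
    +-common x y d d′ c c′ e e′ = begin
      (x ℚ.+ y) ℚ.* ℕtoℚ (d ℕ.* d′)
        ≡⟨ ≡.cong ((x ℚ.+ y) ℚ.*_) (≡.trans (≡.cong ℤtoℚ (ℤₚ.pos-* d d′)) (ℤtoℚ-* (+ d) (+ d′))) ⟩
      (x ℚ.+ y) ℚ.* (ℕtoℚ d ℚ.* ℕtoℚ d′)
        ≡⟨ Q.solve 4 (λ x y d d′ → (x Q.:+ y) Q.:* (d Q.:* d′) Q.:= (x Q.:* d) Q.:* d′ Q.:+ (y Q.:* d′) Q.:* d) ≡.refl x y (ℕtoℚ d) (ℕtoℚ d′) ⟩
      (x ℚ.* ℕtoℚ d) ℚ.* ℕtoℚ d′ ℚ.+ (y ℚ.* ℕtoℚ d′) ℚ.* ℕtoℚ d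
        ≡⟨ ≡.cong₂ (λ a b → a ℚ.* ℕtoℚ d′ ℚ.+ b ℚ.* ℕtoℚ d) e e′ ⟩
      ℤtoℚ c ℚ.* ℕtoℚ d′ ℚ.+ ℤtoℚ c′ ℚ.* ℕtoℚ d
        ≡⟨ ≡.cong₂ ℚ._+_ (≡.sym (ℤtoℚ-* c (+ d′))) (≡.sym (ℤtoℚ-* c′ (+ d))) ⟩
      ℤtoℚ (c ℤ.* + d′) ℚ.+ ℤtoℚ (c′ ℤ.* + d)
        ≡⟨ ℤtoℚ-+ (c ℤ.* + d′) (c′ ℤ.* + d) ⟨
      ℤtoℚ (c ℤ.* + d′ ℤ.+ c′ ℤ.* + d) ∎
      where open ≡.≡-Reasoning

    *-common : ∀ x y d d′ c c′ → x ℚ.* ℕtoℚ d ≡ ℤtoℚ c → y ℚ.* ℕtoℚ d′ ≡ ℤtoℚ c′ →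
      (x ℚ.* y) ℚ.* ℕtoℚ (d ℕ.* d′) ≡ ℤtoℚ (c ℤ.* c′)
    *-common x y d d′ c c′ e e′ = begin
      (x ℚ.* y) ℚ.* ℕtoℚ (d ℕ.* d′)
        ≡⟨ ≡.cong ((x ℚ.* y) ℚ.*_) (≡.trans (≡.cong ℤtoℚ (ℤₚ.pos-* d d′)) (ℤtoℚ-* (+ d) (+ d′))) ⟩
      (x ℚ.* y) ℚ.* (ℕtoℚ d ℚ.* ℕtoℚ d′)
        ≡⟨ Q.solve 4 (λ x y d d′ → (x Q.:* y) Q.:* (d Q.:* d′) Q.:= (x Q.:* d) Q.:* (y Q.:* d′)) ≡.refl x y (ℕtoℚ d) (ℕtoℚ d′) ⟩
      (x ℚ.* ℕtoℚ d) ℚ.* (y ℚ.* ℕtoℚ d′)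
        ≡⟨ ≡.cong₂ ℚ._*_ e e′ ⟩
      ℤtoℚ c ℚ.* ℤtoℚ c′
        ≡⟨ ℤtoℚ-* c c′ ⟨
      ℤtoℚ (c ℤ.* c′) ∎
      where open ≡.≡-Reasoning

  integral-+ : ∀ {x y} → Integral x → Integral y → Integral (x ℚ.+ y)
  integral-+ {x} {y} (integral d c h e) (integral d′ c′ h′ e′) =
    integral (d ℕ.* d′) (c ℤ.* + d′ ℤ.+ c′ ℤ.* + d) (p∤* h h′) (+-common x y d d′ c c′ e e′)

  integral-* : ∀ {x y} → Integral x → Integral y → Integral (x ℚ.* y)
  integral-* {x} {y} (integral d c h e) (integral d′ c′ h′ e′) =
    integral (d ℕ.* d′) (c ℤ.* c′) (p∤* h h′) (*-common x y d d′ c c′ e e′)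

  ideal-+ : ∀ {x y} → InMaximalIdeal x → InMaximalIdeal y → InMaximalIdeal (x ℚ.+ y)
  ideal-+ {x} {y} (inIdeal d c h e) (inIdeal d′ c′ h′ e′) =
    inIdeal (d ℕ.* d′) (c ℤ.* + d′ ℤ.+ c′ ℤ.* + d) (p∤* h h′) (≡.trans (+-common x y d d′ (+ p ℤ.* c) (+ p ℤ.* c′) e e′)
      (≡.cong ℤtoℚ (≡.trans (≡.cong₂ ℤ._+_ (ℤₚ.*-assoc (+ p) c (+ d′)) (ℤₚ.*-assoc (+ p) c′ (+ d)))
        (≡.sym (ℤₚ.*-distribˡ-+ (+ p) (c ℤ.* + d′) (c′ ℤ.* + d))))))

  ideal-* : ∀ {x y} → InMaximalIdeal x → Integral y → InMaximalIdeal (x ℚ.* y)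
  ideal-* {x} {y} (inIdeal d c h e) (integral d′ c′ h′ e′) =
    inIdeal (d ℕ.* d′) (c ℤ.* c′) (p∤* h h′) (≡.trans (*-common x y d d′ (+ p ℤ.* c) c′ e e′) (≡.cong ℤtoℚ (ℤₚ.*-assoc (+ p) c c′)))

  integral-ℤ : ∀ i → Integral (ℤtoℚ i)
  integral-ℤ i = integral 1 i p∤1 (ℚₚ.*-identityʳ (ℤtoℚ i))

  integral-neg : ∀ {x} → Integral x → Integral (ℚ.- x)
  integral-neg {x} h = ≡.subst Integral (Q.solve 1 (λ x → (Q.:- Q.con (+ 1)) Q.:* x Q.:= Q.:- x) ≡.refl x)
    (integral-* (integral-ℤ -[1+ 0 ]) h)

  integral-recip : ∀ k → ¬ p ∣ suc k → Integral (recip (suc k))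
  integral-recip k h = integral (suc k) (+ 1) h (recip-ℕtoℚ k)

  ideal-0 : InMaximalIdeal 0ℚ
  ideal-0 = inIdeal 1 (+ 0) p∤1 (≡.cong ℤtoℚ (≡.sym (ℤₚ.*-zeroʳ (+ p))))

  ideal-neg : ∀ {x} → InMaximalIdeal x → InMaximalIdeal (ℚ.- x)
  ideal-neg {x} h = ≡.subst InMaximalIdeal (Q.solve 1 (λ x → x Q.:* (Q.:- Q.con (+ 1)) Q.:= Q.:- x) ≡.refl x)
    (ideal-* h (integral-ℤ -[1+ 0 ]))

  -- Clearing both denominators, the reduced numerator times `den` is a multiple of p, and p is
  -- prime to `den`.
  ideal⇒p∣numerator : ∀ x → InMaximalIdeal x → p ∣ ℤ.∣ ↥ x ∣
  ideal⇒p∣numerator x (inIdeal d c p∤d e) = strip (euclidsLemma ℤ.∣ ↥ x ∣ d p-prime (divides ℤ.∣ c ℤ.* + ↧ₙ x ∣ multiple))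
    where
    open ≡.≡-Reasoning
    strip : p ∣ ℤ.∣ ↥ x ∣ ⊎ p ∣ d → p ∣ ℤ.∣ ↥ x ∣
    strip (inj₁ h) = h
    strip (inj₂ h) = contradiction h p∤d
    cleared : ↥ x ℤ.* + d ≡ + p ℤ.* (c ℤ.* + ↧ₙ x)
    cleared = ℤtoℚ-injective (begin
      ℤtoℚ (↥ x ℤ.* + d)                    ≡⟨ ℤtoℚ-* (↥ x) (+ d) ⟩
      ℤtoℚ (↥ x) ℚ.* ℕtoℚ d                 ≡⟨ ≡.cong (ℚ._* ℕtoℚ d) (↥-↧ x) ⟨
      x ℚ.* ℕtoℚ (↧ₙ x) ℚ.* ℕtoℚ d          ≡⟨ Q.solve 3 (λ x a b → x Q.:* a Q.:* b Q.:= (x Q.:* b) Q.:* a) ≡.refl x (ℕtoℚ (↧ₙ x)) (ℕtoℚ d) ⟩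
      (x ℚ.* ℕtoℚ d) ℚ.* ℕtoℚ (↧ₙ x)        ≡⟨ ≡.cong (ℚ._* ℕtoℚ (↧ₙ x)) e ⟩
      ℤtoℚ (+ p ℤ.* c) ℚ.* ℕtoℚ (↧ₙ x)      ≡⟨ ℤtoℚ-* (+ p ℤ.* c) (+ ↧ₙ x) ⟨
      ℤtoℚ (+ p ℤ.* c ℤ.* + ↧ₙ x)           ≡⟨ ≡.cong ℤtoℚ (ℤₚ.*-assoc (+ p) c (+ ↧ₙ x)) ⟩
      ℤtoℚ (+ p ℤ.* (c ℤ.* + ↧ₙ x)) ∎)
    multiple : ℤ.∣ ↥ x ∣ ℕ.* d ≡ ℤ.∣ c ℤ.* + ↧ₙ x ∣ ℕ.* p
    multiple = begin
      ℤ.∣ ↥ x ∣ ℕ.* d                     ≡⟨ ℤₚ.abs-* (↥ x) (+ d) ⟨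
      ℤ.∣ ↥ x ℤ.* + d ∣                   ≡⟨ ≡.cong ℤ.∣_∣ cleared ⟩
      ℤ.∣ + p ℤ.* (c ℤ.* + ↧ₙ x) ∣        ≡⟨ ℤₚ.abs-* (+ p) (c ℤ.* + ↧ₙ x) ⟩
      p ℕ.* ℤ.∣ c ℤ.* + ↧ₙ x ∣            ≡⟨ ℕₚ.*-comm p ℤ.∣ c ℤ.* + ↧ₙ x ∣ ⟩
      ℤ.∣ c ℤ.* + ↧ₙ x ∣ ℕ.* p            ∎

  record ℤ₍ₚ₎ : Set where
    constructor _,_
    field
      value      : ℚ
      isIntegral : Integral value
  open ℤ₍ₚ₎ public

  infix 4 _≈ₚ_
  record _≈ₚ_ (x y : ℤ₍ₚ₎) : Set where
    constructor difference
    field difference-ideal : InMaximalIdeal (value x ℚ.- value y)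
  open _≈ₚ_ public

  value⇒≈ : ∀ {x y} → value x ≡ value y → x ≈ₚ y
  value⇒≈ {x} {y} e = difference (≡.subst InMaximalIdeal (≡.sym (≡.trans (≡.cong (ℚ._- value y) e) (ℚₚ.+-inverseʳ (value y)))) ideal-0)

  infixl 6 _+ᴷ_
  infixl 7 _*ᴷ_

  -- Unfolding the arithmetic of ℚ is prohibitively slow.
  abstract
    _+ᴷ_ _*ᴷ_ : ℤ₍ₚ₎ → ℤ₍ₚ₎ → ℤ₍ₚ₎
    x +ᴷ y = value x ℚ.+ value y , integral-+ (isIntegral x) (isIntegral y)
    x *ᴷ y = value x ℚ.* value y , integral-* (isIntegral x) (isIntegral y)

    -ᴷ_ : ℤ₍ₚ₎ → ℤ₍ₚ₎
    -ᴷ x = ℚ.- value x , integral-neg (isIntegral x)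

    0ᴷ 1ᴷ : ℤ₍ₚ₎
    0ᴷ = 0ℚ , integral-ℤ (+ 0)
    1ᴷ = 1ℚ , integral-ℤ (+ 1)

    value-+ : ∀ x y → value (x +ᴷ y) ≡ value x ℚ.+ value y
    value-+ x y = ≡.refl

    value-* : ∀ x y → value (x *ᴷ y) ≡ value x ℚ.* value y
    value-* x y = ≡.refl

    value-neg : ∀ x → value (-ᴷ x) ≡ ℚ.- value x
    value-neg x = ≡.refl

    value-0 : value 0ᴷ ≡ 0ℚ
    value-0 = ≡.refl

    value-1 : value 1ᴷ ≡ 1ℚ
    value-1 = ≡.refl

    isCommutativeRingᴷ : IsCommutativeRing _≈ₚ_ _+ᴷ_ _*ᴷ_ -ᴷ_ 0ᴷ 1ᴷ
    isCommutativeRingᴷ = record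
      { isRing = record
        { +-isAbelianGroup = record
          { isGroup = record
            { isMonoid = record
              { isSemigroup = record
                { isMagma = record
                  { isEquivalence = record
                    { refl  = value⇒≈ ≡.refl
                    ; sym   = λ {x} {y} h → difference (≡.subst InMaximalIdeal
                        (Q.solve 2 (λ x y → Q.:- (x Q.:- y) Q.:= y Q.:- x) ≡.refl (value x) (value y)) (ideal-neg (difference-ideal h)))
                    ; trans = λ {x} {y} {z} h k → difference (≡.subst InMaximalIdeal
                        (Q.solve 3 (λ x y z → (x Q.:- y) Q.:+ (y Q.:- z) Q.:= x Q.:- z) ≡.refl (value x) (value y) (value z))
                        (ideal-+ (difference-ideal h) (difference-ideal k))) }
                  ; ∙-cong = λ {x} {y} {u} {v} h k → difference (≡.subst InMaximalIdeal
                        (Q.solve 4 (λ x y u v → (x Q.:- y) Q.:+ (u Q.:- v) Q.:= (x Q.:+ u) Q.:- (y Q.:+ v)) ≡.refl (value x) (value y) (value u) (value v))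
                        (ideal-+ (difference-ideal h) (difference-ideal k))) }
                ; assoc = λ x y z → value⇒≈ (ℚₚ.+-assoc (value x) (value y) (value z)) }
              ; identity = (λ x → value⇒≈ (ℚₚ.+-identityˡ (value x))) , (λ x → value⇒≈ (ℚₚ.+-identityʳ (value x))) }
            ; inverse = (λ x → value⇒≈ (ℚₚ.+-inverseˡ (value x))) , (λ x → value⇒≈ (ℚₚ.+-inverseʳ (value x)))
            ; ⁻¹-cong = λ {x} {y} h → difference (≡.subst InMaximalIdeal
                        (Q.solve 2 (λ x y → Q.:- (x Q.:- y) Q.:= (Q.:- x) Q.:- (Q.:- y)) ≡.refl (value x) (value y)) (ideal-neg (difference-ideal h))) }
          ; comm = λ x y → value⇒≈ (ℚₚ.+-comm (value x) (value y)) }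
        ; *-cong = λ {x} {y} {u} {v} h k → difference (≡.subst InMaximalIdeal
                        (Q.solve 4 (λ x y u v → (x Q.:- y) Q.:* u Q.:+ (u Q.:- v) Q.:* y Q.:= x Q.:* u Q.:- y Q.:* v) ≡.refl (value x) (value y) (value u) (value v))
                        (ideal-+ (ideal-* (difference-ideal h) (isIntegral u)) (ideal-* (difference-ideal k) (isIntegral y))))
        ; *-assoc = λ x y z → value⇒≈ (ℚₚ.*-assoc (value x) (value y) (value z))
        ; *-identity = (λ x → value⇒≈ (ℚₚ.*-identityˡ (value x))) , (λ x → value⇒≈ (ℚₚ.*-identityʳ (value x)))
        ; distrib = (λ x y z → value⇒≈ (ℚₚ.*-distribˡ-+ (value x) (value y) (value z)))
                  , (λ x y z → value⇒≈ (ℚₚ.*-distribʳ-+ (value x) (value y) (value z))) }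
      ; *-comm = λ x y → value⇒≈ (ℚₚ.*-comm (value x) (value y)) }

  -- The p-integral rationals with congruence modulo p as equality, a model of the prime field in which reduction mod p is the identity map.
  K : CommutativeRing 0ℓ 0ℓ
  K = record { isCommutativeRing = isCommutativeRingᴷ }

  module Kᵣ = RingTools K

  value-minus : ∀ x y → value (x Kᵣ.- y) ≡ value x ℚ.- value y
  value-minus x y = ≡.trans (value-+ x (-ᴷ y)) (≡.cong (value x ℚ.+_) (value-neg y))

  value-ι : ∀ n → value (Kᵣ.ι n) ≡ Q.ι n
  value-ι zero    = value-0
  value-ι (suc n) = ≡.trans (value-+ 1ᴷ (Kᵣ.ι n)) (≡.cong₂ ℚ._+_ value-1 (value-ι n))

  integral-log : ∀ l → Integral (logℚ p l)
  integral-log zero    = ≡.subst Integral (≡.sym (logℚ-0 p)) (integral-ℤ (+ 0))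
  integral-log (suc l) with p ∣? suc l
  ... | yes _  = integral-ℤ (+ 0)
  ... | no p∤l = integral-recip l p∤l

  -- One family plays two roles: the inverses of 1, ..., p-1, and the coefficients of L, which are 0
  -- at the multiples of p.
  invᴷ : ℕ → ℤ₍ₚ₎
  invᴷ l = logℚ p l , integral-log l

  logℚ-unit : ∀ l → ¬ p ∣ l → logℚ p l ≡ recip l
  logℚ-unit l p∤l with p ∣? l
  ... | yes p∣l = contradiction p∣l p∤l
  ... | no  _   = ≡.refl

  logℚ-nonunit : ∀ l → p ∣ l → logℚ p l ≡ 0ℚ
  logℚ-nonunit l p∣l with p ∣? l
  ... | yes _   = ≡.refl
  ... | no  p∤l = contradiction p∣l p∤l

  invᴷ-ι : ∀ l → ¬ p ∣ l → invᴷ l Kᵣ.* Kᵣ.ι l Kᵣ.≈ Kᵣ.1#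
  invᴷ-ι zero    p∤0 = contradiction (p ∣0) p∤0
  invᴷ-ι (suc l) p∤l = value⇒≈ (≡.trans (value-* (invᴷ (suc l)) (Kᵣ.ι (suc l)))
    (≡.trans (≡.cong₂ ℚ._*_ (logℚ-unit (suc l) p∤l) (value-ι (suc l))) (≡.trans (recip-ι l) (≡.sym value-1))))

  ι-p≈0 : Kᵣ.ι p Kᵣ.≈ Kᵣ.0#
  ι-p≈0 = difference (≡.subst InMaximalIdeal
    (≡.trans (≡.trans (ℕtoℚ-ι p) (≡.sym (value-ι p))) (≡.trans (≡.sym (ℚₚ.+-identityʳ (value (Kᵣ.ι p)))) (≡.cong (λ z → value (Kᵣ.ι p) ℚ.- z) (≡.sym value-0))))
    (inIdeal 1 (+ 1) p∤1 (≡.trans (ℚₚ.*-identityʳ (ℕtoℚ p)) (≡.cong ℤtoℚ (≡.sym (ℤₚ.*-identityʳ (+ p)))))))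

  inv-periodic : ∀ n → invᴷ (p ℕ.+ n) Kᵣ.≈ invᴷ n
  inv-periodic n = by-cases (p ∣? n)
    where
    by-cases : Dec (p ∣ n) → invᴷ (p ℕ.+ n) Kᵣ.≈ invᴷ n
    by-cases (yes p∣n) = value⇒≈ {invᴷ (p ℕ.+ n)} {invᴷ n} (≡.trans (logℚ-nonunit (p ℕ.+ n) (∣m∣n⇒∣m+n ∣-refl p∣n)) (≡.sym (logℚ-nonunit n p∣n)))
    by-cases (no p∤n)  = Kᵣ.inverse-unique {invᴷ (p ℕ.+ n)} {invᴷ n} {Kᵣ.ι (p ℕ.+ n)} {Kᵣ.ι n}
      (invᴷ-ι (p ℕ.+ n) (λ h → p∤n (∣m+n∣m⇒∣n h ∣-refl))) (invᴷ-ι n p∤n) (Kᵣ.ι-periodic {p} ι-p≈0 n)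

module PrimeField (q : ℕ) (p-prime : Prime (suc q)) where
  open Localization (suc q) p-prime public

  0<q : 0 ℕ.< q
  0<q = positive q p-prime
    where
    positive : ∀ q → Prime (suc q) → 0 ℕ.< q
    positive zero    h = contradiction h ¬prime[1]
    positive (suc q) _ = ℕ.s≤s ℕ.z≤n

  small : ∀ j → j ℕ.< q → ¬ suc q ∣ suc j
  small j j<q = >⇒∤ (ℕ.s≤s j<q)

  charᴷ : Characteristic K q
  charᴷ = record { 0<q = 0<q ; inv = invᴷ ; inv-ι = λ j j<q → invᴷ-ι (suc j) (small j j<q) ; ι-p = ι-p≈0 }

  logᴷ : Logarithm K q charᴷ
  logᴷ = record { L = invᴷ ; L-0 = value⇒≈ (≡.trans (logℚ-0 (suc q)) (≡.sym value-0)) ; L-inv = λ _ _ → Kᵣ.refl ; L-periodic = inv-periodic }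

  integral-Σ : ∀ n f → (∀ i → i ℕ.< n → Integral (f i)) → Integral (Q.Σ< n f)
  integral-Σ zero    f h = integral-ℤ (+ 0)
  integral-Σ (suc n) f h = integral-+ (integral-Σ n f (λ i i<n → h i (ℕₚ.m<n⇒m<1+n i<n))) (h n ℕₚ.≤-refl)

  -- For n > 0, the recursion for B_n divides by n + 1 only, which is less than p, and the earlier
  -- Bernoulli numbers are p-integral by induction.
  integral-bernoulli : ∀ n → n ℕ.< q → Integral (bernoulli n)
  integral-bernoulli n n<q = below n n ℕₚ.≤-refl n<q
    where
    below : ∀ N n → n ℕ.≤ N → n ℕ.< q → Integral (bernoulli n)
    below N       zero    _   _   = integral-ℤ (+ 1)
    below (suc N) (suc n) n≤N n<q = ≡.subst Integral (≡.sym (bernoulli-suc n)) (integral-neg (integral-*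
      (integral-recip (suc n) (small (suc n) n<q))
      (integral-Σ (suc n) _ (λ k k<n → integral-* (integral-ℤ (+ (suc (suc n) C k)))
        (below N k (ℕₚ.≤-trans (ℕ.s≤s⁻¹ k<n) (ℕ.s≤s⁻¹ n≤N)) (ℕₚ.<-trans k<n n<q))))))

  -- B_(p-1) is not p-integral; its place is taken by 0.
  βᴷ : ℕ → ℤ₍ₚ₎
  βᴷ i with i ℕ.<? q
  ... | yes i<q = bernoulli i , integral-bernoulli i i<q
  ... | no  _   = 0ℚ , integral-ℤ (+ 0)

  value-β : ∀ i → i ℕ.< q → value (βᴷ i) ≡ bernoulli i
  value-β i i<q with i ℕ.<? q
  ... | yes _   = ≡.refl
  ... | no  i≮q = contradiction i<q i≮q

  private
    module TQ = BinomialTransform ℚₚ.+-*-commutativeRing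
    module TK = BinomialTransform K

  value-T : ∀ A a n → value (TK.T A a n) ≡ TQ.T (value A) (value ∘ a) n
  value-T A a zero    = ≡.refl
  value-T A a (suc n) = ≡.trans (value-+ (A *ᴷ TK.T A a n) (TK.T A (a ∘ suc) n))
    (≡.cong₂ ℚ._+_ (≡.trans (value-* A (TK.T A a n)) (≡.cong (value A ℚ.*_) (value-T A a n))) (value-T A (a ∘ suc) n))

  value-δ₁ : ∀ n → value (TK.δ₁ n) ≡ TQ.δ₁ n
  value-δ₁ zero          = value-0
  value-δ₁ (suc zero)    = value-1
  value-δ₁ (suc (suc n)) = value-0

  -- `βᴷ` differs from the Bernoulli numbers only from index p - 1 on. Up to n = p - 1 the
  -- difference therefore enters the binomial sum through its top term alone, which also stands on
  -- the other side.
  bernᴷ : BernoulliNumbers K q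
  bernᴷ = record { β = βᴷ ; β-rec = λ n n≤q → value⇒≈ (≡.trans (value-T 1ᴷ βᴷ n)
      (≡.trans (TQ.T-cong n value-1 (λ _ _ → ≡.refl)) (≡.trans (rec n n≤q)
      (≡.trans (≡.cong (value (βᴷ n) ℚ.+_) (≡.sym (value-δ₁ n))) (≡.sym (value-+ (βᴷ n) (TK.δ₁ n))))))) }
    where
    open ≡.≡-Reasoning
    c : ℕ → ℚ
    c i = value (βᴷ i) ℚ.- bernoulli i
    c-low : ∀ i → i ℕ.< q → c i ≡ 0ℚ
    c-low i i<q = ≡.trans (≡.cong (ℚ._- bernoulli i) (value-β i i<q)) (ℚₚ.+-inverseʳ (bernoulli i))
    rec : ∀ n → n ℕ.≤ q → TQ.T 1ℚ (value ∘ βᴷ) n ≡ value (βᴷ n) ℚ.+ TQ.δ₁ n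
    rec n n≤q = begin
      TQ.T 1ℚ (value ∘ βᴷ) n
        ≡⟨ TQ.T-cong n ≡.refl (λ i _ → Q.solve 2 (λ x b → x Q.:= b Q.:+ (x Q.:- b)) ≡.refl (value (βᴷ i)) (bernoulli i)) ⟩
      TQ.T 1ℚ (λ i → bernoulli i ℚ.+ c i) n
        ≡⟨ TQ.T-+ n 1ℚ bernoulli c ⟩
      TQ.T 1ℚ bernoulli n ℚ.+ TQ.T 1ℚ c n
        ≡⟨ ≡.cong₂ ℚ._+_ (bernoulli-rec n) (TQ.T-low n 1ℚ c (λ i i<n → c-low i (ℕₚ.<-≤-trans i<n n≤q))) ⟩
      (bernoulli n ℚ.+ TQ.δ₁ n) ℚ.+ c n
        ≡⟨ Q.solve 3 (λ b d x → (b Q.:+ d) Q.:+ (x Q.:- b) Q.:= x Q.:+ d) ≡.refl (bernoulli n) (TQ.δ₁ n) (value (βᴷ n)) ⟩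
      value (βᴷ n) ℚ.+ TQ.δ₁ n ∎

-- Comparison of the two sides modulo p

module DoubleConvolution where
  open Convolution Qˢ._+ˢ_ Qˢ._*ˢ_ public renaming (conv to conv²)

  conv²-Σ : ∀ m n F G → conv² F G m n ≡ Q.Σ< (suc m) (λ i → Q.Σ< (suc n) (λ j → F i j ℚ.* G (m ℕ.∸ i) (n ℕ.∸ j)))
  conv²-Σ zero    n F G = ≡.trans (Qˢ.conv-Σ n (F 0) (G 0)) (≡.sym (ℚₚ.+-identityˡ _))
  conv²-Σ (suc m) n F G = ≡.trans (≡.cong₂ ℚ._+_ (Qˢ.conv-Σ n (F 0) (G (suc m))) (conv²-Σ m n (F ∘ suc) G))
    (≡.sym (Q.Σ-head (suc m) (λ i → Q.Σ< (suc n) (λ j → F i j ℚ.* G (suc m ℕ.∸ i) (n ℕ.∸ j)))))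

  conv²-transpose : ∀ m n F G → conv² F G m n ≡ conv² (flip F) (flip G) n m
  conv²-transpose m n F G = ≡.trans (conv²-Σ m n F G) (≡.trans (Q.Σ-swap (suc m) (suc n) (λ i j → F i j ℚ.* G (m ℕ.∸ i) (n ℕ.∸ j)))
    (≡.sym (conv²-Σ n m (flip F) (flip G))))

module Comparison (q : ℕ) (p-prime : Prime (suc q)) (2<q : 2 ℕ.< q) where
  open PrimeField q p-prime
  open DoubleConvolution
  module S = Slices K q charᴷ bernᴷ logᴷ
  open S using (p; e; r; Φ)
  open Kᵣ

  infix 4 _~_
  -- The rational x is p-integral and reduces to κ. The separate `lift` carries integrality: the
  -- word sums are plain rationals whose integrality is only established along with their residue.
  record _~_ (x : ℚ) (κ : ℤ₍ₚ₎) : Set where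
    constructor represented
    field
      lift   : ℤ₍ₚ₎
      value≡ : x ≡ value lift
      lift≈  : lift ≈ κ

  ~-+ : ∀ {x κ y μ} → x ~ κ → y ~ μ → x ℚ.+ y ~ κ + μ
  ~-+ (represented a h k) (represented b h′ k′) = represented (a + b) (≡.trans (≡.cong₂ ℚ._+_ h h′) (≡.sym (value-+ a b))) (+-cong k k′)

  ~-* : ∀ {x κ y μ} → x ~ κ → y ~ μ → x ℚ.* y ~ κ * μ
  ~-* (represented a h k) (represented b h′ k′) = represented (a * b) (≡.trans (≡.cong₂ ℚ._*_ h h′) (≡.sym (value-* a b))) (*-cong k k′)

  ~-≈ : ∀ {x κ μ} → x ~ κ → κ ≈ μ → x ~ μ
  ~-≈ (represented a h k) k′ = represented a h (trans k k′)

  ~-≡ : ∀ {x y κ} → x ≡ y → y ~ κ → x ~ κ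
  ~-≡ e (represented a h k) = represented a (≡.trans e h) k

  ~-value : ∀ {x} κ → x ≡ value κ → x ~ κ
  ~-value κ h = represented κ h refl

  ~-0 : ∀ {x} → x ≡ 0ℚ → x ~ 0#
  ~-0 e = ~-value 0# (≡.trans e (≡.sym value-0))

  ~-1 : ∀ {x} → x ≡ 1ℚ → x ~ 1#
  ~-1 e = ~-value 1# (≡.trans e (≡.sym value-1))

  ~-ι : ∀ n → Q.ι n ~ ι n
  ~-ι n = ~-value (ι n) (≡.sym (value-ι n))

  ~-congruent : ∀ {x y κ} → x ~ κ → y ~ κ → suc q ∣ ℤ.∣ ↥ (x ℚ.- y) ∣
  ~-congruent {x} {y} (represented a h k) (represented b h′ k′) = ideal⇒p∣numerator (x ℚ.- y)
    (≡.subst InMaximalIdeal (≡.sym (≡.cong₂ ℚ._-_ h h′)) (difference-ideal (trans k (sym k′))))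

  infix 4 _~ˢ_
  _~ˢ_ : (ℕ → ℚ) → (ℕ → ℤ₍ₚ₎) → Set
  f ~ˢ g = ∀ k → k ℕ.≤ q → f k ~ g k

  ~ˢ-* : ∀ {f g f′ g′} → f ~ˢ g → f′ ~ˢ g′ → Qˢ.conv f f′ ~ˢ S.S.conv g g′
  ~ˢ-* h h′ k k≤q = ConvolutionRelation.conv-~ ℚ._+_ ℚ._*_ _+_ _*_ _~_ ~-+ ~-* k
    (λ i i≤k → h i (ℕₚ.≤-trans i≤k k≤q)) (λ i i≤k → h′ i (ℕₚ.≤-trans i≤k k≤q))

  conv²-~ : ∀ n {F G F′ G′} → (∀ i → i ℕ.≤ n → F i ~ˢ G i) → (∀ i → i ℕ.≤ n → F′ i ~ˢ G′ i) →
    conv² F F′ n ~ˢ S.P.conv G G′ n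
  conv²-~ n = ConvolutionRelation.conv-~ Qˢ._+ˢ_ Qˢ._*ˢ_ S.S._+ˢ_ S.S._*ˢ_ _~ˢ_ (λ h h′ k k≤q → ~-+ (h k k≤q) (h′ k k≤q)) ~ˢ-* n

  module _ (b : ℕ) where
    module I = IteratedSumsProperties ℚₚ.+-*-commutativeRing ℚ-reciprocals b (word-sums p b)

    kernel X : ℕ → ℕ → ℚ
    kernel a k = I.τ I.H k a
    X n k = I.X k n

    kernel≡ : ∀ a k → kernel a k ≡ Q.ι a ℚ.* (recip k ℚ.* letter p k a)
    kernel≡ a k = ≡.cong (Q.ι a ℚ.*_) (I.T.conv-const a (recip k) (letter p k))

    kernel-0 : ∀ k → kernel 0 k ≡ 0ℚ
    kernel-0 k = ℚₚ.*-zeroˡ (I.H k 0)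

    -- `I.X` is a series in y over series in t, while e_0 is a series in t over series in y; the
    -- transposition brings both into the second form. As the kernel has no t^0 term, only lower
    -- coefficients of X occur on the right.
    X-rec : ∀ n k → suc n ℕ.≤ b → Q.ι (suc n) ℚ.* X (suc n) k ≡ conv² (kernel ∘ suc) X n k
    X-rec n k n<b = ≡.trans (I.T.at (I.𝕐.at I.τ-X k tt) (suc n) n<b)
      (≡.trans (conv²-transpose k (suc n) (flip kernel) (flip X))
      (≡.trans (≡.cong (ℚ._+ conv² (kernel ∘ suc) X n k) (≡.trans (Qˢ.conv-cong k kernel-0 (λ _ → ≡.refl)) (Qˢ.conv-zeroˡ k (X (suc n)))))
        (ℚₚ.+-identityˡ (conv² (kernel ∘ suc) X n k))))

    X-0 : X 0 ~ˢ e 0 0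
    X-0 zero    _ = ~-1 (I.T.at I.X-0 0 ℕ.z≤n)
    X-0 (suc k) _ = ~-0 (≡.trans (I.T.Σ-at (suc b) (λ ℓ → wordSum p ℓ 0 (suc k)) 0) (Q.Σ-zero (suc b) words-0))
      where
      words-0 : ∀ ℓ → ℓ ℕ.< suc b → wordSum p ℓ 0 (suc k) 0 ≡ 0ℚ
      words-0 zero    _ = ≡.refl
      words-0 (suc ℓ) _ = wordSum-zero p (suc ℓ) 0 (suc k) 0 (ℕ.s≤s ℕ.z≤n)

    recip~inv : ∀ j → j ℕ.< q → recip (suc j) ~ invᴷ (suc j)
    recip~inv j j<q = ~-value (invᴷ (suc j)) (≡.sym (logℚ-unit (suc j) (small j j<q)))

    module _ (kernel~Φ : ∀ N → suc N ℕ.< q → kernel (suc N) ~ˢ Φ (suc N)) where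
      -- X and e_0 agree at t = 0 and obey the same recursion modulo p, whose leading factor n + 1 <
      -- p is a unit.
      X~e : ∀ n → n ℕ.≤ b → n ℕ.< q → X n ~ˢ e 0 n
      X~e n = below n n ℕₚ.≤-refl
        where
        below : ∀ N n → n ℕ.≤ N → n ℕ.≤ b → n ℕ.< q → X n ~ˢ e 0 n
        below N       zero    _   _   _     = X-0
        below (suc N) (suc n) n≤N n<b n+1<q k k≤q = ~-≡ X≡ (~-≈ (~-* (recip~inv n n<q) (~-≈ product (sym (S.e-0-rec n k n+1<q)))) (S.inv-*-ι n (e 0 (suc n) k) n<q))
          where
          n<q : n ℕ.< q
          n<q = ℕₚ.<-trans (ℕₚ.n<1+n n) n+1<q
          product : conv² (kernel ∘ suc) X n k ~ S.P.conv (Φ ∘ suc) (e 0) n k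
          product = conv²-~ n (λ i i≤n → kernel~Φ i (ℕₚ.≤-<-trans (ℕ.s≤s i≤n) n+1<q))
            (λ i i≤n → below N i (ℕₚ.≤-trans i≤n (ℕ.s≤s⁻¹ n≤N)) (ℕₚ.≤-trans i≤n (ℕₚ.<⇒≤ n<b)) (ℕₚ.≤-<-trans i≤n n<q)) k k≤q
          X≡ : X (suc n) k ≡ recip (suc n) ℚ.* conv² (kernel ∘ suc) X n k
          X≡ = ≡.sym (≡.trans (≡.cong (recip (suc n) ℚ.*_) (≡.sym (X-rec n k n<b)))
            (≡.trans (≡.sym (ℚₚ.*-assoc (recip (suc n)) (Q.ι (suc n)) (X (suc n) k)))
            (≡.trans (≡.cong (ℚ._* X (suc n) k) (recip-ι n)) (ℚₚ.*-identityˡ (X (suc n) k)))))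

odd-prime : ∀ q → Prime (suc q) → 2 ℕ.< q → suc q % 2 ≢ 0
odd-prime q p-prime 2<q even with prime⇒irreducible p-prime (m%n≡0⇒n∣m (suc q) 2 even)
... | inj₁ ()
... | inj₂ ≡.refl = contradiction 2<q (λ { (ℕ.s≤s ()) })

oddGe3-even : ∀ a → a % 2 ≡ 0 → oddGe3 a ≡ false
oddGe3-even a h = ≡.trans (≡.cong (λ r → (3 ≤ᵇ a) ∧ not (does (r ℕ.≟ 0))) h) (∧-zeroʳ (3 ≤ᵇ a))

oddGe3-odd : ∀ a → suc (suc (suc a)) % 2 ≢ 0 → oddGe3 (suc (suc (suc a))) ≡ true
oddGe3-odd a h = ≡.cong not (dec-false (suc (suc (suc a)) % 2 ℕ.≟ 0) h)

ℤtoℚ-- : ∀ i j → ℤtoℚ (i ℤ.- j) ≡ ℤtoℚ i ℚ.- ℤtoℚ j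
ℤtoℚ-- i j = Q.+-cancelʳ′ (ℤtoℚ j) (≡.trans (≡.sym (ℤtoℚ-+ (i ℤ.- j) j))
  (≡.trans (≡.cong ℤtoℚ (≡.trans (ℤₚ.+-assoc i (ℤ.- j) j) (≡.trans (≡.cong (λ x → i ℤ.+ x) (ℤₚ.+-inverseˡ j)) (ℤₚ.+-identityʳ i))))
    (Q.solve 2 (λ x y → x Q.:= x Q.:- y Q.:+ y) ≡.refl (ℤtoℚ i) (ℤtoℚ j))))

[1+N]*C : ∀ k N → suc N ℕ.* ((k ℕ.+ suc N) C suc N) ≡ suc k ℕ.* ((suc k ℕ.+ N) C suc k)
[1+N]*C k N = begin
  suc N ℕ.* ((k ℕ.+ suc N) C suc N)      ≡⟨ ≡.cong (λ x → suc N ℕ.* (x C suc N)) (ℕₚ.+-suc k N) ⟩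
  suc N ℕ.* (suc (k ℕ.+ N) C suc N)      ≡⟨ [1+k]*[1+n]C[1+k] (k ℕ.+ N) N ⟩
  suc (k ℕ.+ N) ℕ.* ((k ℕ.+ N) C N)      ≡⟨ ≡.cong (suc (k ℕ.+ N) ℕ.*_) (≡.trans (nCk≡nC[n∸k] (ℕₚ.m≤n+m N k)) (≡.cong ((k ℕ.+ N) C_) (ℕₚ.m+n∸n≡m k N))) ⟩
  suc (k ℕ.+ N) ℕ.* ((k ℕ.+ N) C k)      ≡⟨ [1+k]*[1+n]C[1+k] (k ℕ.+ N) k ⟨
  suc k ℕ.* (suc (k ℕ.+ N) C suc k)      ∎
  where open ≡.≡-Reasoning

-- With a = N + 1 and k + 1 written k, the quotients are (a/k) C(k+a-1,a) = C(k+a-1,k) and (a/k)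
-- C(k,a) = C(k-1,a-1): the coefficients of y^k in w^a and u^a. The division by k takes place in ℚ,
-- before any reduction modulo p.
factor-kernel : ∀ p k N → Q.ι (suc N) ℚ.* (recip (suc k) ℚ.* factor p (suc k) (suc N)) ≡
  ℚ.- ((recip (suc N) ℚ.* bernoulli (p ℕ.∸ suc N)) ℚ.* (Q.ι ((suc k ℕ.+ N) C suc k) ℚ.- Q.ι (k C N)))
factor-kernel p k N = begin
  ιM ℚ.* (rk ℚ.* (ℤtoℚ (+ C₁ ℤ.- + C₂) ℚ.* (ℚ.- (B ℚ.* rM))))
    ≡⟨ ≡.cong (λ x → ιM ℚ.* (rk ℚ.* (x ℚ.* (ℚ.- (B ℚ.* rM))))) (≡.trans (ℤtoℚ-- (+ C₁) (+ C₂)) (≡.cong₂ ℚ._-_ (ℕtoℚ-ι C₁) (ℕtoℚ-ι C₂))) ⟩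
  ιM ℚ.* (rk ℚ.* ((Q.ι C₁ ℚ.- Q.ι C₂) ℚ.* (ℚ.- (B ℚ.* rM))))
    ≡⟨ Q.solve 6 (λ m rk c d b rm → m Q.:* (rk Q.:* ((c Q.:- d) Q.:* (Q.:- (b Q.:* rm)))) Q.:= Q.:- ((rm Q.:* b) Q.:* (rk Q.:* (m Q.:* c) Q.:- rk Q.:* (m Q.:* d)))) ≡.refl
         ιM rk (Q.ι C₁) (Q.ι C₂) B rM ⟩
  ℚ.- ((rM ℚ.* B) ℚ.* (rk ℚ.* (ιM ℚ.* Q.ι C₁) ℚ.- rk ℚ.* (ιM ℚ.* Q.ι C₂)))
    ≡⟨ ≡.cong₂ (λ x y → ℚ.- ((rM ℚ.* B) ℚ.* (x ℚ.- y))) (absorb C₁ W ([1+N]*C k N)) (absorb C₂ U ([1+k]*[1+n]C[1+k] k N)) ⟩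
  ℚ.- ((rM ℚ.* B) ℚ.* (Q.ι W ℚ.- Q.ι U)) ∎
  where
  open ≡.≡-Reasoning
  C₁ C₂ W U : ℕ
  C₁ = (k ℕ.+ suc N) C suc N
  C₂ = suc k C suc N
  W = (suc k ℕ.+ N) C suc k
  U = k C N
  ιM rk rM B : ℚ
  ιM = Q.ι (suc N)
  rk = recip (suc k)
  rM = recip (suc N)
  B = bernoulli (p ℕ.∸ suc N)
  absorb : ∀ x y → suc N ℕ.* x ≡ suc k ℕ.* y → rk ℚ.* (ιM ℚ.* Q.ι x) ≡ Q.ι y
  absorb x y h = begin
    rk ℚ.* (ιM ℚ.* Q.ι x)              ≡⟨ ≡.cong (rk ℚ.*_) (≡.trans (≡.sym (Q.ι-* (suc N) x)) (≡.trans (≡.cong Q.ι h) (Q.ι-* (suc k) y))) ⟩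
    rk ℚ.* (Q.ι (suc k) ℚ.* Q.ι y)     ≡⟨ ℚₚ.*-assoc rk (Q.ι (suc k)) (Q.ι y) ⟨
    (rk ℚ.* Q.ι (suc k)) ℚ.* Q.ι y     ≡⟨ ≡.cong (ℚ._* Q.ι y) (recip-ι k) ⟩
    1ℚ ℚ.* Q.ι y                       ≡⟨ ℚₚ.*-identityˡ (Q.ι y) ⟩
    Q.ι y ∎

module KernelComparison (q : ℕ) (p-prime : Prime (suc q)) (2<q : 2 ℕ.< q) (b : ℕ) where
  open PrimeField q p-prime
  open Comparison q p-prime 2<q
  open S using (p; r; Φ)
  open Kᵣ
  private
    module ±Q = SignPowers ℚₚ.+-*-commutativeRing

  module _ (N : ℕ) (N+1<q : suc N ℕ.< q) where
    private
      M : ℕ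
      M = suc N

      N<q : N ℕ.< q
      N<q = ℕₚ.<-trans (ℕₚ.n<1+n N) N+1<q

      q∸N<q : 0 ℕ.< N → q ℕ.∸ N ℕ.< q
      q∸N<q 0<N = ℕₚ.∸-monoʳ-< 0<N (ℕₚ.<⇒≤ N<q)

    -- q ∸ N = p - M is odd and at least 3.
    β-even : M % 2 ≡ 0 → βᴷ (q ℕ.∸ N) ≈ 0#
    β-even even = value⇒≈ (≡.trans (value-β (q ℕ.∸ N) (q∸N<q 0<N)) (≡.trans (vanish (q ℕ.∸ N) (ℕₚ.m+n≤o⇒m≤o∸n 2 N+1<q) sign) (≡.sym value-0)))
      where
      sign : (ℚ.- 1ℚ) Q.^ (q ℕ.∸ N) ≡ ℚ.- 1ℚ
      sign = ±Q.sign-summand (q ℕ.∸ N) M (≡.trans (≡.cong ((ℚ.- 1ℚ) Q.^_) total) (±Q.sign-odd (suc q) (odd-prime q p-prime 2<q))) (±Q.sign-even M even)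
        where
        total : q ℕ.∸ N ℕ.+ M ≡ suc q
        total = ≡.trans (ℕₚ.+-suc (q ℕ.∸ N) N) (≡.cong suc (ℕₚ.m∸n+n≡m (ℕₚ.<⇒≤ N<q)))
      vanish : ∀ i → 2 ℕ.≤ i → (ℚ.- 1ℚ) Q.^ i ≡ ℚ.- 1ℚ → bernoulli i ≡ 0ℚ
      vanish (suc (suc i)) _ h = bernoulli-odd i h
      vanish (suc zero) (ℕ.s≤s ()) h
      0<N : 0 ℕ.< N
      0<N = positive N even
        where
        positive : ∀ N → suc N % 2 ≡ 0 → 0 ℕ.< N
        positive (suc N) _ = ℕ.s≤s ℕ.z≤n

    private
      module Φ = S.ΦCoefficients N N+1<q

      kernel-letter-0 : ∀ k → letter p k M ≡ 0ℚ → kernel b M k ≡ 0ℚ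
      kernel-letter-0 k h = ≡.trans (kernel≡ b M k) (≡.trans (≡.cong (λ x → Q.ι M ℚ.* (recip k ℚ.* x)) h)
        (Q.solve 2 (λ x y → x Q.:* (y Q.:* Q.con (+ 0)) Q.:= Q.con (+ 0)) ≡.refl (Q.ι M) (recip k)))

      letter≡ : ∀ {t} k → oddGe3 M ≡ t → letter p (suc k) M ≡ (if t then factor p (suc k) M else 0ℚ)
      letter≡ k = ≡.cong (λ t → if t then factor p (suc k) M else 0ℚ)

    -- For even a there is no letter, and B_(p-a) = 0. For a = 1 there is no letter, and the bracket
    -- in Φ vanishes. For odd a ≥ 3 the two agree by `factor-kernel`. At y = 0 both sides vanish.
    kernel~Φ : kernel b M ~ˢ Φ M
    kernel~Φ k _ with M % 2 ℕ.≟ 0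
    kernel~Φ zero    _ | yes even = ~-≈ (~-0 (kernel-letter-0 0 ≡.refl)) (sym (Φ.Φ-even (β-even even) 0))
    kernel~Φ (suc k) _ | yes even = ~-≈ (~-0 (kernel-letter-0 (suc k) (letter≡ k (oddGe3-even M even)))) (sym (Φ.Φ-even (β-even even) (suc k)))
    kernel~Φ zero    _ | no odd   = ~-≈ (~-0 (kernel-letter-0 0 ≡.refl)) (sym (Φ.Φ-odd-0 odd))
    kernel~Φ (suc k) _ | no odd   = by-size N ≡.refl
      where
      by-size : ∀ N′ → N ≡ N′ → kernel b M (suc k) ~ Φ M (suc k)
      by-size zero          ≡.refl = ~-≈ (~-0 (kernel-letter-0 (suc k) ≡.refl)) (sym (S.Φ-1-suc N+1<q k))
      by-size (suc zero)    ≡.refl = contradiction ≡.refl odd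
      by-size (suc (suc a)) ≡.refl = ~-≈ (~-value κ (≡.trans (kernel≡ b M (suc k))
        (≡.trans (≡.cong (λ x → Q.ι M ℚ.* (recip (suc k) ℚ.* x)) (letter≡ k (oddGe3-odd a odd)))
        (≡.trans (factor-kernel p k N) (≡.sym value-κ))))) (sym (Φ.Φ-odd-suc odd k))
        where
        W U c κ : ℤ₍ₚ₎
        W = ι ((suc k ℕ.+ N) C suc k)
        U = ι (k C N)
        c = invᴷ M * βᴷ (q ℕ.∸ N)
        κ = - (c * (W - U))
        value-κ : value κ ≡ ℚ.- ((recip M ℚ.* bernoulli (q ℕ.∸ N)) ℚ.* (Q.ι ((suc k ℕ.+ N) C suc k) ℚ.- Q.ι (k C N)))
        value-κ = ≡.trans (value-neg (c * (W - U))) (≡.cong ℚ.-_ (≡.trans (value-* c (W - U)) (≡.cong₂ ℚ._*_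
          (≡.trans (value-* (invᴷ M) (βᴷ (q ℕ.∸ N))) (≡.cong₂ ℚ._*_ (logℚ-unit M (small N N<q)) (value-β (q ℕ.∸ N) (q∸N<q (ℕ.s≤s ℕ.z≤n)))))
          (≡.trans (value-minus W U) (≡.cong₂ ℚ._-_ (value-ι ((suc k ℕ.+ N) C suc k)) (value-ι (k C N)))))))

  power~ : ∀ n N → power p n N ~ S.logPower n N
  power~ zero    zero    = ~-1 ≡.refl
  power~ zero    (suc N) = ~-0 ≡.refl
  power~ (suc n) N       = ConvolutionRelation.conv-~ ℚ._+_ ℚ._*_ _+_ _*_ _~_ ~-+ ~-* N
    (λ i _ → ~-value (invᴷ i) ≡.refl) (λ i _ → power~ n i)

-- Both sides reduce to n! times the coefficient of t^n x^(mp) in exp(tL). The single bound provides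
-- 2 < p - 1 (p is odd), n < p - 1 (the truncation in t) and m ≤ p - 1 (the range of the comparison
-- in y).
congruence : ∀ m n q → Prime (suc q) → 1 ℕ.≤ m → 3 ℕ.+ (n ℕ.+ m) ℕ.≤ q → R n m (suc q) (suc q) ≡ℚ RHS n m (suc q) [mod suc q ]
congruence m n q p-prime 1≤m large = ~-congruent
    (~-≡ (R≡power (suc q) n m (suc q)) (~-≈ (power~ n (m ℕ.* suc q)) (S.logPower≈n!r n (m ℕ.* suc q) (ℕₚ.<⇒≤ n<q))))
    (~-≡ (≡.trans (RHS≡wordSums (suc q) n m 1≤m) (≡.cong₂ ℚ._*_ (ℕtoℚ-ι (n !)) (≡.sym (I.T.Σ-at n (suc n) (λ ℓ → wordSum (suc q) ℓ 0 m) n))))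
      (~-* (~-ι (n !)) (X~e n kernel~Φ n ℕₚ.≤-refl n<q m m≤q)))
  where
  2<q : 2 ℕ.< q
  2<q = ℕₚ.≤-trans (ℕₚ.m≤m+n 3 (n ℕ.+ m)) large
  n<q : n ℕ.< q
  n<q = ℕₚ.≤-trans (ℕ.s≤s (ℕₚ.≤-trans (ℕₚ.m≤m+n n m) (ℕₚ.m≤n+m (n ℕ.+ m) 2))) large
  m≤q : m ℕ.≤ q
  m≤q = ℕₚ.≤-trans (ℕₚ.≤-trans (ℕₚ.m≤n+m m n) (ℕₚ.m≤n+m (n ℕ.+ m) 3)) large
  open Comparison q p-prime 2<q
  open KernelComparison q p-prime 2<q n

theorem3p3 : (m n : ℕ) → 1 ≤ m → 1 ≤ n →
    ∃[ N ] ((p : ℕ) → Prime p → N < p → R n m p p ≡ℚ RHS n m p [mod p ])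
theorem3p3 m n 1≤m _ = 3 ℕ.+ (n ℕ.+ m) , λ { (suc q) p-prime N<p → congruence m n q p-prime 1≤m (ℕ.s≤s⁻¹ N<p) }
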